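{- Let $u\in\{0,1\}^+$ be a nonempty finite binary word. Then $\mu(u)\leq 3$ if and only if $u$ is a factor of a double Sturmian word.
   Context: For a finite word $u=u_1u_2\cdots u_n$ over an alphabet $\mathbb{A}$ and $1\le i\le j\le n$, write $u[i,j]=u_iu_{i+1}\cdots u_j$, and let $\mathcal{S}(n)=\{(i,j)\mid 1\le i\le j\le n\}$. Let $\mathrm{alph}(u)$ be the set of letters occurring in $u$. A set $S\subseteq\mathcal{S}(n)$ palindromically generates $u\in\mathbb{A}^n$ if (1) $u[i,j]$ is a palindrome for every $(i,j)\in S$, and (2) for every nonempty set $\mathbb{B}$ and every $v\in\mathbb{B}^n$ such that $v[i,j]$ is a palindrome for all $(i,j)\in S$, there is a map $c\colon\mathrm{alph}(u)\to\mathbb{B}$ whose extension to a morphism of words satisfies $c(u)=v$. Define $\mu(u)=\inf\{\#S\mid S\subseteq\mathcal{S}(|u|)\text{ palindromically generates }u\}$, with $\inf\emptyset=+\infty$. An infinite word $x\in\{0,1\}^{\mathbb N}$ is Sturmian if it has exactly $m+1$ distinct factors of each length $m\ge1$. For $A\subseteq\{0,1\}$, the doubling morphism $d_A\colon\{0,1\}^*\to\{0,1\}^*$ is given by $d_A(a)=aa$ if $a\in A$ and $d_A(a)=a$ if $a\notin A$ (extended to infinite words letterwise). An infinite word $y\in\{0,1\}^{\mathbb N}$ is double Sturmian if $y$ is a suffix of $d_A(x)$ for some Sturmian word $x$ and some $A\subseteq\{0,1\}$. -}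

module Defs where

open import Data.Bool using (Bool; true; false)
open import Data.Nat using (ℕ; zero; suc; _+_; _∸_; _≤_)
open import Data.List using (List; []; _∷_; length; map; reverse; take; drop; upTo)
open import Data.List.Relation.Unary.All using (All)
open import Data.List.Relation.Unary.Unique.Propositional using (Unique)
open import Data.List.Membership.Propositional using (_∈_)
open import Data.Product using (Σ; ∃; _×_; _,_)
open import Function.Bundles using (_⇔_)
open import Relation.Binary.PropositionalEquality using (_≡_)

-- Binary alphabet {0,1} is represented by Bool (false = 0, true = 1).
-- Finite words are lists; infinite words are functions ℕ → Bool (0-indexed).

Palindrome : {B : Set} → List B → Set
Palindrome w = reverse w ≡ w

-- u[i,j] = u_i ⋯ u_j with 1-based indices (1 ≤ i ≤ j ≤ |u|)
factor : {B : Set} → List B → ℕ → ℕ → List B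
factor u i j = take (suc (j ∸ i)) (drop (i ∸ 1) u)

InS : ℕ → ℕ × ℕ → Set
InS n (i , j) = (1 ≤ i) × (i ≤ j) × (j ≤ n)

PalAt : {B : Set} → List B → ℕ × ℕ → Set
PalAt v (i , j) = Palindrome (factor v i j)

-- S palindromically generates u  (S a duplicate-free list, i.e. a finite set)
PalGenerates : List (ℕ × ℕ) → List Bool → Set₁
PalGenerates S u =
  All (InS (length u)) S ×
  All (PalAt u) S ×
  ((B : Set) → B →                               -- every nonempty set B
   (v : List B) → length v ≡ length u →
   All (PalAt v) S →
   Σ (Bool → B) λ c → map c u ≡ v)

-- μ(u) ≤ k : some set S ⊆ 𝒮(|u|) with #S ≤ k palindromically generates u
-- (the infimum over a subset of ℕ is ≤ k iff attained by some element ≤ k)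
MuLe : List Bool → ℕ → Set₁
MuLe u k = Σ (List (ℕ × ℕ)) λ S → Unique S × length S ≤ k × PalGenerates S u

factorAt : (ℕ → Bool) → ℕ → ℕ → List Bool
factorAt x k m = map (λ i → x (k + i)) (upTo m)

IsFactor : List Bool → (ℕ → Bool) → Set
IsFactor w x = ∃ λ k → factorAt x k (length w) ≡ w

IsFactorLen : (ℕ → Bool) → ℕ → List Bool → Set
IsFactorLen x m w = ∃ λ k → factorAt x k m ≡ w

Sturmian : (ℕ → Bool) → Set
Sturmian x = (m : ℕ) → 1 ≤ m →
  Σ (List (List Bool)) λ L →
    length L ≡ suc m × Unique L × ((w : List Bool) → (w ∈ L) ⇔ IsFactorLen x m w)

-- doubling morphism d_A on infinite words; A ⊆ {0,1} given by its
-- characteristic function A : Bool → Bool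
mutual
  dbl : (Bool → Bool) → (ℕ → Bool) → ℕ → Bool
  dbl A x zero = x zero
  dbl A x (suc n) = dblStep A x (A (x zero)) n

  dblStep : (Bool → Bool) → (ℕ → Bool) → Bool → ℕ → Bool
  dblStep A x true zero = x zero
  dblStep A x true (suc n) = dbl A (λ i → x (suc i)) n
  dblStep A x false n = dbl A (λ i → x (suc i)) n

DoubleSturmian : (ℕ → Bool) → Set
DoubleSturmian y =
  Σ (ℕ → Bool) λ x → Σ (Bool → Bool) λ A → Σ ℕ λ k →
    Sturmian x × ((n : ℕ) → y n ≡ dbl A x (k + n))

FactorOfDoubleSturmian : List Bool → Set
FactorOfDoubleSturmian u = Σ (ℕ → Bool) λ y → DoubleSturmian y × IsFactor u y

{-# OPTIONS --safe #-}

-- Finite double Sturmian words are the factors of d_A(w) with w a central word, where the central word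
-- with directive word aD is a τ_a(w′) for w′ the one of D (Justin's formula).
--
-- A central word w comes with two return words t and s such that w, wt and ws are palindromes. The
-- palindromic prefixes of lengths |w|, |w| − |t|, |w| − |s| generate it, doubled or not, by induction on
-- the directive word. Generation by three palindromes passes to factors: before the last position is
-- deleted, the palindromes ending there are reflected in the longest one, which then merely shrinks.
--
-- Conversely, if S generates u, every word v with the palindromes S is a renaming of u, so a nonconstant
-- double Sturmian v suffices. A reflection turns one interval into the whole word; unless a residue word
-- such as (0…01)^ω avoids the third interval, a central window carries two periods p, q, and Euclid's
-- algorithm on (p, q), with parity deciding which letters are doubled, yields a central word.
--
-- A word is Sturmian iff it has exactly one right special factor of each length. This property passes
-- through τ_a in both directions, which links central words with infinite Sturmian ones.

module Submission where

open import Defs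
open import Data.Bool using (Bool; true; false; not; if_then_else_; _∧_; T)
open import Data.Bool.Properties using (not-involutive; not-¬) renaming (_≟_ to _≟ᵇ_)
open import Data.Empty using (⊥; ⊥-elim)
open import Data.List using (List; []; _∷_; _++_; _∷ʳ_; [_]; length; map; reverse; take; drop; upTo; applyUpTo;
  concatMap; replicate; deduplicate)
open import Data.List.Membership.Propositional using (_∈_; _∉_)
open import Data.List.Membership.Propositional.Properties using (∈-++⁺ˡ; ∈-++⁺ʳ; ∈-++⁻; ∈-∃++)
open import Data.List.Properties renaming (≡-dec to ≡ᴸ-dec)
open import Data.List.Relation.Unary.All as All using (All; []; _∷_)
open import Data.List.Relation.Unary.All.Properties as Allₚ using ()
open import Data.List.Relation.Unary.Any as Any using (here; there)
open import Data.List.Relation.Unary.Unique.Propositional using (Unique; []; _∷_)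
open import Data.List.Reverse using (Reverse; reverseView; []; _∶_∶ʳ_)
open import Data.Nat using (ℕ; zero; suc; pred; _+_; _*_; _∸_; _≤_; _<_; z≤n; s≤s; z<s; _<ᵇ_; _≡ᵇ_; _≟_; _≤?_;
  _<?_; NonZero; >-nonZero)
open import Data.Nat.DivMod using (_%_; _/_; m≡m%n+[m/n]*n; m%n<n)
open import Data.Nat.Properties hiding (_≟_; _≤?_; _<?_)
open import Data.Product using (Σ; ∃; ∃₂; _×_; _,_; proj₁; proj₂)
open import Data.Product.Properties renaming (≡-dec to ×-≡-dec) using ()
open import Data.Sum using (_⊎_; inj₁; inj₂; [_,_]′)
open import Data.Unit using (⊤; tt)
open import Function using (_∘_; id; case_of_)
open import Function.Bundles using (_⇔_; mk⇔; Equivalence)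
open import Relation.Binary using (tri<; tri≈; tri>)
open import Relation.Binary.PropositionalEquality hiding ([_])
open import Relation.Nullary using (¬_; Dec; yes; no; does; contradiction)

-- Linear arithmetic over ℕ by certificates

-- The obstacle in the converse is parity. A central word with coprime periods p and q has length p
-- + q - 2, while the palindromes prescribe a length n, and one word can be centred in another only
-- if the two lengths have the same parity. Doubling neither, one or both letters replaces the
-- defect 2 by 2, 3 or 4, and this is how doubling enters. If the periods have a common divisor,
-- residue words with that divisor as period take over, and their letter 1 is single or double,
-- again according to parity. The one mixed case is a common divisor 2 with an even defect, which is
-- met by doubling both letters. Words are treated as functions on ℕ, and a palindrome as the
-- equations v k = v l for all k, l in it with a given sum. Every composition of reflections and
-- translations then turns into linear conditions on positions, and these are what the certificates
-- below dispose of.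

infix  4 _≼_by_ _≃_by_ _≈_by_
infix  6 _·_ _∙_
infixl 7 _:*_
infixl 6 _:+_

-- Variables are positions in the list ρ supplied with each call. Products are kept as sorted
-- monomials, so a certificate is linear in monomials, and a term such as `e * g` serves as one more
-- unknown.
data Exp : Set where
  #_   : ℕ → Exp
  κ    : ℕ → Exp
  _:+_ : Exp → Exp → Exp
  _:*_ : Exp → Exp → Exp

infixr 8 #_ 1+_

1+_ : Exp → Exp
1+ e = κ 1 :+ e

at : List ℕ → ℕ → ℕ
at []       _       = 0
at (x ∷ ρ) zero    = x
at (x ∷ ρ) (suc i) = at ρ i

⟦_⟧ : Exp → List ℕ → ℕ
⟦ # i ⟧    ρ = at ρ i
⟦ κ c ⟧    ρ = c
⟦ a :+ b ⟧ ρ = ⟦ a ⟧ ρ + ⟦ b ⟧ ρ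
⟦ a :* b ⟧ ρ = ⟦ a ⟧ ρ * ⟦ b ⟧ ρ

Monomial : Set
Monomial = List ℕ

Poly : Set
Poly = List (ℕ × Monomial)

insert : ℕ → Monomial → Monomial
insert i []       = i ∷ []
insert i (j ∷ m) = if i <ᵇ j then i ∷ j ∷ m else j ∷ insert i m

mulMono : Monomial → Monomial → Monomial
mulMono []       m = m
mulMono (i ∷ l) m = insert i (mulMono l m)

scale : ℕ → Monomial → Poly → Poly
scale c l []            = []
scale c l ((d , m) ∷ p) = (c * d , mulMono l m) ∷ scale c l p

mulPoly : Poly → Poly → Poly
mulPoly []            q = []
mulPoly ((c , l) ∷ p) q = scale c l q ++ mulPoly p q

poly : Exp → Poly
poly (# i)    = (1 , i ∷ []) ∷ []
poly (κ c)    = (c , []) ∷ []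
poly (a :+ b) = poly a ++ poly b
poly (a :* b) = mulPoly (poly a) (poly b)

module _ (ρ : List ℕ) where

  monoVal : Monomial → ℕ
  monoVal []       = 1
  monoVal (i ∷ m) = at ρ i * monoVal m

  polyVal : Poly → ℕ
  polyVal []            = 0
  polyVal ((c , m) ∷ p) = c * monoVal m + polyVal p

  polyVal-++ : ∀ p q → polyVal (p ++ q) ≡ polyVal p + polyVal q
  polyVal-++ []            q = refl
  polyVal-++ ((c , m) ∷ p) q =
    trans (cong (c * monoVal m +_) (polyVal-++ p q)) (sym (+-assoc (c * monoVal m) _ _))

  insert-val : ∀ i m → monoVal (insert i m) ≡ at ρ i * monoVal m
  insert-val i []       = refl
  insert-val i (j ∷ m) with i <ᵇ j
  ... | true  = refl
  ... | false = trans (cong (at ρ j *_) (insert-val i m))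
                (trans (sym (*-assoc (at ρ j) (at ρ i) _))
                (trans (cong (_* monoVal m) (*-comm (at ρ j) (at ρ i))) (*-assoc (at ρ i) _ _)))

  mulMono-val : ∀ l m → monoVal (mulMono l m) ≡ monoVal l * monoVal m
  mulMono-val []       m = sym (+-identityʳ _)
  mulMono-val (i ∷ l) m = trans (insert-val i (mulMono l m))
    (trans (cong (at ρ i *_) (mulMono-val l m)) (sym (*-assoc (at ρ i) _ _)))

  scale-val : ∀ c l p → polyVal (scale c l p) ≡ c * monoVal l * polyVal p
  scale-val c l []            = sym (*-zeroʳ (c * monoVal l))
  scale-val c l ((d , m) ∷ p) = begin
    c * d * monoVal (mulMono l m) + polyVal (scale c l p)
      ≡⟨ cong₂ _+_ (cong (c * d *_) (mulMono-val l m)) (scale-val c l p) ⟩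
    c * d * (monoVal l * monoVal m) + c * monoVal l * polyVal p
      ≡⟨ cong (_+ c * monoVal l * polyVal p) ([m*n]*[o*p]≡[m*o]*[n*p] c d (monoVal l) _) ⟩
    c * monoVal l * (d * monoVal m) + c * monoVal l * polyVal p
      ≡⟨ sym (*-distribˡ-+ (c * monoVal l) _ _) ⟩
    c * monoVal l * (d * monoVal m + polyVal p) ∎
    where open ≡-Reasoning

  mulPoly-val : ∀ p q → polyVal (mulPoly p q) ≡ polyVal p * polyVal q
  mulPoly-val []            q = refl
  mulPoly-val ((c , l) ∷ p) q = begin
    polyVal (scale c l q ++ mulPoly p q)              ≡⟨ polyVal-++ (scale c l q) _ ⟩
    polyVal (scale c l q) + polyVal (mulPoly p q)     ≡⟨ cong₂ _+_ (scale-val c l q) (mulPoly-val p q) ⟩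
    c * monoVal l * polyVal q + polyVal p * polyVal q ≡⟨ sym (*-distribʳ-+ (polyVal q) (c * monoVal l) _) ⟩
    (c * monoVal l + polyVal p) * polyVal q           ∎
    where open ≡-Reasoning

  poly-val : ∀ e → polyVal (poly e) ≡ ⟦ e ⟧ ρ
  poly-val (# i)    = trans (+-identityʳ _) (trans (+-identityʳ _) (*-identityʳ _))
  poly-val (κ c)    = trans (+-identityʳ _) (*-identityʳ c)
  poly-val (a :+ b) = trans (polyVal-++ (poly a) (poly b)) (cong₂ _+_ (poly-val a) (poly-val b))
  poly-val (a :* b) = trans (mulPoly-val (poly a) (poly b)) (cong₂ _*_ (poly-val a) (poly-val b))

sameMono : Monomial → Monomial → Bool
sameMono []       []       = true
sameMono (i ∷ l) (j ∷ m) = (i ≡ᵇ j) ∧ sameMono l m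
sameMono _        _        = false

sameMono-≡ : ∀ l m → T (sameMono l m) → l ≡ m
sameMono-≡ []       []       _ = refl
sameMono-≡ (i ∷ l) (j ∷ m) t with i ≡ᵇ j in eq
... | true = cong₂ _∷_ (≡ᵇ⇒≡ i j (subst T (sym eq) _)) (sameMono-≡ l m t)

data Removal : Set where
  fail : Removal
  ok   : Poly → Removal

keep : ℕ × Monomial → Removal → Removal
keep t fail   = fail
keep t (ok p) = ok (t ∷ p)

-- Like terms are never collected in a `Poly`, so the amount to subtract may have to be gathered
-- from several terms.
remove : ℕ → Monomial → Poly → Removal
remove zero    m p             = ok p
remove (suc c) m []            = fail
remove (suc c) m ((d , l) ∷ p) =
  if sameMono m l
  then (if d <ᵇ suc c then remove (suc c ∸ d) m p else ok ((d ∸ suc c , l) ∷ p))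
  else keep (d , l) (remove (suc c) m p)

_covers_ : Poly → Poly → Bool
p covers []            = true
p covers ((c , m) ∷ q) with remove c m p
... | fail  = false
... | ok p′ = p′ covers q

module _ (ρ : List ℕ) where

  remove-val : ∀ c m p {q} → remove c m p ≡ ok q → c * monoVal ρ m + polyVal ρ q ≡ polyVal ρ p
  remove-val zero    m p             refl = refl
  remove-val (suc c) m ((d , l) ∷ p) {q} eq with sameMono m l in same
  ... | false with remove (suc c) m p in rem
  remove-val (suc c) m ((d , l) ∷ p) refl | false | ok q =
    trans (sym (+-assoc (suc c * monoVal ρ m) _ _))
    (trans (cong (_+ polyVal ρ q) (+-comm (suc c * monoVal ρ m) (d * monoVal ρ l)))
    (trans (+-assoc (d * monoVal ρ l) _ _) (cong (d * monoVal ρ l +_) (remove-val (suc c) m p rem))))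
  remove-val (suc c) m ((d , l) ∷ p) {q} eq | true with sameMono-≡ m l (subst T (sym same) _)
  ... | refl with d <ᵇ suc c in lt
  remove-val (suc c) m ((d , l) ∷ p) {q} eq | true | refl | true = begin
    suc c * M + polyVal ρ q               ≡⟨ cong (λ e → e * M + polyVal ρ q) (sym (m+[n∸m]≡n d≤c)) ⟩
    (d + (suc c ∸ d)) * M + polyVal ρ q   ≡⟨ cong (_+ polyVal ρ q) (*-distribʳ-+ M d _) ⟩
    d * M + (suc c ∸ d) * M + polyVal ρ q ≡⟨ +-assoc (d * M) _ _ ⟩
    d * M + ((suc c ∸ d) * M + polyVal ρ q) ≡⟨ cong (d * M +_) (remove-val (suc c ∸ d) m p eq) ⟩
    d * M + polyVal ρ p                   ∎
    where
    open ≡-Reasoning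
    M = monoVal ρ m
    d≤c : d ≤ suc c
    d≤c = <⇒≤ (<ᵇ⇒< d (suc c) (subst T (sym lt) _))
  remove-val (suc c) m ((d , l) ∷ p) refl | true | refl | false = begin
    suc c * M + ((d ∸ suc c) * M + polyVal ρ p) ≡⟨ sym (+-assoc (suc c * M) _ _) ⟩
    suc c * M + (d ∸ suc c) * M + polyVal ρ p   ≡⟨ cong (_+ polyVal ρ p) (sym (*-distribʳ-+ M (suc c) _)) ⟩
    (suc c + (d ∸ suc c)) * M + polyVal ρ p     ≡⟨ cong (λ e → e * M + polyVal ρ p) (m+[n∸m]≡n c<d) ⟩
    d * M + polyVal ρ p                         ∎
    where
    open ≡-Reasoning
    M = monoVal ρ m
    c<d : suc c ≤ d
    c<d = ≮⇒≥ λ d<c → subst T lt (<⇒<ᵇ d<c)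

  covers-≤ : ∀ p q → T (p covers q) → polyVal ρ q ≤ polyVal ρ p
  covers-≤ p []            _ = z≤n
  covers-≤ p ((c , m) ∷ q) t with remove c m p in rem
  ... | ok p′ = ≤-trans (+-monoʳ-≤ (c * monoVal ρ m) (covers-≤ p′ q t)) (≤-reflexive (remove-val c m p rem))

record Inequality (ρ : List ℕ) : Set where
  constructor _≼_by_
  field
    small large : Exp
    proof       : ⟦ small ⟧ ρ ≤ ⟦ large ⟧ ρ

record Equation (ρ : List ℕ) : Set where
  constructor _≈_by_
  field
    left right : Exp
    proof      : ⟦ left ⟧ ρ ≡ ⟦ right ⟧ ρ

_≃_by_ : ∀ {ρ} a b → ⟦ a ⟧ ρ ≡ ⟦ b ⟧ ρ → Inequality ρ
a ≃ b by e = a ≼ b by ≤-reflexive e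

_·_ : ∀ {ρ} → ℕ → Inequality ρ → Inequality ρ
c · (a ≼ b by h) = κ c :* a ≼ κ c :* b by *-monoʳ-≤ c h

sumSmall sumLarge : ∀ {ρ} → List (Inequality ρ) → Exp
sumSmall []                  = κ 0
sumSmall ((a ≼ b by _) ∷ hs) = a :+ sumSmall hs
sumLarge []                  = κ 0
sumLarge ((a ≼ b by _) ∷ hs) = b :+ sumLarge hs

sum-≤ : ∀ {ρ} (hs : List (Inequality ρ)) → ⟦ sumSmall hs ⟧ ρ ≤ ⟦ sumLarge hs ⟧ ρ
sum-≤ []                  = z≤n
sum-≤ ((a ≼ b by h) ∷ hs) = +-mono-≤ h (sum-≤ hs)

-- The hypotheses are added up and compared coefficient by coefficient. The comparison does not
-- depend on ρ, so its implicit proof is found by evaluation.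
contra : ∀ ρ (hs : List (Inequality ρ)) {_ : T (poly (sumSmall hs) covers poly (κ 1 :+ sumLarge hs))} → ⊥
contra ρ hs {t} = <-irrefl refl (<-≤-trans strict (sum-≤ hs))
  where
  strict : ⟦ sumLarge hs ⟧ ρ < ⟦ sumSmall hs ⟧ ρ
  strict = subst₂ _≤_ (poly-val ρ (κ 1 :+ sumLarge hs)) (poly-val ρ (sumSmall hs))
                  (covers-≤ ρ (poly (sumSmall hs)) (poly (κ 1 :+ sumLarge hs)) t)

-- Farkas certificates: N times the negated goal b + 1 ≤ a joins the hypotheses hs.
farkas′ : ∀ N ρ (hs : List (Inequality ρ)) (a b : Exp)
  {_ : T (poly (κ N :* (κ 1 :+ b) :+ sumSmall hs) covers poly (κ 1 :+ (κ N :* a :+ sumLarge hs)))} →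
  ⟦ a ⟧ ρ ≤ ⟦ b ⟧ ρ
farkas′ N ρ hs a b {t} = ≮⇒≥ λ b<a → contra ρ (N · (κ 1 :+ b ≼ a by b<a) ∷ hs) {t}

farkas : ∀ ρ (hs : List (Inequality ρ)) (a b : Exp)
  {_ : T (poly (κ 1 :* (κ 1 :+ b) :+ sumSmall hs) covers poly (κ 1 :+ (κ 1 :* a :+ sumLarge hs)))} →
  ⟦ a ⟧ ρ ≤ ⟦ b ⟧ ρ
farkas ρ hs a b {t} = farkas′ 1 ρ hs a b {t}

_∙_ : ∀ {ρ} → ℕ → Equation ρ → Equation ρ
c ∙ (a ≈ b by e) = κ c :* a ≈ κ c :* b by cong (c *_) e

sumLeft sumRight : ∀ {ρ} → List (Equation ρ) → Exp
sumLeft  []                  = κ 0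
sumLeft  ((a ≈ b by _) ∷ es) = a :+ sumLeft es
sumRight []                  = κ 0
sumRight ((a ≈ b by _) ∷ es) = b :+ sumRight es

sum-≡ : ∀ {ρ} (es : List (Equation ρ)) → ⟦ sumLeft es ⟧ ρ ≡ ⟦ sumRight es ⟧ ρ
sum-≡ []                  = refl
sum-≡ ((a ≈ b by e) ∷ es) = cong₂ _+_ e (sum-≡ es)

-- Covering in both directions replaces a canonical form for polynomials; afterwards the given
-- equations and the factor N are cancelled.
combine′ : ∀ N .{{_ : NonZero N}} ρ (es : List (Equation ρ)) (a b : Exp) →
  let l = poly (κ N :* a :+ sumRight es) ; r = poly (κ N :* b :+ sumLeft es) in
  {_ : T (l covers r)} {_ : T (r covers l)} → ⟦ a ⟧ ρ ≡ ⟦ b ⟧ ρ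
combine′ N ρ es a b {s} {t} = *-cancelˡ-≡ _ _ N (+-cancelʳ-≡ (⟦ sumLeft es ⟧ ρ) _ _
  (trans (cong (N * ⟦ a ⟧ ρ +_) (sum-≡ es))
  (trans (sym (poly-val ρ l))
    (trans (≤-antisym (covers-≤ ρ (poly r) (poly l) t) (covers-≤ ρ (poly l) (poly r) s)) (poly-val ρ r)))))
  where
  l r : Exp
  l = κ N :* a :+ sumRight es
  r = κ N :* b :+ sumLeft es

combine : ∀ ρ (es : List (Equation ρ)) (a b : Exp) →
  let l = poly (κ 1 :* a :+ sumRight es) ; r = poly (κ 1 :* b :+ sumLeft es) in
  {_ : T (l covers r)} {_ : T (r covers l)} → ⟦ a ⟧ ρ ≡ ⟦ b ⟧ ρ
combine ρ es a b {s} {t} = combine′ 1 ρ es a b {s} {t}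

-- Words, the morphisms τ and central words

-- Total lookup makes a function on ℕ out of a list. The default b is met only beyond the end, where
-- no palindrome condition looks.
nth : {B : Set} → B → List B → ℕ → B
nth b []       _       = b
nth b (x ∷ xs) zero    = x
nth b (x ∷ xs) (suc k) = nth b xs k

module _ {B : Set} (b : B) where

  nth-++ˡ : ∀ xs ys {k} → k < length xs → nth b (xs ++ ys) k ≡ nth b xs k
  nth-++ˡ (x ∷ xs) ys {zero}  _       = refl
  nth-++ˡ (x ∷ xs) ys {suc k} (s≤s h) = nth-++ˡ xs ys h

  nth-++ʳ : ∀ xs ys k → nth b (xs ++ ys) (length xs + k) ≡ nth b ys k
  nth-++ʳ []       ys k = refl
  nth-++ʳ (x ∷ xs) ys k = nth-++ʳ xs ys k

  nth-++ʳ′ : ∀ xs ys {k l} → k ≡ length xs + l → nth b (xs ++ ys) k ≡ nth b ys l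
  nth-++ʳ′ xs ys {l = l} refl = nth-++ʳ xs ys l

  nth-ext : ∀ xs ys → length xs ≡ length ys → (∀ k → k < length xs → nth b xs k ≡ nth b ys k) → xs ≡ ys
  nth-ext []       []       _  _ = refl
  nth-ext (x ∷ xs) (y ∷ ys) eq h =
    cong₂ _∷_ (h 0 z<s) (nth-ext xs ys (suc-injective eq) λ k lt → h (suc k) (s≤s lt))

  nth-reverse : ∀ xs k l → suc (k + l) ≡ length xs → nth b (reverse xs) k ≡ nth b xs l
  nth-reverse (x ∷ xs) k zero eq = trans (cong (λ ys → nth b ys k) (unfold-reverse x xs))
    (nth-++ʳ′ (reverse xs) [ x ] (combine (k ∷ length (reverse xs) ∷ length xs ∷ [])
      ((1+ (# 0 :+ κ 0) ≈ 1+ # 2 by eq) ∷ (# 2 ≈ # 1 by sym (length-reverse xs)) ∷ [])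
      (# 0) (# 1 :+ κ 0)))
  nth-reverse (x ∷ xs) k (suc l) eq = trans (cong (λ ys → nth b ys k) (unfold-reverse x xs))
    (trans (nth-++ˡ (reverse xs) [ x ] (farkas (k ∷ length (reverse xs) ∷ l ∷ length xs ∷ [])
      ((1+ (# 0 :+ 1+ # 2) ≃ 1+ # 3 by eq) ∷ (# 3 ≃ # 1 by sym (length-reverse xs)) ∷ [])
      (1+ # 0) (# 1)))
           (nth-reverse xs k l (combine (k ∷ l ∷ length xs ∷ [])
             ((1+ (# 0 :+ 1+ # 1) ≈ 1+ # 2 by eq) ∷ []) (1+ (# 0 :+ # 1)) (# 2))))

  nth-applyUpTo : ∀ (v : ℕ → B) {n k} → k < n → nth b (applyUpTo v n) k ≡ v k
  nth-applyUpTo v {suc n} {zero}  _       = refl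
  nth-applyUpTo v {suc n} {suc k} (s≤s h) = nth-applyUpTo (v ∘ suc) h

  nth-drop : ∀ i xs k → nth b (drop i xs) k ≡ nth b xs (i + k)
  nth-drop zero    xs       k = refl
  nth-drop (suc i) []       k = refl
  nth-drop (suc i) (x ∷ xs) k = nth-drop i xs k

  nth-take : ∀ m xs k → k < m → nth b (take m xs) k ≡ nth b xs k
  nth-take (suc m) []       k       _       = refl
  nth-take (suc m) (x ∷ xs) zero    _       = refl
  nth-take (suc m) (x ∷ xs) (suc k) (s≤s h) = nth-take m xs k h

  applyUpTo-nth : ∀ n xs → n ≤ length xs → applyUpTo (nth b xs) n ≡ take n xs
  applyUpTo-nth zero    xs       _       = refl
  applyUpTo-nth (suc n) (x ∷ xs) (s≤s h) = cong (x ∷_) (applyUpTo-nth n xs h)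

  nth-All : ∀ {P : B → Set} {xs} → All P xs → ∀ {k} → k < length xs → P (nth b xs k)
  nth-All (p ∷ ps) {zero}  _       = p
  nth-All (p ∷ ps) {suc k} (s≤s h) = nth-All ps h

  nth-map : ∀ {A : Set} (a : A) (f : A → B) xs {k} → k < length xs → nth b (map f xs) k ≡ f (nth a xs k)
  nth-map a f (x ∷ xs) {zero}  _       = refl
  nth-map a f (x ∷ xs) {suc k} (s≤s h) = nth-map a f xs h

applyUpTo-cong : {B : Set} {v w : ℕ → B} → ∀ n → (∀ k → k < n → v k ≡ w k) → applyUpTo v n ≡ applyUpTo w n
applyUpTo-cong zero    h = refl
applyUpTo-cong (suc n) h = cong₂ _∷_ (h 0 z<s) (applyUpTo-cong n λ k lt → h (suc k) (s≤s lt))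

infix 4 _⊑_

_⊑_ : {B : Set} → List B → List B → Set
u ⊑ w = ∃₂ λ x y → w ≡ x ++ (u ++ y)

⊑-refl : {B : Set} (u : List B) → u ⊑ u
⊑-refl u = [] , [] , sym (++-identityʳ u)

⊑-trans : {B : Set} {u v w : List B} → u ⊑ v → v ⊑ w → u ⊑ w
⊑-trans {u = u} (x , y , refl) (x′ , y′ , refl) = x′ ++ x , y ++ y′ ,
  trans (cong (x′ ++_) (trans (++-assoc x (u ++ y) y′) (cong (x ++_) (++-assoc u y y′))))
    (sym (++-assoc x′ x _))

⊑-concatMap : {A B : Set} (f : A → List B) {u w : List A} → u ⊑ w → concatMap f u ⊑ concatMap f w
⊑-concatMap f {u} (x , y , refl) = concatMap f x , concatMap f y ,
  trans (concatMap-++ f x _) (cong (concatMap f x ++_) (concatMap-++ f u y))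

⊑-map : {A B : Set} (f : A → B) {u w : List A} → u ⊑ w → map f u ⊑ map f w
⊑-map f {u} (x , y , refl) = map f x , map f y ,
  trans (map-++ f x _) (cong (map f x ++_) (map-++ f u y))

drop-⊑ : {B : Set} → ∀ o (xs : List B) → drop o xs ⊑ xs
drop-⊑ o xs = take o xs , [] , sym (trans (cong (take o xs ++_) (++-identityʳ _)) (take++drop≡id o xs))

take-⊑ : {B : Set} → ∀ n (xs : List B) → take n xs ⊑ xs
take-⊑ n xs = [] , drop n xs , sym (take++drop≡id n xs)

window-⊑ : {B : Set} (b : B) → ∀ w o n → o + n ≤ length w → applyUpTo (λ k → nth b w (o + k)) n ⊑ w
window-⊑ b w o n h = subst (_⊑ w) (sym eq) (⊑-trans (take-⊑ n (drop o w)) (drop-⊑ o w))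
  where
  eq : applyUpTo (λ k → nth b w (o + k)) n ≡ take n (drop o w)
  eq = trans (applyUpTo-cong n λ k _ → sym (nth-drop b o w k))
    (applyUpTo-nth b n (drop o w) (subst (n ≤_) (sym (length-drop o w))
      (subst (_≤ length w ∸ o) (m+n∸m≡n o n) (∸-monoˡ-≤ o h))))

doubled : (Bool → Bool) → Bool → List Bool
doubled A c = if A c then c ∷ c ∷ [] else c ∷ []

double : (Bool → Bool) → List Bool → List Bool
double A = concatMap (doubled A)

-- With `not a` in front of a, the word `a ∷ τ a z` is also the image of z under the conjugate
-- morphism a ↦ a, not a ↦ a (not a), followed by a. The first reading serves the directive words,
-- the second the infinite words of `Image`.
block : Bool → Bool → List Bool
block false false = false ∷ []
block false true  = true ∷ false ∷ []
block true  true  = true ∷ []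
block true  false = false ∷ true ∷ []

τ : Bool → List Bool → List Bool
τ a = concatMap (block a)

-- img D false and img D true are the return words by which W D extends (see W-∷ʳ).
img : List Bool → Bool → List Bool
img []      c = c ∷ []
img (a ∷ D) c = τ a (img D c)

-- Justin's formula for the central word with a given directive word.
W : List Bool → List Bool
W []      = []
W (a ∷ D) = a ∷ τ a (W D)

-- The last letter of a directive word acts first, so `img (D ∷ʳ a) c` is composed of the words
-- `img D` of the letters of `block a c`. This recursion at the right end carries all inductions on
-- directive words below.
img-∷ʳ-same : ∀ D a → img (D ∷ʳ a) a ≡ img D a
img-∷ʳ-same []      false = refl
img-∷ʳ-same []      true  = refl
img-∷ʳ-same (b ∷ D) a     = cong (τ b) (img-∷ʳ-same D a)

img-∷ʳ-other : ∀ D a → img (D ∷ʳ a) (not a) ≡ img D (not a) ++ img D a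
img-∷ʳ-other []      false = refl
img-∷ʳ-other []      true  = refl
img-∷ʳ-other (b ∷ D) a     = trans (cong (τ b) (img-∷ʳ-other D a))
  (concatMap-++ (block b) (img D (not a)) (img D a))

W-∷ʳ : ∀ D a → W (D ∷ʳ a) ≡ W D ++ img D a
W-∷ʳ []      a = refl
W-∷ʳ (b ∷ D) a = cong (b ∷_) (trans (cong (τ b) (W-∷ʳ D a)) (concatMap-++ (block b) (W D) (img D a)))

reverse-double : ∀ A w → reverse (double A w) ≡ double A (reverse w)
reverse-double A []      = refl
reverse-double A (c ∷ w) = trans (reverse-++ (doubled A c) (double A w))
  (trans (cong₂ _++_ (reverse-double A w) (flip-doubled c))
  (sym (trans (cong (double A) (unfold-reverse c w))
       (trans (concatMap-++ (doubled A) (reverse w) [ c ])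
         (cong (double A (reverse w) ++_) (++-identityʳ _))))))
  where
  flip-doubled : ∀ c → reverse (doubled A c) ≡ doubled A c
  flip-doubled c with A c
  ... | true  = refl
  ... | false = refl

-- Conjugation by a turns a reversed block into the block, so the a behind the word travels through
-- it and comes out in front.
reverse-τ : ∀ a w → reverse (τ a w) ∷ʳ a ≡ a ∷ τ a (reverse w)
reverse-τ a []      = refl
reverse-τ a (c ∷ w) = begin
  reverse (block a c ++ τ a w) ∷ʳ a              ≡⟨ cong (_∷ʳ a) (reverse-++ (block a c) (τ a w)) ⟩
  (reverse (τ a w) ++ reverse (block a c)) ∷ʳ a  ≡⟨ ++-assoc (reverse (τ a w)) _ _ ⟩
  reverse (τ a w) ++ (reverse (block a c) ∷ʳ a)  ≡⟨ cong (reverse (τ a w) ++_) (flip-block a c) ⟩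
  reverse (τ a w) ++ (a ∷ block a c)             ≡⟨ sym (++-assoc (reverse (τ a w)) [ a ] _) ⟩
  (reverse (τ a w) ∷ʳ a) ++ block a c            ≡⟨ cong (_++ block a c) (reverse-τ a w) ⟩
  a ∷ (τ a (reverse w) ++ block a c)             ≡⟨ cong (λ z → a ∷ (τ a (reverse w) ++ z))
    (sym (++-identityʳ (block a c))) ⟩
  a ∷ (τ a (reverse w) ++ τ a [ c ])             ≡⟨ cong (a ∷_)
    (sym (concatMap-++ (block a) (reverse w) [ c ])) ⟩
  a ∷ τ a (reverse w ∷ʳ c)                       ≡⟨ cong (λ z → a ∷ τ a z) (sym (unfold-reverse c w)) ⟩
  a ∷ τ a (reverse (c ∷ w))                      ∎
  where
  open ≡-Reasoning
  flip-block : ∀ a c → reverse (block a c) ∷ʳ a ≡ a ∷ block a c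
  flip-block false false = refl
  flip-block false true  = refl
  flip-block true  true  = refl
  flip-block true  false = refl

W-palindrome : ∀ D → reverse (W D) ≡ W D
W-palindrome []      = refl
W-palindrome (a ∷ D) = trans (unfold-reverse a (τ a (W D)))
  (trans (reverse-τ a (W D)) (cong (λ z → a ∷ τ a z) (W-palindrome D)))

-- Since `W D` is a palindrome, this makes `W D ++ img D c` a palindrome too; as a conjugacy it
-- makes the length of `img D c` a period.
W-img : ∀ D c → W D ++ img D c ≡ reverse (img D c) ++ W D
W-img []      c = refl
W-img (a ∷ D) c = begin
  a ∷ (τ a (W D) ++ τ a (img D c))             ≡⟨ cong (a ∷_) (sym (concatMap-++ (block a) (W D) _)) ⟩
  a ∷ τ a (W D ++ img D c)                     ≡⟨ cong (λ z → a ∷ τ a z) (W-img D c) ⟩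
  a ∷ τ a (reverse (img D c) ++ W D)           ≡⟨ cong (a ∷_) (concatMap-++ (block a) (reverse (img D c)) _) ⟩
  (a ∷ τ a (reverse (img D c))) ++ τ a (W D)   ≡⟨ cong (_++ τ a (W D)) (sym (reverse-τ a (img D c))) ⟩
  (reverse (τ a (img D c)) ∷ʳ a) ++ τ a (W D)  ≡⟨ ++-assoc (reverse (τ a (img D c))) [ a ] _ ⟩
  reverse (τ a (img D c)) ++ (a ∷ τ a (W D))   ∎
  where open ≡-Reasoning

WD : (Bool → Bool) → List Bool → List Bool
WD A D = double A (W D)

imgD : (Bool → Bool) → List Bool → Bool → List Bool
imgD A D c = double A (img D c)

module _ (A : Bool → Bool) (D : List Bool) where

  WD-palindrome : reverse (WD A D) ≡ WD A D
  WD-palindrome = trans (reverse-double A (W D)) (cong (double A) (W-palindrome D))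

  WD-img : ∀ c → WD A D ++ imgD A D c ≡ reverse (imgD A D c) ++ WD A D
  WD-img c = begin
    double A (W D) ++ double A (img D c)           ≡⟨ sym (concatMap-++ (doubled A) (W D) _) ⟩
    double A (W D ++ img D c)                      ≡⟨ cong (double A) (W-img D c) ⟩
    double A (reverse (img D c) ++ W D)            ≡⟨ concatMap-++ (doubled A) (reverse (img D c)) _ ⟩
    double A (reverse (img D c)) ++ double A (W D) ≡⟨ cong (_++ WD A D) (sym (reverse-double A (img D c))) ⟩
    reverse (double A (img D c)) ++ double A (W D) ∎
    where open ≡-Reasoning

  imgD-∷ʳ-same : ∀ a → imgD A (D ∷ʳ a) a ≡ imgD A D a
  imgD-∷ʳ-same a = cong (double A) (img-∷ʳ-same D a)

  imgD-∷ʳ-other : ∀ a → imgD A (D ∷ʳ a) (not a) ≡ imgD A D (not a) ++ imgD A D a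
  imgD-∷ʳ-other a = trans (cong (double A) (img-∷ʳ-other D a)) (concatMap-++ (doubled A) (img D (not a)) _)

  WD-∷ʳ : ∀ a → WD A (D ∷ʳ a) ≡ WD A D ++ imgD A D a
  WD-∷ʳ a = trans (cong (double A) (W-∷ʳ D a)) (concatMap-++ (doubled A) (W D) _)

  WD-∷ʳ-palindrome : ∀ a → reverse (WD A D ++ imgD A D a) ≡ WD A D ++ imgD A D a
  WD-∷ʳ-palindrome a = trans (reverse-++ (WD A D) _)
    (trans (cong (reverse (imgD A D a) ++_) WD-palindrome) (sym (WD-img a)))

snoc-induction : ∀ {ℓ} {B : Set} (P : List B → Set ℓ) → P [] → (∀ D a → P D → P (D ∷ʳ a)) → ∀ D → P D
snoc-induction P z s D = go (reverseView D)
  where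
  go : ∀ {D} → Reverse D → P D
  go []            = z
  go (D ∶ r ∶ʳ a) = s D a (go r)

-- The finite notion through which both directions of the theorem pass.
Central : List Bool → Set
Central u = ∃₂ λ A D → u ⊑ WD A D

-- Generation by palindromes

-- As k + l = i + j, the two lower bounds already imply k, l ≤ j. Sums instead of differences keep
-- truncated subtraction out of the palindrome conditions.
Sym : {B : Set} → ℕ × ℕ → (ℕ → B) → Set
Sym (i , j) v = ∀ k l → i ≤ k → i ≤ l → k + l ≡ i + j → v k ≡ v l

Valid : ℕ → ℕ × ℕ → Set
Valid n (i , j) = i ≤ j × j < n

Generates : ℕ → List (ℕ × ℕ) → (ℕ → Bool) → Set₁
Generates n S u = All (Valid n) S × All (λ I → Sym I u) S ×
  ((B : Set) (v : ℕ → B) → All (λ I → Sym I v) S → Σ (Bool → B) λ c → ∀ k → k < n → v k ≡ c (u k))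

-- MuLe (_ , 3) for words represented as functions on [0, n), with 0-based inclusive intervals.
Mu≤3 : ℕ → (ℕ → Bool) → Set₁
Mu≤3 n u = Σ (List (ℕ × ℕ)) λ S → length S ≤ 3 × Generates n S u

-- Translation between lists with 1-based intervals and functions with 0-based intervals

module _ {B : Set} (b : B) (v : List B) {i j : ℕ} (i≤j : i ≤ j) (j<n : j < length v) where
  private
    w : List B
    w = factor v (suc i) (suc j)

    m : ℕ
    m = suc (j ∸ i)

    i+m : i + m ≡ suc j
    i+m = combine (i ∷ (j ∸ i) ∷ j ∷ [])
      ((# 0 :+ # 1 ≈ # 2 by m+[n∸m]≡n i≤j) ∷ []) (# 0 :+ 1+ # 1) (1+ # 2)

    length-w : length w ≡ m
    length-w = trans (length-take m (drop i v)) (m≤n⇒m⊓n≡m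
      (subst (m ≤_) (sym (length-drop i v)) (subst (_≤ length v ∸ i)
        (trans (cong (_∸ i) (sym i+m)) (m+n∸m≡n i m)) (∸-monoˡ-≤ i j<n))))

    nth-w : ∀ k → k < m → nth b w k ≡ nth b v (i + k)
    nth-w k h = trans (nth-take b m (drop i v) k h) (nth-drop b i v k)

  PalAt⇒Sym : PalAt v (suc i , suc j) → Sym (i , j) (nth b v)
  PalAt⇒Sym pal k l i≤k i≤l eq = begin
    nth b v k                ≡⟨ cong (nth b v) (sym (m+[n∸m]≡n i≤k)) ⟩
    nth b v (i + (k ∸ i))    ≡⟨ sym (nth-w (k ∸ i) k<m) ⟩
    nth b w (k ∸ i)          ≡⟨ cong (λ z → nth b z (k ∸ i)) (sym pal) ⟩
    nth b (reverse w) (k ∸ i) ≡⟨ nth-reverse b w (k ∸ i) (l ∸ i) (trans kl (sym length-w)) ⟩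
    nth b w (l ∸ i)          ≡⟨ nth-w (l ∸ i) l<m ⟩
    nth b v (i + (l ∸ i))    ≡⟨ cong (nth b v) (m+[n∸m]≡n i≤l) ⟩
    nth b v l                ∎
    where
    open ≡-Reasoning
    kl : suc (k ∸ i + (l ∸ i)) ≡ m
    kl = combine ((k ∸ i) ∷ (l ∸ i) ∷ (j ∸ i) ∷ i ∷ k ∷ l ∷ j ∷ [])
      ((# 3 :+ # 0 ≈ # 4 by m+[n∸m]≡n i≤k) ∷ (# 3 :+ # 1 ≈ # 5 by m+[n∸m]≡n i≤l)
       ∷ (# 4 :+ # 5 ≈ # 3 :+ # 6 by eq) ∷ (# 6 ≈ # 3 :+ # 2 by sym (m+[n∸m]≡n i≤j)) ∷ [])
      (1+ # 0 :+ # 1) (1+ # 2)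
    k<m : k ∸ i < m
    k<m = subst (k ∸ i <_) kl (s≤s (m≤m+n _ _))
    l<m : l ∸ i < m
    l<m = subst (l ∸ i <_) kl (s≤s (m≤n+m _ _))

  Sym⇒PalAt : Sym (i , j) (nth b v) → PalAt v (suc i , suc j)
  Sym⇒PalAt s = nth-ext b (reverse w) w (length-reverse w) λ k k<r →
    same k (subst (k <_) (trans (length-reverse w) length-w) k<r)
    where
    same : ∀ k → k < m → nth b (reverse w) k ≡ nth b w k
    same k k<m = trans (nth-reverse b w k l (trans kl (sym length-w)))
      (trans (nth-w l (subst (l <_) kl (s≤s (m≤n+m _ _))))
      (trans (s (i + l) (i + k) (m≤m+n _ _) (m≤m+n _ _) (combine (i ∷ l ∷ k ∷ j ∷ (j ∸ i) ∷ [])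
        ((1+ (# 2 :+ # 1) ≈ 1+ # 4 by kl) ∷ (# 0 :+ # 4 ≈ # 3 by m+[n∸m]≡n i≤j) ∷ [])
        (# 0 :+ # 1 :+ (# 0 :+ # 2)) (# 0 :+ # 3)))
             (sym (nth-w k k<m))))
      where
      l : ℕ
      l = m ∸ suc k
      kl : suc (k + l) ≡ m
      kl = m+[n∸m]≡n k<m

Sym-cong : ∀ {m i j} {B : Set} {v w : ℕ → B} → j < m → (∀ k → k < m → v k ≡ w k) → Sym (i , j) v → Sym (i , j) w
Sym-cong {m} {i} {j} j<m eq s k l i≤k i≤l kl = trans (sym (eq k k<m)) (trans (s k l i≤k i≤l kl) (eq l l<m))
  where
  k<m : k < m
  k<m = farkas (k ∷ m ∷ j ∷ i ∷ l ∷ [])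
    ((1+ # 2 ≼ # 1 by j<m) ∷ (# 3 ≼ # 4 by i≤l) ∷ (# 0 :+ # 4 ≃ # 3 :+ # 2 by kl) ∷ [])
    (1+ # 0) (# 1)
  l<m : l < m
  l<m = farkas (l ∷ m ∷ j ∷ i ∷ k ∷ [])
    ((1+ # 2 ≼ # 1 by j<m) ∷ (# 3 ≼ # 4 by i≤k) ∷ (# 4 :+ # 0 ≃ # 3 :+ # 2 by kl) ∷ [])
    (1+ # 0) (# 1)

Syms-cong : ∀ {m S} {B : Set} {v w : ℕ → B} → All (Valid m) S →
  (∀ k → k < m → v k ≡ w k) → All (λ I → Sym I v) S → All (λ I → Sym I w) S
Syms-cong []              eq []       = []
Syms-cong ((_ , h) ∷ vs) eq (s ∷ ss) = Sym-cong h eq s ∷ Syms-cong vs eq ss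

module _ (u : List Bool) where
  private
    n : ℕ
    n = length u

    shift unshift : ℕ × ℕ → ℕ × ℕ
    shift   (i , j) = suc i , suc j
    unshift (i , j) = pred i , pred j

    InS⇒Valid : ∀ {S} → All (InS n) S → All (Valid n) (map unshift S) × S ≡ map shift (map unshift S)
    InS⇒Valid []                             = [] , refl
    InS⇒Valid ((s≤s z≤n , s≤s i≤j , j<n) ∷ h) =
      (i≤j , j<n) ∷ proj₁ (InS⇒Valid h) , cong (_ ∷_) (proj₂ (InS⇒Valid h))

    Valid⇒InS : ∀ {S} → All (Valid n) S → All (InS n) (map shift S)
    Valid⇒InS []                = []
    Valid⇒InS ((i≤j , j<n) ∷ h) = (s≤s z≤n , s≤s i≤j , j<n) ∷ Valid⇒InS h

    pals : ∀ {S} {B : Set} (b : B) (v : List B) → length v ≡ n → All (Valid n) S →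
      All (λ I → Sym I (nth b v)) S → All (PalAt v) (map shift S)
    pals b v eq []                []       = []
    pals b v eq ((i≤j , j<n) ∷ h) (p ∷ ps) = Sym⇒PalAt b v i≤j (subst (_ <_) (sym eq) j<n) p ∷ pals b v eq h ps

    syms : ∀ {S} {B : Set} (b : B) (v : List B) → length v ≡ n → All (Valid n) S →
      All (PalAt v) (map shift S) → All (λ I → Sym I (nth b v)) S
    syms b v eq []                []       = []
    syms b v eq ((i≤j , j<n) ∷ h) (p ∷ ps) = PalAt⇒Sym b v i≤j (subst (_ <_) (sym eq) j<n) p ∷ syms b v eq h ps

  MuLe⇒Mu≤3 : MuLe u 3 → Mu≤3 n (nth false u)
  MuLe⇒Mu≤3 (S , _ , len , inS , pal , gen) = S₀ , subst (_≤ 3) (sym (length-map unshift S)) len , valid ,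
    syms false u refl valid (subst (All (PalAt u)) S-eq pal) , generate
    where
    S₀ : List (ℕ × ℕ)
    S₀ = map unshift S
    valid : All (Valid n) S₀
    valid = proj₁ (InS⇒Valid inS)
    S-eq : S ≡ map shift S₀
    S-eq = proj₂ (InS⇒Valid inS)
    generate : (B : Set) (v : ℕ → B) → All (λ I → Sym I v) S₀ → Σ (Bool → B) λ c → ∀ k → k < n →
      v k ≡ c (nth false u k)
    generate B v h with gen B (v 0) (applyUpTo v n) (length-applyUpTo v n)
      (subst (All (PalAt (applyUpTo v n))) (sym S-eq) (pals (v 0) (applyUpTo v n) (length-applyUpTo v n) valid
        (Syms-cong valid (λ k k<n → sym (nth-applyUpTo (v 0) v k<n)) h)))
    ... | c , eq = c , λ k k<n → trans (sym (nth-applyUpTo (v 0) v k<n))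
                     (trans (cong (λ z → nth (v 0) z k) (sym eq)) (nth-map (v 0) false c u k<n))

  Mu≤3⇒MuLe : Mu≤3 n (nth false u) → MuLe u 3
  Mu≤3⇒MuLe (S , len , valid , sym-u , gen) =
    -- Different intervals may have become equal by reflection or truncation, whereas `MuLe` asks
    -- for a set.
    S′ , deduplicate-! (map shift S) ,
    ≤-trans (length-deduplicate _≟²_ (map shift S)) (subst (_≤ 3) (sym (length-map shift S)) len) ,
    Allₚ.deduplicate⁺ _≟²_ (Valid⇒InS valid) , Allₚ.deduplicate⁺ _≟²_ (pals false u refl valid sym-u) , generate
    where
    _≟²_ : (I J : ℕ × ℕ) → Dec (I ≡ J)
    _≟²_ = ×-≡-dec _≟_ _≟_
    open import Data.List.Relation.Unary.Unique.DecPropositional.Properties _≟²_ using (deduplicate-!)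
    S′ : List (ℕ × ℕ)
    S′ = deduplicate _≟²_ (map shift S)
    generate : (B : Set) → B → (v : List B) → length v ≡ n → All (PalAt v) S′ → Σ (Bool → B) λ c → map c u ≡ v
    generate B b v eq pal with gen B (nth b v)
      (syms b v eq valid (Allₚ.deduplicate⁻ _≟²_ (λ { refl p → p }) (map shift S) pal))
    ... | c , h = c , nth-ext b (map c u) v (trans (length-map c u) (sym eq)) λ k k<m →
      trans (nth-map b false c u (subst (k <_) (length-map c u) k<m))
        (sym (h k (subst (k <_) (length-map c u) k<m)))

Mu≤3-cong : ∀ {n u w} → (∀ k → k < n → u k ≡ w k) → Mu≤3 n u → Mu≤3 n w
Mu≤3-cong eq (S , len , valid , syms , gen) = S , len , valid , Syms-cong valid eq syms , λ B v h →
  proj₁ (gen B v h) , λ k k<n → trans (proj₂ (gen B v h) k k<n) (cong (proj₁ (gen B v h)) (eq k k<n))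

-- Generation by three palindromes passes to factors

leastLeftEnd : ∀ n (S : List (ℕ × ℕ)) →
  All (λ I → proj₂ I ≢ n) S ⊎ ∃ λ m → (m , n) ∈ S × All (λ I → proj₂ I ≡ n → m ≤ proj₁ I) S
leastLeftEnd n []            = inj₁ []
leastLeftEnd n ((i , j) ∷ S) with j ≟ n | leastLeftEnd n S
... | no j≢n    | inj₁ h           = inj₁ (j≢n ∷ h)
... | no j≢n    | inj₂ (m , e , h) = inj₂ (m , there e , (λ j≡n → contradiction j≡n j≢n) ∷ h)
... | yes refl | inj₁ h           = inj₂ (i , here refl ,
  (λ _ → ≤-refl) ∷ All.map (λ ne e → contradiction e ne) h)
... | yes refl | inj₂ (m , e , h) with ≤-total m i
... | inj₁ m≤i = inj₂ (m , there e , (λ _ → m≤i) ∷ h)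
... | inj₂ i≤m = inj₂ (i , here refl , (λ _ → ≤-refl) ∷ All.map (λ g e → ≤-trans i≤m (g e)) h)

-- The neutral constraint: it takes the place of a palindrome that has shrunk to nothing or that was
-- never there.
zeroSym : ∀ {B : Set} (v : ℕ → B) → Sym (0 , 0) v
zeroSym v zero zero _ _ _ = refl

-- The reflection of [m , n] carries a pair symmetric about the new centre to one symmetric about
-- the old centre, and back.
reflect-sym : ∀ {B : Set} {v : ℕ → B} {m n i j i′ j′} → m ≤ i → j ≤ n → i + j′ ≡ m + n → i′ + j ≡ m + n →
  Sym (m , n) v → Sym (i , j) v → Sym (i′ , j′) v
reflect-sym {m = m} {n} {i} {j} {i′} {j′} m≤i j≤n ij′ i′j S s k l ik il kl =
  trans (S k k* (≤-trans m≤i′ ik) (≤-trans m≤i i≤k*) kk*)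
  (trans (s k* l* i≤k* i≤l* (combine (k* ∷ l* ∷ i ∷ j ∷ k ∷ m ∷ n ∷ l ∷ i′ ∷ j′ ∷ [])
    ((# 4 :+ # 0 ≈ # 5 :+ # 6 by kk*) ∷ (# 7 :+ # 1 ≈ # 5 :+ # 6 by ll*)
     ∷ (# 8 :+ # 9 ≈ # 4 :+ # 7 by sym kl) ∷ (# 5 :+ # 6 ≈ # 2 :+ # 9 by sym ij′)
     ∷ (# 5 :+ # 6 ≈ # 8 :+ # 3 by sym i′j) ∷ []) (# 0 :+ # 1) (# 2 :+ # 3)))
         (sym (S l l* (≤-trans m≤i′ il) (≤-trans m≤i i≤l*) ll*)))
  where
  k* l* : ℕ
  k* = m + n ∸ k
  l* = m + n ∸ l
  m≤i′ : m ≤ i′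
  m≤i′ = farkas (m ∷ i′ ∷ n ∷ j ∷ [])
    ((# 0 :+ # 2 ≃ # 1 :+ # 3 by sym i′j) ∷ (# 3 ≼ # 2 by j≤n) ∷ []) (# 0) (# 1)
  kk* : k + k* ≡ m + n
  kk* = m+[n∸m]≡n (farkas (k ∷ m ∷ n ∷ l ∷ i′ ∷ j′ ∷ i ∷ [])
    ((# 0 :+ # 3 ≃ # 4 :+ # 5 by kl) ∷ (# 4 ≼ # 3 by il) ∷ (# 6 :+ # 5 ≃ # 1 :+ # 2 by ij′) ∷ [])
    (# 0) (# 1 :+ # 2))
  ll* : l + l* ≡ m + n
  ll* = m+[n∸m]≡n (farkas (l ∷ m ∷ n ∷ k ∷ i′ ∷ j′ ∷ i ∷ [])
    ((# 3 :+ # 0 ≃ # 4 :+ # 5 by kl) ∷ (# 4 ≼ # 3 by ik) ∷ (# 6 :+ # 5 ≃ # 1 :+ # 2 by ij′) ∷ [])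
    (# 0) (# 1 :+ # 2))
  i≤k* : i ≤ k*
  i≤k* = farkas (i ∷ k* ∷ m ∷ n ∷ k ∷ l ∷ i′ ∷ j′ ∷ [])
    ((# 2 :+ # 3 ≃ # 4 :+ # 1 by sym kk*) ∷ (# 4 :+ # 5 ≃ # 6 :+ # 7 by kl) ∷ (# 6 ≼ # 5 by il)
     ∷ (# 0 :+ # 7 ≃ # 2 :+ # 3 by ij′) ∷ []) (# 0) (# 1)
  i≤l* : i ≤ l*
  i≤l* = farkas (i ∷ l* ∷ m ∷ n ∷ l ∷ k ∷ i′ ∷ j′ ∷ [])
    ((# 2 :+ # 3 ≃ # 4 :+ # 1 by sym ll*) ∷ (# 5 :+ # 4 ≃ # 6 :+ # 7 by kl) ∷ (# 6 ≼ # 5 by ik)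
     ∷ (# 0 :+ # 7 ≃ # 2 :+ # 3 by ij′) ∷ []) (# 0) (# 1)

-- Deleting the last position n of the longest palindrome [m, n] ending there: the other palindromes
-- ending at n are first replaced by their mirror images in [m, n].
module DropLast (n : ℕ) (1≤n : 1 ≤ n) (m : ℕ) (m≤n : m ≤ n) where

  fold : ℕ × ℕ → ℕ × ℕ
  fold (i , j) with j ≟ n | i ≟ m | suc (suc m) ≤? n
  ... | no _  | _     | _     = i , j
  ... | yes _ | yes _ | yes _ = suc m , pred n
  -- Here [m , n] has at most two positions, and nothing is left of it between its ends.
  ... | yes _ | yes _ | no _  = 0 , 0
  ... | yes _ | no _  | _     = m , m + n ∸ i

  private
    suc-pred-n : suc (pred n) ≡ n
    suc-pred-n = m+[n∸m]≡n 1≤n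

  fold-valid : ∀ {i j} → (j ≡ n → m ≤ i) → Valid (suc n) (i , j) → Valid n (fold (i , j))
  fold-valid {i} {j} least (i≤j , j≤n) with j ≟ n | i ≟ m | suc (suc m) ≤? n
  ... | no j≢n   | _        | _     = i≤j , ≤∧≢⇒< (≤-pred j≤n) j≢n
  ... | yes refl | yes refl | yes h = (farkas (m ∷ pred n ∷ n ∷ [])
    ((1+ (1+ # 0) ≼ # 2 by h) ∷ (# 2 ≃ 1+ # 1 by sym suc-pred-n) ∷ []) (1+ # 0) (# 1)) ,
      (farkas (pred n ∷ n ∷ [])
      ((1+ # 0 ≃ # 1 by suc-pred-n) ∷ []) (1+ # 0) (# 1))
  ... | yes refl | yes refl | no _  = z≤n , 1≤n
  ... | yes refl | no i≢m   | _     = (farkas (m ∷ (m + n ∸ i) ∷ n ∷ i ∷ [])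
    ((# 0 :+ # 2 ≃ # 3 :+ # 1 by sym (m+[n∸m]≡n i≤m+n)) ∷ (# 3 ≼ # 2 by i≤j) ∷ []) (# 0) (# 1)) ,
    (farkas ((m + n ∸ i) ∷ n ∷ i ∷ m ∷ [])
      ((# 2 :+ # 0 ≃ # 3 :+ # 1 by m+[n∸m]≡n i≤m+n) ∷ (1+ # 3 ≼ # 2 by ≤∧≢⇒< (least refl) (i≢m ∘ sym)) ∷ [])
      (1+ # 0) (# 1))
    where
    i≤m+n : i ≤ m + n
    i≤m+n = ≤-trans i≤j (m≤n+m n m)

  module _ {B : Set} where

    fold-sym : ∀ {v : ℕ → B} {i j} → (j ≡ n → m ≤ i) → i ≤ j → Sym (m , n) v → Sym (i , j) v →
      Sym (fold (i , j)) v
    fold-sym {v} {i} {j} least i≤j S s with j ≟ n | i ≟ m | suc (suc m) ≤? n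
    ... | no j≢n   | _        | _     = s
    ... | yes refl | yes refl | yes h = λ k l mk ml kl → S k l (<⇒≤ mk) (<⇒≤ ml)
      (combine (k ∷ l ∷ m ∷ n ∷ pred n ∷ [])
        ((# 0 :+ # 1 ≈ 1+ # 2 :+ # 4 by kl) ∷ (1+ # 4 ≈ # 3 by suc-pred-n) ∷ [])
        (# 0 :+ # 1) (# 2 :+ # 3))
    ... | yes refl | yes refl | no _  = zeroSym v
    ... | yes refl | no i≢m   | _     =
      reflect-sym (least refl) ≤-refl (m+[n∸m]≡n (≤-trans i≤j (m≤n+m n m))) refl S s

    fold-base : Σ (ℕ × ℕ) λ I → fold (m , n) ≡ I ×
      (∀ {v : ℕ → B} → Sym I v → ∀ k l → m < k → m < l → k + l ≡ m + n → v k ≡ v l)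
    fold-base with n ≟ n | m ≟ m | suc (suc m) ≤? n
    ... | no ne | _     | _     = contradiction refl ne
    ... | yes _ | no ne | _     = contradiction refl ne
    ... | yes _ | yes _ | yes h = _ , refl , λ s k l mk ml kl → s k l mk ml
      (combine (k ∷ l ∷ m ∷ pred n ∷ n ∷ [])
        ((# 0 :+ # 1 ≈ # 2 :+ # 4 by kl) ∷ (# 4 ≈ 1+ # 3 by sym suc-pred-n) ∷ [])
        (# 0 :+ # 1) (1+ # 2 :+ # 3))
    ... | yes _ | yes _ | no h  = _ , refl , λ s k l mk ml kl → contradiction
      (farkas (m ∷ n ∷ k ∷ l ∷ [])
        ((1+ # 0 ≼ # 2 by mk) ∷ (1+ # 0 ≼ # 3 by ml) ∷ (# 2 :+ # 3 ≃ # 0 :+ # 1 by kl) ∷ [])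
        (1+ (1+ # 0)) (# 1)) h

    -- The value at m is the one that [m , n] demands at n. So a solution of the folded constraints
    -- becomes a solution of the original ones, to which generation of the longer word applies.
    extend : (ℕ → B) → ℕ → B
    extend v k with k ≟ n
    ... | yes _ = v m
    ... | no _  = v k

    extend-below : ∀ v k → k < n → extend v k ≡ v k
    extend-below v k k<n with k ≟ n
    ... | yes refl = contradiction k<n (<-irrefl refl)
    ... | no _     = refl

    extend-top : ∀ v → extend v n ≡ v m
    extend-top v with n ≟ n
    ... | yes _ = refl
    ... | no ne = contradiction refl ne

    extend-m : ∀ v → extend v m ≡ v m
    extend-m v with m ≟ n
    ... | yes _ = refl
    ... | no _  = refl

    extend-longest : ∀ {v} → Sym (fold (m , n)) v → Sym (m , n) (extend v)
    extend-longest {v} s k l mk ml kl with k ≟ m | l ≟ m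
    ... | yes refl | _ with +-cancelˡ-≡ m l n kl
    ... | refl = trans (extend-m v) (sym (extend-top v))
    extend-longest {v} s k l mk ml kl | no _ | yes refl with +-cancelʳ-≡ m k n (trans kl (+-comm m n))
    ... | refl = trans (extend-top v) (sym (extend-m v))
    extend-longest {v} s k l mk ml kl | no k≢m | no l≢m with fold-base
    ... | I , eq , h = trans (extend-below v k (farkas (k ∷ n ∷ l ∷ m ∷ [])
      ((# 0 :+ # 2 ≃ # 3 :+ # 1 by kl) ∷ (1+ # 3 ≼ # 2 by m<l) ∷ []) (1+ # 0) (# 1)))
      (trans (h (subst (λ J → Sym J v) eq s) k l m<k m<l kl) (sym (extend-below v l (farkas (l ∷ n ∷ k ∷ m ∷ [])
        ((# 2 :+ # 0 ≃ # 3 :+ # 1 by kl) ∷ (1+ # 3 ≼ # 2 by m<k) ∷ []) (1+ # 0) (# 1)))))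
      where
      m<k : m < k
      m<k = ≤∧≢⇒< mk (k≢m ∘ sym)
      m<l : m < l
      m<l = ≤∧≢⇒< ml (l≢m ∘ sym)

    unfold-sym : ∀ {v i j} → (j ≡ n → m ≤ i) → Valid (suc n) (i , j) → Sym (m , n) (extend v) →
      Sym (fold (i , j)) v → Sym (i , j) (extend v)
    unfold-sym {v} {i} {j} least (i≤j , j≤n) S s with j ≟ n | i ≟ m | suc (suc m) ≤? n
    ... | no j≢n   | _        | _     = Sym-cong (≤∧≢⇒< (≤-pred j≤n) j≢n)
      (λ k k<n → sym (extend-below v k k<n)) s
    ... | yes refl | yes refl | yes h = S
    ... | yes refl | yes refl | no _  = S
    ... | yes refl | no i≢m   | _     = reflect-sym ≤-refl (<⇒≤ r<n) refl ir S
      (Sym-cong r<n (λ k k<n → sym (extend-below v k k<n)) s)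
      where
      ir : i + (m + n ∸ i) ≡ m + n
      ir = m+[n∸m]≡n (≤-trans i≤j (m≤n+m n m))
      r<n : m + n ∸ i < n
      r<n = farkas ((m + n ∸ i) ∷ n ∷ i ∷ m ∷ [])
        ((# 2 :+ # 0 ≃ # 3 :+ # 1 by ir) ∷ (1+ # 3 ≼ # 2 by ≤∧≢⇒< (least refl) (i≢m ∘ sym)) ∷ [])
        (1+ # 0) (# 1)

Mu≤3-init : ∀ {n u} → 1 ≤ n → Mu≤3 (suc n) u → Mu≤3 n u
Mu≤3-init {n} {u} 1≤n (S , len , valid , syms , gen) with leastLeftEnd n S
... | inj₁ none = S , len , shrink valid none , syms , λ B v h → proj₁ (gen B v h) , λ k k<n →
  proj₂ (gen B v h) k (m<n⇒m<1+n k<n)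
  where
  shrink : ∀ {S} → All (Valid (suc n)) S → All (λ I → proj₂ I ≢ n) S → All (Valid n) S
  shrink []                []       = []
  shrink ((i≤j , h) ∷ vs) (ne ∷ nes) = (i≤j , ≤∧≢⇒< (≤-pred h) ne) ∷ shrink vs nes
... | inj₂ (m , m∈S , least) = map fold S , subst (_≤ 3) (sym (length-map fold S)) len ,
    valids valid least , folds valid least syms , generate
  where
  m≤n : m ≤ n
  m≤n = proj₁ (All.lookup valid m∈S)
  open DropLast n 1≤n m m≤n
  valids : ∀ {S} → All (Valid (suc n)) S → All (λ I → proj₂ I ≡ n → m ≤ proj₁ I) S → All (Valid n) (map fold S)
  valids []       []       = []
  valids (v ∷ vs) (l ∷ ls) = fold-valid l v ∷ valids vs ls
  folds : ∀ {S} → All (Valid (suc n)) S → All (λ I → proj₂ I ≡ n → m ≤ proj₁ I) S → All (λ I → Sym I u) S →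
    All (λ I → Sym I u) (map fold S)
  folds []       []       []       = []
  folds (v ∷ vs) (l ∷ ls) (s ∷ ss) = fold-sym l (proj₁ v) (All.lookup syms m∈S) s ∷ folds vs ls ss
  unfolds : ∀ {S} {B : Set} {v : ℕ → B} → Sym (m , n) (extend v) → All (Valid (suc n)) S →
    All (λ I → proj₂ I ≡ n → m ≤ proj₁ I) S →
    All (λ I → Sym I v) (map fold S) → All (λ I → Sym I (extend v)) S
  unfolds s []       []       []       = []
  unfolds s (v ∷ vs) (l ∷ ls) (t ∷ ts) = unfold-sym l v s t ∷ unfolds s vs ls ts
  generate : (B : Set) (v : ℕ → B) → All (λ I → Sym I v) (map fold S) → Σ (Bool → B) λ c → ∀ k → k < n →
    v k ≡ c (u k)
  generate B v h with gen B (extend v) (unfolds (extend-longest (All.lookup (Allₚ.map⁻ h) m∈S)) valid least h)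
  ... | c , eq = c , λ k k<n → trans (sym (extend-below v k k<n)) (eq k (m<n⇒m<1+n k<n))

mirror² : ∀ {n k} → k < n → n ∸ suc (n ∸ suc k) ≡ k
mirror² {n} {k} k<n = combine ((n ∸ suc (n ∸ suc k)) ∷ k ∷ n ∷ (n ∸ suc k) ∷ [])
  ((# 2 ≈ 1+ # 1 :+ # 3 by sym (m+[n∸m]≡n k<n)) ∷ (1+ # 3 :+ # 0 ≈ # 2 by m+[n∸m]≡n (below k<n)) ∷ [])
  (# 0) (# 1)
  where
  below : k < n → n ∸ suc k < n
  below k<n = farkas ((n ∸ suc k) ∷ n ∷ k ∷ [])
    ((1+ # 2 :+ # 0 ≃ # 1 by m+[n∸m]≡n k<n) ∷ []) (1+ # 0) (# 1)

module _ (n : ℕ) where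

  mirrorInterval : ℕ × ℕ → ℕ × ℕ
  mirrorInterval (i , j) = n ∸ suc j , n ∸ suc i

  mirrorInterval-valid : ∀ {i j} → Valid n (i , j) → Valid n (mirrorInterval (i , j))
  mirrorInterval-valid {i} {j} (i≤j , j<n) = ∸-monoʳ-≤ n (s≤s i≤j) , (farkas ((n ∸ suc i) ∷ n ∷ i ∷ [])
    ((1+ # 2 :+ # 0 ≃ # 1 by m+[n∸m]≡n i<n) ∷ []) (1+ # 0) (# 1))
    where
    i<n : i < n
    i<n = ≤-<-trans i≤j j<n

  mirrorInterval-sym : ∀ {B : Set} {v : ℕ → B} {i j} → Valid n (i , j) → Sym (i , j) v →
    Sym (mirrorInterval (i , j)) (λ k → v (n ∸ suc k))
  mirrorInterval-sym {v = v} {i} {j} (i≤j , j<n) s k l ik il kl =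
    s k* l* (farkas (i ∷ k* ∷ n ∷ k ∷ i* ∷ j* ∷ l ∷ [])
      ((# 2 ≃ 1+ # 3 :+ # 1 by sym kk*) ∷ (1+ # 0 :+ # 4 ≃ # 2 by ii) ∷ (# 5 ≼ # 6 by il)
       ∷ (# 3 :+ # 6 ≃ # 5 :+ # 4 by kl) ∷ []) (# 0) (# 1))
            (farkas (i ∷ l* ∷ n ∷ l ∷ i* ∷ j* ∷ k ∷ [])
              ((# 2 ≃ 1+ # 3 :+ # 1 by sym ll*) ∷ (1+ # 0 :+ # 4 ≃ # 2 by ii) ∷ (# 5 ≼ # 6 by ik)
               ∷ (# 6 :+ # 3 ≃ # 5 :+ # 4 by kl) ∷ []) (# 0) (# 1))
            (combine (k* ∷ l* ∷ i ∷ j ∷ k ∷ n ∷ l ∷ j* ∷ i* ∷ [])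
              ((1+ # 4 :+ # 0 ≈ # 5 by kk*) ∷ (1+ # 6 :+ # 1 ≈ # 5 by ll*) ∷ (# 5 ≈ 1+ # 3 :+ # 7 by sym jj)
               ∷ (# 5 ≈ 1+ # 2 :+ # 8 by sym ii) ∷ (# 7 :+ # 8 ≈ # 4 :+ # 6 by sym kl) ∷ [])
              (# 0 :+ # 1) (# 2 :+ # 3))
    where
    k* l* i* j* : ℕ
    k* = n ∸ suc k
    l* = n ∸ suc l
    i* = n ∸ suc i
    j* = n ∸ suc j
    jj : suc j + j* ≡ n
    jj = m+[n∸m]≡n j<n
    ii : suc i + i* ≡ n
    ii = m+[n∸m]≡n (≤-<-trans i≤j j<n)
    kk* : suc k + k* ≡ n
    kk* = m+[n∸m]≡n (farkas (k ∷ n ∷ i ∷ i* ∷ j* ∷ l ∷ [])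
      ((1+ # 2 :+ # 3 ≃ # 1 by ii) ∷ (# 4 ≼ # 5 by il) ∷ (# 0 :+ # 5 ≃ # 4 :+ # 3 by kl) ∷ [])
      (1+ # 0) (# 1))
    ll* : suc l + l* ≡ n
    ll* = m+[n∸m]≡n (farkas (l ∷ n ∷ i ∷ i* ∷ j* ∷ k ∷ [])
      ((1+ # 2 :+ # 3 ≃ # 1 by ii) ∷ (# 4 ≼ # 5 by ik) ∷ (# 5 :+ # 0 ≃ # 4 :+ # 3 by kl) ∷ [])
      (1+ # 0) (# 1))

  Mu≤3-mirror : ∀ {u} → Mu≤3 n u → Mu≤3 n (λ k → u (n ∸ suc k))
  Mu≤3-mirror {u} (S , len , valid , syms , gen) = map mirrorInterval S ,
    subst (_≤ 3) (sym (length-map mirrorInterval S)) len ,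
    valids valid , mirrors valid syms , generate
    where
    valids : ∀ {S} → All (Valid n) S → All (Valid n) (map mirrorInterval S)
    valids []       = []
    valids (v ∷ vs) = mirrorInterval-valid v ∷ valids vs
    mirrors : ∀ {S} {B : Set} {v : ℕ → B} → All (Valid n) S → All (λ I → Sym I v) S →
      All (λ I → Sym I (λ k → v (n ∸ suc k))) (map mirrorInterval S)
    mirrors []       []       = []
    mirrors (v ∷ vs) (s ∷ ss) = mirrorInterval-sym v s ∷ mirrors vs ss
    unmirrors : ∀ {S} {B : Set} {v : ℕ → B} → All (Valid n) S → All (λ I → Sym I v) (map mirrorInterval S) →
      All (λ I → Sym I (λ k → v (n ∸ suc k))) S
    unmirrors []       []       = []
    unmirrors {(i , j) ∷ _} {v = v} (h@(i≤j , j<n) ∷ vs) (s ∷ ss) =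
      subst (λ I → Sym I (λ k → v (n ∸ suc k))) (cong₂ _,_ (mirror² (≤-<-trans i≤j j<n)) (mirror² j<n))
        (mirrorInterval-sym (mirrorInterval-valid h) s)
      ∷ unmirrors vs ss
    generate : (B : Set) (v : ℕ → B) → All (λ I → Sym I v) (map mirrorInterval S) → Σ (Bool → B) λ c → ∀ k →
      k < n → v k ≡ c (u (n ∸ suc k))
    generate B v h with gen B (λ k → v (n ∸ suc k)) (unmirrors valid h)
    ... | c , eq = c , λ k k<n → trans (cong v (sym (mirror² k<n)))
      (eq (n ∸ suc k) (farkas ((n ∸ suc k) ∷ n ∷ k ∷ [])
      ((1+ # 2 :+ # 0 ≃ # 1 by m+[n∸m]≡n k<n) ∷ []) (1+ # 0) (# 1)))

Mu≤3-tail : ∀ {n u} → 1 ≤ n → Mu≤3 (suc n) u → Mu≤3 n (u ∘ suc)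
Mu≤3-tail {n} {u} 1≤n h = Mu≤3-cong same (Mu≤3-mirror n (Mu≤3-init 1≤n (Mu≤3-mirror (suc n) h)))
  where
  same : ∀ k → k < n → u (n ∸ (n ∸ suc k)) ≡ u (suc k)
  same k k<n = cong u (m∸[m∸n]≡n k<n)

Mu≤3-window : ∀ x {n y u} → 1 ≤ n → Mu≤3 (x + (n + y)) u → Mu≤3 n (λ k → u (x + k))
Mu≤3-window (suc x) {suc n} 1≤n h = Mu≤3-window x 1≤n (Mu≤3-tail (≤-trans (s≤s z≤n) (m≤n+m _ x)) h)
Mu≤3-window zero {n} {zero}  {u} 1≤n h = subst (λ m → Mu≤3 m u) (+-identityʳ n) h
Mu≤3-window zero {n} {suc y} {u} 1≤n h =
  Mu≤3-window zero 1≤n (Mu≤3-init (≤-trans 1≤n (m≤m+n n y)) (subst (λ m → Mu≤3 m u) (+-suc n y) h))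

-- Central words are generated by three palindromic prefixes

SymL : {B : Set} → ℕ → (ℕ → B) → Set
SymL m v = ∀ k l → suc (k + l) ≡ m → v k ≡ v l

-- Lengths 0 and 1 share the interval (0 , 0), both conditions being void. Thus a length `n ∸ p`
-- that truncates to 0 still has a legitimate interval.
SymL⇒Sym : ∀ {B : Set} m {v : ℕ → B} → SymL m v → Sym (0 , pred m) v
SymL⇒Sym zero    s zero zero _ _ _  = refl
SymL⇒Sym (suc m) s k    l    _ _ kl = s k l (cong suc kl)

Sym⇒SymL : ∀ {B : Set} m {v : ℕ → B} → Sym (0 , pred m) v → SymL m v
Sym⇒SymL (suc m) s k l kl = s k l z≤n z≤n (suc-injective kl)

SymL-cong : ∀ {B : Set} m {v w : ℕ → B} → (∀ k → k < m → v k ≡ w k) → SymL m v → SymL m w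
SymL-cong m eq s k l refl = trans (sym (eq k (s≤s (m≤m+n k l)))) (trans (s k l refl) (eq l (s≤s (m≤n+m l k))))

∸-suc-+ : ∀ n p {m} → suc m ≡ n ∸ p → suc m + p ≡ n
∸-suc-+ n p eq = trans (cong (_+ p) eq) (m∸n+n≡m {n} {p}
  (≮⇒≥ λ n<p → case trans eq (m≤n⇒m∸n≡0 (<⇒≤ n<p)) of λ ()))

-- The reflections of the prefixes of lengths n, n + p and n again compose to the reflection of the
-- prefix of length `n ∸ p`.
SymL-∸ : ∀ {B : Set} {v : ℕ → B} n p → SymL (n + p) v → SymL n v → SymL (n ∸ p) v
SymL-∸ {v = v} n p s t k l kl = trans (t k (l + p) (combine (k ∷ l ∷ p ∷ n ∷ [])
  ((1+ (# 0 :+ # 1) :+ # 2 ≈ # 3 by e) ∷ []) (1+ (# 0 :+ (# 1 :+ # 2))) (# 3)))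
  (trans (s (l + p) (k + p) (combine (l ∷ p ∷ k ∷ n ∷ [])
    ((1+ (# 2 :+ # 0) :+ # 1 ≈ # 3 by e) ∷ []) (1+ (# 0 :+ # 1 :+ (# 2 :+ # 1))) (# 3 :+ # 1)))
         (t (k + p) l (combine (k ∷ p ∷ l ∷ n ∷ [])
           ((1+ (# 0 :+ # 2) :+ # 1 ≈ # 3 by e) ∷ []) (1+ (# 0 :+ # 1 :+ # 2)) (# 3))))
  where
  e : suc (k + l) + p ≡ n
  e = ∸-suc-+ n p kl

palindrome⇒SymL : ∀ {B : Set} (b : B) w → reverse w ≡ w → SymL (length w) (nth b w)
palindrome⇒SymL b w pal k l kl = trans (cong (λ z → nth b z k) (sym pal)) (nth-reverse b w k l kl)

bool-cases : ∀ c a → c ≡ a ⊎ c ≡ not a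
bool-cases false false = inj₁ refl
bool-cases false true  = inj₂ refl
bool-cases true  false = inj₂ refl
bool-cases true  true  = inj₁ refl

module _ (A : Bool → Bool) where

  -- The state before the first c in the directive word: the central word w is a power of the other
  -- letter, and reading c turns it into w c w or w c c w.
  Missing : List Bool → Bool → Set
  Missing D c = All (_≡ not c) (WD A D) × All (_≡ not c) (imgD A D (not c)) × imgD A D c ≡ doubled A c ++ WD A D

  long-or-missing : ∀ D c → length (imgD A D c) ≤ length (WD A D) ⊎ Missing D c
  long-or-missing = snoc-induction _ base step
    where
    base : ∀ c → length (imgD A [] c) ≤ 0 ⊎ Missing [] c
    base c = inj₂ ([] , unmixed , refl)
      where
      unmixed : All (_≡ not c) (double A (not c ∷ []))
      unmixed with A (not c)
      ... | true  = refl ∷ refl ∷ []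
      ... | false = refl ∷ []
    step : ∀ D a → (∀ c → length (imgD A D c) ≤ length (WD A D) ⊎ Missing D c) →
      ∀ c → length (imgD A (D ∷ʳ a) c) ≤ length (WD A (D ∷ʳ a)) ⊎ Missing (D ∷ʳ a) c
    step D a ih c with bool-cases c a
    ... | inj₁ refl rewrite imgD-∷ʳ-same A D a | WD-∷ʳ A D a =
      inj₁ (subst (length (imgD A D a) ≤_) (sym (length-++ (WD A D))) (m≤n+m _ _))
    ... | inj₂ refl with ih (not a)
    ... | inj₁ le rewrite imgD-∷ʳ-other A D a | WD-∷ʳ A D a =
      inj₁ (subst₂ _≤_ (sym (length-++ (imgD A D (not a)))) (sym (length-++ (WD A D))) (+-monoˡ-≤ _ le))
    ... | inj₂ (ws , ts , eq) rewrite not-involutive a | imgD-∷ʳ-same A D a | imgD-∷ʳ-other A D a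
      | WD-∷ʳ A D a =
      inj₂ (Allₚ.++⁺ ws ts , ts , trans (cong (_++ imgD A D a) eq) (++-assoc (doubled A (not a)) _ _))

  Determined : List Bool → Set₁
  Determined D = ∀ (B : Set) (v : ℕ → B) → SymL (length (WD A D)) v →
    (∀ c → SymL (length (WD A D) ∸ length (imgD A D c)) v) →
    Σ (Bool → B) λ c → ∀ k → k < length (WD A D) → v k ≡ c (nth false (WD A D) k)

  -- The prefixes of the longer word, of length n + p, supply those of w: the length n is n + p less
  -- the return word of a, `n ∸ q` is n + p less q + p for the other return word, and `n ∸ p` comes
  -- from `SymL-∸`. So v is known on w, and reflecting the whole settles every position whose
  -- partner lies in w.
  determined-∷ʳ : ∀ D a → Determined D → Determined (D ∷ʳ a)
  determined-∷ʳ D a ih B v whole prefixes = result (long-or-missing D a)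
    where
    w t : List Bool
    w = WD A D
    t = imgD A D a
    n p : ℕ
    n = length w
    p = length t
    length-wt : length (WD A (D ∷ʳ a)) ≡ n + p
    length-wt = trans (cong length (WD-∷ʳ A D a)) (length-++ w)
    whole′ : SymL (n + p) v
    whole′ = subst (λ m → SymL m v) length-wt whole
    prefix : SymL n v
    prefix = subst (λ m → SymL m v) (trans (cong₂ _∸_ length-wt (cong length (imgD-∷ʳ-same A D a)))
      (m+n∸n≡m n p)) (prefixes a)
    prefixes′ : ∀ c → SymL (n ∸ length (imgD A D c)) v
    prefixes′ c with bool-cases c a
    ... | inj₁ refl = SymL-∸ n p whole′ prefix
    ... | inj₂ refl = subst (λ m → SymL m v)
      (trans (cong₂ _∸_ length-wt (trans (cong length (imgD-∷ʳ-other A D a)) (length-++ (imgD A D (not a)))))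
      (trans (cong₂ _∸_ (+-comm n p) (+-comm (length (imgD A D (not a))) p)) ([m+n]∸[m+o]≡n∸o p n _)))
        (prefixes (not a))
    old : Σ (Bool → B) λ c → ∀ k → k < n → v k ≡ c (nth false w k)
    old = ih B v prefix prefixes′
    word : SymL (n + p) (nth false (w ++ t))
    word = subst (λ m → SymL m (nth false (w ++ t))) (length-++ w)
      (palindrome⇒SymL false (w ++ t) (WD-∷ʳ-palindrome A D a))
    reflected : ∀ (c : Bool → B) → (∀ k → k < n → v k ≡ c (nth false w k)) → ∀ k l → suc (k + l) ≡ n + p →
      l < n → v k ≡ c (nth false (w ++ t) k)
    reflected c h k l kl l<n = trans (whole′ k l kl) (trans (h l l<n)
      (cong c (trans (sym (nth-++ˡ false w t l<n)) (word l k (trans (cong suc (+-comm l k)) kl)))))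
    finish : Σ (Bool → B) (λ c → (∀ k → k < n → v k ≡ c (nth false w k)) ×
      (∀ k l → suc (k + l) ≡ n + p → n ≤ k → n ≤ l → v k ≡ c (nth false (w ++ t) k))) →
      Σ (Bool → B) λ c → ∀ k → k < length (WD A (D ∷ʳ a)) → v k ≡ c (nth false (WD A (D ∷ʳ a)) k)
    finish (c , h , mid) = c , λ k k< → trans (go k (subst (k <_) length-wt k<))
      (cong (λ z → c (nth false z k)) (sym (WD-∷ʳ A D a)))
      where
      go : ∀ k → k < n + p → v k ≡ c (nth false (w ++ t) k)
      go k k<n+p with k <? n | (n + p ∸ suc k) <? n
      ... | yes k<n | _       = trans (h k k<n) (cong c (sym (nth-++ˡ false w t k<n)))
      ... | no k≮n | yes l<n = reflected c h k _ (m+[n∸m]≡n k<n+p) l<n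
      ... | no k≮n | no l≮n  = mid k _ (m+[n∸m]≡n k<n+p) (≮⇒≥ k≮n) (≮⇒≥ l≮n)
    result : p ≤ n ⊎ Missing D a → Σ (Bool → B) λ c → ∀ k → k < length (WD A (D ∷ʳ a)) →
      v k ≡ c (nth false (WD A (D ∷ʳ a)) k)
    result (inj₁ p≤n) = finish (proj₁ old , proj₂ old , λ k l kl n≤k n≤l →
      ⊥-elim (contra (k ∷ l ∷ n ∷ p ∷ [])
        ((1+ (# 0 :+ # 1) ≃ # 2 :+ # 3 by kl) ∷ (# 2 ≼ # 0 by n≤k) ∷ (# 2 ≼ # 1 by n≤l)
         ∷ (# 3 ≼ # 2 by p≤n) ∷ [])))
    result (inj₂ (ws , _ , eq)) = finish (c , old′ , middle)
      where
      -- The letter a does not occur in w, so its value is still free and is set to the value of v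
      -- in the middle.
      c : Bool → B
      c x with x ≟ᵇ a
      ... | yes _ = v n
      ... | no _  = proj₁ old x
      c-a : c a ≡ v n
      c-a with a ≟ᵇ a
      ... | yes _ = refl
      ... | no ne = contradiction refl ne
      c-not-a : c (not a) ≡ proj₁ old (not a)
      c-not-a with not a ≟ᵇ a
      ... | yes e = contradiction (sym e) (not-¬ refl)
      ... | no _  = refl
      old′ : ∀ k → k < n → v k ≡ c (nth false w k)
      old′ k k<n with nth false w k | nth-All false ws k<n | proj₂ old k k<n
      ... | _ | refl | e = trans e (sym c-not-a)
      new : ∀ i → i < length (doubled A a) → nth false (doubled A a) i ≡ a
      new i i< with A a
      new zero          _ | false = refl
      new (suc i) (s≤s ()) | false
      new zero          _ | true  = refl
      new (suc zero)    _ | true  = refl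
      new (suc (suc i)) (s≤s (s≤s ())) | true
      -- Two middle positions are exchanged by the reflection of the whole, so the single value
      -- `v n` is right for both.
      d≤2 : length (doubled A a) ≤ 2
      d≤2 with A a
      ... | true  = ≤-refl
      ... | false = s≤s z≤n
      p-eq : p ≡ length (doubled A a) + n
      p-eq = trans (cong length eq) (length-++ (doubled A a))
      middle : ∀ k l → suc (k + l) ≡ n + p → n ≤ k → n ≤ l → v k ≡ c (nth false (w ++ t) k)
      middle k l kl n≤k n≤l = trans v-eq (sym (trans (cong c letter) c-a))
        where
        d : ℕ
        d = length (doubled A a)
        i<d : k ∸ n < d
        i<d = farkas ((k ∸ n) ∷ d ∷ k ∷ l ∷ n ∷ p ∷ [])
          ((1+ (# 2 :+ # 3) ≃ # 4 :+ # 5 by kl) ∷ (# 5 ≃ # 1 :+ # 4 by p-eq)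
           ∷ (# 4 :+ # 0 ≃ # 2 by m+[n∸m]≡n n≤k) ∷ (# 4 ≼ # 3 by n≤l) ∷ []) (1+ # 0) (# 1)
        letter : nth false (w ++ t) k ≡ a
        letter = trans (nth-++ʳ′ false w t (sym (m+[n∸m]≡n n≤k)))
          (trans (cong (λ z → nth false z (k ∸ n)) eq)
            (trans (nth-++ˡ false (doubled A a) w i<d) (new (k ∸ n) i<d)))
        v-eq : v k ≡ v n
        v-eq with k ≟ n | l ≟ n
        ... | yes refl | _        = refl
        ... | no _     | yes refl = whole′ k n kl
        ... | no k≢n   | no l≢n   = ⊥-elim (contra (k ∷ l ∷ n ∷ p ∷ d ∷ [])
          ((1+ (# 0 :+ # 1) ≃ # 2 :+ # 3 by kl) ∷ (# 3 ≃ # 4 :+ # 2 by p-eq)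
           ∷ (1+ # 2 ≼ # 0 by ≤∧≢⇒< n≤k (k≢n ∘ sym)) ∷ (1+ # 2 ≼ # 1 by ≤∧≢⇒< n≤l (l≢n ∘ sym))
           ∷ (# 4 ≼ κ 2 by d≤2) ∷ []))

  determined : ∀ D → Determined D
  determined = snoc-induction Determined (λ B v _ _ → (λ _ → v 0) , λ k ()) determined-∷ʳ

  WD-prefix : ∀ D c → SymL (length (WD A D) ∸ length (imgD A D c)) (nth false (WD A D))
  WD-prefix D c = SymL-cong (n ∸ p) (λ k h → nth-++ˡ false w t (<-≤-trans h (m∸n≤m n p)))
    (SymL-∸ n p
      (subst (λ m → SymL m (nth false (w ++ t))) (length-++ w)
        (palindrome⇒SymL false (w ++ t) (WD-∷ʳ-palindrome A D c)))
      (SymL-cong n (λ k h → sym (nth-++ˡ false w t h)) (palindrome⇒SymL false w (WD-palindrome A D))))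
    where
    w t : List Bool
    w = WD A D
    t = imgD A D c
    n p : ℕ
    n = length w
    p = length t

  WD-Mu≤3 : ∀ D → 1 ≤ length (WD A D) → Mu≤3 (length (WD A D)) (nth false (WD A D))
  WD-Mu≤3 D 1≤n = I n ∷ I (n ∸ p false) ∷ I (n ∸ p true) ∷ [] , ≤-refl ,
    valid n ≤-refl ∷ valid (n ∸ p false) (m∸n≤m n (p false)) ∷ valid (n ∸ p true) (m∸n≤m n (p true)) ∷ [] ,
    SymL⇒Sym n (palindrome⇒SymL false (WD A D) (WD-palindrome A D)) ∷ SymL⇒Sym _ (WD-prefix D false) ∷
      SymL⇒Sym _ (WD-prefix D true) ∷ [] ,
    λ { B v (s ∷ sf ∷ st ∷ []) → determined D B v
      (Sym⇒SymL n s) λ { false → Sym⇒SymL _ sf ; true → Sym⇒SymL _ st } }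
    where
    n : ℕ
    n = length (WD A D)
    p : Bool → ℕ
    p c = length (imgD A D c)
    I : ℕ → ℕ × ℕ
    I m = 0 , pred m
    valid : ∀ m → m ≤ n → Valid n (I m)
    valid zero    _   = z≤n , 1≤n
    valid (suc m) m≤n = z≤n , m≤n

nonempty : ∀ {B : Set} (u : List B) → u ≢ [] → 1 ≤ length u
nonempty []      ne = contradiction refl ne
nonempty (_ ∷ _) _  = s≤s z≤n

Central⇒MuLe : ∀ u → u ≢ [] → Central u → MuLe u 3
Central⇒MuLe u ne (A , D , x , y , eq) = Mu≤3⇒MuLe u (Mu≤3-cong same (Mu≤3-window (length x) 1≤u
  (subst₂ Mu≤3 lengths refl
    (WD-Mu≤3 A D (subst (1 ≤_) (sym lengths) (≤-trans 1≤u (≤-trans (m≤m+n _ _) (m≤n+m _ (length x)))))))))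
  where
  lengths : length (WD A D) ≡ length x + (length u + length y)
  lengths = trans (cong length eq) (trans (length-++ x) (cong (length x +_) (length-++ u)))
  1≤u : 1 ≤ length u
  1≤u = nonempty u ne
  same : ∀ k → k < length u → nth false (WD A D) (length x + k) ≡ nth false u k
  same k k<u = trans (cong (λ z → nth false z (length x + k)) eq)
    (trans (nth-++ʳ false x (u ++ y) k) (nth-++ˡ false u y k<u))

-- Periodic words

rep : {B : Set} → ℕ → List B → List B
rep zero    t = []
rep (suc e) t = t ++ rep e t

rep-+ : ∀ {B : Set} e x (t : List B) → rep (e + x) t ≡ rep e t ++ rep x t
rep-+ zero    x t = refl
rep-+ (suc e) x t = trans (cong (t ++_) (rep-+ e x t)) (sym (++-assoc t _ _))

length-rep : ∀ {B : Set} e (t : List B) → length (rep e t) ≡ e * length t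
length-rep zero    t = refl
length-rep (suc e) t = trans (length-++ t) (cong (length t +_) (length-rep e t))

nth-rep-≤ : ∀ {B : Set} (b : B) t {e e′} k → e ≤ e′ → k < length (rep e t) →
  nth b (rep e′ t) k ≡ nth b (rep e t) k
nth-rep-≤ b t {e} k e≤e′ h with m≤n⇒∃[o]m+o≡n e≤e′
... | x , refl = trans (cong (λ z → nth b z k) (rep-+ e x t)) (nth-++ˡ b (rep e t) (rep x t) h)

doubled-head : ∀ A c z → nth false (doubled A c ++ z) 0 ≡ c
doubled-head A c z with A c
... | true  = refl
... | false = refl

self-∈ : ∀ A D c → c ∈ imgD A D c
self-∈ A = snoc-induction _ base step
  where
  base : ∀ c → c ∈ imgD A [] c
  base c with A c
  ... | true  = here refl
  ... | false = here refl
  step : ∀ D a → (∀ c → c ∈ imgD A D c) → ∀ c → c ∈ imgD A (D ∷ʳ a) c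
  step D a ih c with bool-cases c a
  ... | inj₁ refl rewrite imgD-∷ʳ-same A D a  = ih c
  ... | inj₂ refl rewrite imgD-∷ʳ-other A D a = ∈-++⁺ˡ (ih (not a))

∈⇒nth : ∀ {B : Set} (b : B) {c} {w : List B} → c ∈ w → ∃ λ k → k < length w × nth b w k ≡ c
∈⇒nth b (here refl) = 0 , z<s , refl
∈⇒nth b (there h) with ∈⇒nth b h
... | k , k< , eq = suc k , s≤s k< , eq

1≤img : ∀ A D c → 1 ≤ length (imgD A D c)
1≤img A D c with ∈⇒nth false (self-∈ A D c)
... | k , k< , _ = ≤-trans (s≤s z≤n) k<

-- Reading the letter other than c adds the same amount to both lengths, so the inequality can
-- become true only when c is read.
long⇒∈ : ∀ A D c → length (imgD A D c) ≤ length (WD A D) → c ∈ WD A D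
long⇒∈ A = snoc-induction _ (λ c h → contradiction (≤-trans (1≤img A [] c) h) λ ()) step
  where
  step : ∀ D a → (∀ c → length (imgD A D c) ≤ length (WD A D) → c ∈ WD A D) →
    ∀ c → length (imgD A (D ∷ʳ a) c) ≤ length (WD A (D ∷ʳ a)) → c ∈ WD A (D ∷ʳ a)
  step D a ih c h with bool-cases c a
  ... | inj₁ refl rewrite WD-∷ʳ A D a = ∈-++⁺ʳ (WD A D) (self-∈ A D a)
  ... | inj₂ refl rewrite WD-∷ʳ A D a | imgD-∷ʳ-other A D a = ∈-++⁺ˡ (ih (not a)
    (+-cancelʳ-≤ (length (imgD A D a)) _ _ (subst₂ _≤_ (length-++ (imgD A D (not a))) (length-++ (WD A D)) h)))

module Limit (A : Bool → Bool) (D : List Bool) (a : Bool) where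
  w t : List Bool
  w = WD A D
  t = imgD A D a

  n g : ℕ
  n = length w
  g = length t

  1≤g : 1 ≤ g
  1≤g = 1≤img A D a

  -- The limit of the central words with directive words D, a, ..., a. They are w t^e and, after
  -- every t has been moved to the left, r^e w with r the reverse of t; the second form exhibits the
  -- period. The exponent k + 1 just has to be large enough.
  Q : ℕ → Bool
  Q k = nth false (rep (suc k) (reverse t)) k

  private
    r : List Bool
    r = reverse t

    rep-long : ∀ e → length (rep e r) ≡ e * g
    rep-long e = trans (length-rep e r) (cong (e *_) (length-reverse t))

    Q-rep : ∀ e z k → k < e * g → nth false (rep e r ++ z) k ≡ Q k
    Q-rep e z k h = trans (nth-++ˡ false (rep e r) z (subst (k <_) (sym (rep-long e)) h))
      (compare (≤-total e (suc k)))
      where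
      compare : e ≤ suc k ⊎ suc k ≤ e → nth false (rep e r) k ≡ Q k
      compare (inj₁ le) = sym (nth-rep-≤ false r k le (subst (k <_) (sym (rep-long e)) h))
      compare (inj₂ le) = nth-rep-≤ false r {suc k} k le
        (subst (k <_) (sym (rep-long (suc k))) (m≤m*n (suc k) g {{>-nonZero 1≤g}}))

    slide : ∀ e → w ++ rep e t ≡ rep e r ++ w
    slide zero    = ++-identityʳ w
    slide (suc e) = begin
      w ++ (t ++ rep e t) ≡⟨ sym (++-assoc w t _) ⟩
      (w ++ t) ++ rep e t ≡⟨ cong (_++ rep e t) (WD-img A D a) ⟩
      (r ++ w) ++ rep e t ≡⟨ ++-assoc r w _ ⟩
      r ++ (w ++ rep e t) ≡⟨ cong (r ++_) (slide e) ⟩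
      r ++ (rep e r ++ w) ≡⟨ sym (++-assoc r _ w) ⟩
      (r ++ rep e r) ++ w ∎
      where open ≡-Reasoning

  WD-power : ∀ e → WD A (D ++ replicate e a) ≡ w ++ rep e t
  WD-power e = go e D
    where
    go : ∀ e D → WD A (D ++ replicate e a) ≡ WD A D ++ rep e (imgD A D a)
    go zero    D = trans (cong (WD A) (++-identityʳ D)) (sym (++-identityʳ _))
    go (suc e) D = begin
      WD A (D ++ a ∷ replicate e a)                    ≡⟨ cong (WD A) (sym (++-assoc D [ a ] _)) ⟩
      WD A ((D ∷ʳ a) ++ replicate e a)                 ≡⟨ go e (D ∷ʳ a) ⟩
      WD A (D ∷ʳ a) ++ rep e (imgD A (D ∷ʳ a) a)       ≡⟨ cong₂ _++_ (WD-∷ʳ A D a)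
        (cong (rep e) (imgD-∷ʳ-same A D a)) ⟩
      (WD A D ++ imgD A D a) ++ rep e (imgD A D a)     ≡⟨ ++-assoc (WD A D) _ _ ⟩
      WD A D ++ (imgD A D a ++ rep e (imgD A D a))     ∎
      where open ≡-Reasoning

  private
    V : ℕ → List Bool
    V e = WD A (D ++ replicate e a)

    length-V : ∀ e → length (V e) ≡ n + e * g
    length-V e = trans (cong length (WD-power e)) (trans (length-++ w) (cong (n +_) (length-rep e t)))

    V-Q : ∀ e k → k < e * g → nth false (V e) k ≡ Q k
    V-Q e k h = trans (cong (λ z → nth false z k) (trans (WD-power e) (slide e))) (Q-rep e w k h)

  Q-periodic : ∀ k → Q (k + g) ≡ Q k
  Q-periodic k = begin
    Q (k + g)                                      ≡⟨ sym
      (Q-rep (suc (k + g)) [] (k + g) (m≤m*n (suc (k + g)) g {{>-nonZero 1≤g}})) ⟩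
    nth false (rep (suc (k + g)) r ++ []) (k + g)  ≡⟨ cong (λ z → nth false z (k + g))
      (++-identityʳ (rep (suc (k + g)) r)) ⟩
    nth false (r ++ rep (k + g) r) (k + g)         ≡⟨ nth-++ʳ′ false r (rep (k + g) r)
      (trans (+-comm k g) (cong (_+ k) (sym (length-reverse t)))) ⟩
    nth false (rep (k + g) r) k                    ≡⟨ cong (λ z → nth false z k)
      (sym (++-identityʳ (rep (k + g) r))) ⟩
    nth false (rep (k + g) r ++ []) k              ≡⟨ Q-rep (k + g) [] k k< ⟩
    Q k                                            ∎
    where
    open ≡-Reasoning
    k< : k < (k + g) * g
    k< = ≤-trans (farkas (k ∷ g ∷ []) ((κ 1 ≼ # 1 by 1≤g) ∷ []) (1+ # 0) (# 0 :+ # 1))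
      (m≤m*n (k + g) g {{>-nonZero 1≤g}})

  Q-shift : ∀ k x → Q (k + x * g) ≡ Q k
  Q-shift k zero    = cong Q (+-identityʳ k)
  Q-shift k (suc x) =
    trans (cong Q (combine (k ∷ g ∷ x ∷ []) [] (# 0 :+ (# 1 :+ # 2 :* # 1)) (# 0 :+ # 2 :* # 1 :+ # 1)))
    (trans (Q-periodic (k + x * g)) (Q-shift k x))

  Q-prefix : ∀ k → k < length (w ++ t) → Q k ≡ nth false (w ++ t) k
  Q-prefix k h = begin
    Q k                                ≡⟨ sym (V-Q (suc k) k (m≤m*n (suc k) g {{>-nonZero 1≤g}})) ⟩
    nth false (V (suc k)) k            ≡⟨ cong (λ z → nth false z k)
      (trans (WD-power (suc k)) (sym (++-assoc w t _))) ⟩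
    nth false ((w ++ t) ++ rep k t) k  ≡⟨ nth-++ˡ false (w ++ t) (rep k t) h ⟩
    nth false (w ++ t) k               ∎
    where open ≡-Reasoning

  Q-prefix-w : ∀ k → k < n → Q k ≡ nth false w k
  Q-prefix-w k h = trans (Q-prefix k (≤-trans h (subst (n ≤_) (sym (length-++ w)) (m≤m+n n g))))
    (nth-++ˡ false w t h)

  Q-mirror : ∀ k l x y → suc (k + l) + x * g ≡ n + y * g → Q k ≡ Q l
  Q-mirror k l x y eq = begin
    Q k               ≡⟨ sym (Q-shift k (n + x)) ⟩
    Q k′              ≡⟨ sym (V-Q e k′ (farkas (k′ ∷ e ∷ g ∷ l′ ∷ n ∷ [])
      ((1+ (# 0 :+ # 3) ≃ # 4 :+ # 1 :* # 2 by sum) ∷ (# 4 ≼ # 3 by n≤l′) ∷ []) (1+ # 0) (# 1 :* # 2))) ⟩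
    nth false (V e) k′ ≡⟨ palindrome⇒SymL false (V e) (WD-palindrome A (D ++ replicate e a)) k′ l′
      (trans sum (sym (length-V e))) ⟩
    nth false (V e) l′ ≡⟨ V-Q e l′ (farkas (l′ ∷ e ∷ g ∷ k′ ∷ n ∷ [])
      ((1+ (# 3 :+ # 0) ≃ # 4 :+ # 1 :* # 2 by sum) ∷ (# 4 ≼ # 3 by n≤k′) ∷ []) (1+ # 0) (# 1 :* # 2)) ⟩
    Q l′              ≡⟨ Q-shift l n ⟩
    Q l               ∎
    where
    open ≡-Reasoning
    e k′ l′ : ℕ
    -- Multiples of g lift both positions to at least n. Their sum is one less than n + e * g, so
    -- each lies below e * g, where `V e` agrees with Q.
    e = y + (n + n)
    k′ = k + (n + x) * g
    l′ = l + n * g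
    ng : n ≤ n * g
    ng = m≤m*n n g {{>-nonZero 1≤g}}
    n≤k′ : n ≤ k + (n + x) * g
    n≤k′ = farkas (n ∷ k ∷ x ∷ g ∷ [])
      ((# 0 ≼ # 0 :* # 3 by ng) ∷ []) (# 0) (# 1 :+ (# 0 :+ # 2) :* # 3)
    n≤l′ : n ≤ l + n * g
    n≤l′ = farkas (n ∷ l ∷ g ∷ [])
      ((# 0 ≼ # 0 :* # 2 by ng) ∷ []) (# 0) (# 1 :+ # 0 :* # 2)
    sum : suc (k + (n + x) * g + (l + n * g)) ≡ n + (y + (n + n)) * g
    sum = combine (k ∷ n ∷ x ∷ g ∷ l ∷ y ∷ [])
      ((1+ (# 0 :+ # 4) :+ # 2 :* # 3 ≈ # 1 :+ # 5 :* # 3 by eq) ∷ [])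
      (1+ (# 0 :+ (# 1 :+ # 2) :* # 3 :+ (# 4 :+ # 1 :* # 3))) (# 1 :+ (# 5 :+ (# 1 :+ # 1)) :* # 3)

  Q-central : ∀ z m → Central (applyUpTo (λ k → Q (z + k)) m)
  Q-central z m = A , D ++ replicate e a , subst (_⊑ V e)
    (applyUpTo-cong m λ k k<m → V-Q e (z + k) (<-≤-trans (+-monoʳ-< z k<m) e≤))
    (window-⊑ false (V e) z m (≤-trans e≤ (subst (e * g ≤_) (sym (length-V e)) (m≤n+m (e * g) n))))
    where
    e : ℕ
    e = z + m
    e≤ : e ≤ e * g
    e≤ = m≤m*n e g {{>-nonZero 1≤g}}

  Q-occurs : ∀ {c} → c ∈ w ++ t → ∃ λ k → Q k ≡ c
  Q-occurs h with ∈⇒nth false h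
  ... | k , k< , eq = k , trans (Q-prefix k k<) eq

  Q-occurs-shifted : ∀ z {c} → c ∈ w ++ t → ∃ λ k → Q (k + z) ≡ c
  Q-occurs-shifted z h with Q-occurs h
  -- As z * pred g + z = z * g, the shift by z is completed to a multiple of the period.
  ... | k , eq = k + z * pred g , trans (cong Q (combine (k ∷ z ∷ pred g ∷ g ∷ [])
    ((# 1 :* 1+ # 2 ≈ # 1 :* # 3 by cong (z *_) (m+[n∸m]≡n 1≤g)) ∷ [])
    (# 0 :+ # 1 :* # 2 :+ # 1) (# 0 :+ # 1 :* # 3))) (trans (Q-shift k z) eq)

-- The residue words (0^f 1)^ω and (0^f 11)^ω.
module Residue (two : Bool) (f : ℕ) (1≤f : 1 ≤ f) where
  A : Bool → Bool
  A c = c ∧ two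

  d : ℕ
  d = length (doubled A true)

  private
    τ-zeros : ∀ f → τ false (replicate f false) ≡ replicate f false
    τ-zeros zero    = refl
    τ-zeros (suc f) = cong (false ∷_) (τ-zeros f)

    W-zeros : ∀ f → W (replicate f false) ≡ replicate f false
    W-zeros zero    = refl
    W-zeros (suc f) = cong (false ∷_) (trans (cong (τ false) (W-zeros f)) (τ-zeros f))

    img-zeros : ∀ f → img (replicate f false) true ≡ true ∷ replicate f false
    img-zeros zero    = refl
    img-zeros (suc f) = trans (cong (τ false) (img-zeros f)) (cong (λ z → true ∷ false ∷ z) (τ-zeros f))

    double-zeros : ∀ f → double A (replicate f false) ≡ replicate f false
    double-zeros zero    = refl
    double-zeros (suc f) = cong (false ∷_) (double-zeros f)

  open Limit A (replicate f false) true public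

  w-zeros : w ≡ replicate f false
  w-zeros = trans (cong (double A) (W-zeros f)) (double-zeros f)

  t-eq : t ≡ doubled A true ++ replicate f false
  t-eq = trans (cong (double A) (img-zeros f)) (cong (doubled A true ++_) (double-zeros f))

  n≡f : n ≡ f
  n≡f = trans (cong length w-zeros) (length-replicate f)

  g≡f+d : g ≡ f + d
  g≡f+d = trans (cong length t-eq) (trans (length-++ (doubled A true))
    (trans (cong (d +_) (length-replicate f)) (+-comm d f)))

  private
    nth-zeros : ∀ m k → nth false (replicate m false) k ≡ false
    nth-zeros zero    k       = refl
    nth-zeros (suc m) zero    = refl
    nth-zeros (suc m) (suc k) = nth-zeros m k

  Q-false : ∀ k y → k < f → Q (k + y * g) ≡ false
  Q-false k y k<f = trans (Q-shift k y) (trans (Q-prefix-w k (subst (k <_) (sym n≡f) k<f))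
    (trans (cong (λ z → nth false z k) w-zeros) (nth-zeros f k)))

  Q-true : ∀ y → Q (f + y * g) ≡ true
  Q-true y = trans (Q-shift f y) (trans (Q-prefix f f<)
    (trans (nth-++ʳ′ false w t (trans (sym n≡f) (sym (+-identityʳ n))))
    (trans (cong (λ z → nth false z 0) t-eq) (doubled-head A true (replicate f false)))))
    where
    f< : f < length (w ++ t)
    f< = subst (f <_) (sym (length-++ w)) (farkas (f ∷ n ∷ g ∷ [])
      ((# 0 ≃ # 1 by sym n≡f) ∷ (κ 1 ≼ # 2 by 1≤g) ∷ []) (1+ # 0) (# 1 :+ # 2))

-- Two periods

NonConstant : ℕ → (ℕ → Bool) → Set
NonConstant n u = ∃₂ λ a b → a < n × b < n × u a ≢ u b

-- How a word of length n with symmetric prefixes of lengths n, n ∸ p and n ∸ q arises: either centred in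
-- a central word, or as a window of a residue word whose period divides p and q.
data Kind (n p q : ℕ) : Set where
  centred : ∀ A D a m → length (imgD A D a) ≡ p → length (imgD A D (not a)) ≡ q →
            length (WD A D) ≡ n + 2 * m → Kind n p q
  residue : ∀ two f z x y Y → 1 ≤ f → p ≡ x * (f + length (doubled (_∧ two) true)) →
    q ≡ y * (f + length (doubled (_∧ two) true)) →
            n + 2 * z + length (doubled (_∧ two) true) ≡ Y * (f + length (doubled (_∧ two) true)) → Kind n p q

Kind-swap : ∀ {n p q} → Kind n p q → Kind n q p
Kind-swap (centred A D a m ep eq en) = centred A D (not a) m eq
  (trans (cong (length ∘ imgD A D) (not-involutive a)) ep) en
Kind-swap (residue two f z x y Y 1≤f ep eq en) = residue two f z y x Y 1≤f eq ep en

-- Undoes one subtraction of Euclid's algorithm. Appending a to D adds p to the other period and to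
-- the length of the central word, so the margin m stays.
Kind-step : ∀ {n p q} → Kind n p q → Kind (p + n) p (p + q)
Kind-step {n} (centred A D a m refl refl en) = centred A (D ∷ʳ a) a m
  (cong length (imgD-∷ʳ-same A D a))
  (trans (cong length (imgD-∷ʳ-other A D a)) (trans (length-++ (imgD A D (not a)))
    (+-comm (length (imgD A D (not a))) _)))
  (trans (cong length (WD-∷ʳ A D a)) (trans (length-++ (WD A D))
    (combine (length (WD A D) ∷ length (imgD A D a) ∷ n ∷ m ∷ [])
      ((# 0 ≈ # 2 :+ κ 2 :* # 3 by en) ∷ []) (# 0 :+ # 1) (# 1 :+ # 2 :+ κ 2 :* # 3))))
Kind-step {n} (residue two f z x y Y 1≤f refl refl en) = residue two f z x (x + y) (x + Y) 1≤f refl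
  (combine (x ∷ f ∷ d ∷ y ∷ []) [] (# 0 :* (# 1 :+ # 2) :+ # 3 :* (# 1 :+ # 2)) ((# 0 :+ # 3) :* (# 1 :+ # 2)))
  (combine (x ∷ f ∷ d ∷ n ∷ z ∷ Y ∷ [])
    ((# 3 :+ κ 2 :* # 4 :+ # 2 ≈ # 5 :* (# 1 :+ # 2) by en) ∷ [])
    (# 0 :* (# 1 :+ # 2) :+ # 3 :+ κ 2 :* # 4 :+ # 2) ((# 0 :+ # 5) :* (# 1 :+ # 2)))
  where
  d : ℕ
  d = length (doubled (_∧ two) true)

parity : ∀ n → ∃ λ m → n ≡ 2 * m ⊎ n ≡ suc (2 * m)
parity zero = 0 , inj₁ refl
parity (suc n) with parity n
... | m , inj₁ refl = m , inj₂ refl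
... | m , inj₂ refl = suc m , inj₁ (combine (m ∷ []) [] (1+ (1+ (κ 2 :* # 0))) (κ 2 :* 1+ # 0))

-- Without doubling this is the classical length p + q - 2 of a central word with periods p and q;
-- each doubled letter raises the defect by 1. A letter appended to D adds the length of one return
-- word on both sides.
lengths : ∀ A D → length (WD A D) + (length (doubled A false) + length (doubled A true)) ≡ length
  (imgD A D false) + length (imgD A D true)
lengths A = snoc-induction _ base step
  where
  base : length (doubled A false) + length (doubled A true) ≡ length (imgD A [] false) + length (imgD A [] true)
  base = cong₂ _+_ (cong length (sym (++-identityʳ (doubled A false))))
    (cong length (sym (++-identityʳ (doubled A true))))
  L : List Bool → ℕ
  L D = length (WD A D)
  ℓ : List Bool → Bool → ℕ
  ℓ D c = length (imgD A D c)
  δ : ℕ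
  δ = length (doubled A false) + length (doubled A true)
  same : ∀ D a → ℓ (D ∷ʳ a) a ≡ ℓ D a
  same D a = cong length (imgD-∷ʳ-same A D a)
  other : ∀ D a → ℓ (D ∷ʳ a) (not a) ≡ ℓ D (not a) + ℓ D a
  other D a = trans (cong length (imgD-∷ʳ-other A D a)) (length-++ (imgD A D (not a)))
  word : ∀ D a → L (D ∷ʳ a) ≡ L D + ℓ D a
  word D a = trans (cong length (WD-∷ʳ A D a)) (length-++ (WD A D))
  step : ∀ D a → L D + δ ≡ ℓ D false + ℓ D true → L (D ∷ʳ a) + δ ≡ ℓ (D ∷ʳ a) false + ℓ (D ∷ʳ a) true
  step D false ih = combine (L (D ∷ʳ false) ∷ δ ∷ ℓ (D ∷ʳ false) false ∷ ℓ (D ∷ʳ false) true ∷ L D ∷ ℓ D false ∷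
    ℓ D true ∷ [])
    ((# 4 :+ # 1 ≈ # 5 :+ # 6 by ih) ∷ (# 5 ≈ # 2 by sym (same D false))
     ∷ (# 6 :+ # 5 ≈ # 3 by sym (other D false)) ∷ (# 0 ≈ # 4 :+ # 5 by word D false) ∷ [])
    (# 0 :+ # 1) (# 2 :+ # 3)
  step D true ih = combine (L (D ∷ʳ true) ∷ δ ∷ ℓ (D ∷ʳ true) false ∷ ℓ (D ∷ʳ true) true ∷ L D ∷ ℓ D false ∷
    ℓ D true ∷ [])
    ((# 4 :+ # 1 ≈ # 5 :+ # 6 by ih) ∷ (# 6 ≈ # 3 by sym (same D true))
     ∷ (# 5 :+ # 6 ≈ # 2 by sym (other D true)) ∷ (# 0 ≈ # 4 :+ # 6 by word D true) ∷ [])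
    (# 0 :+ # 1) (# 2 :+ # 3)

undoubled : Bool → Bool
undoubled _ = false

alldoubled : Bool → Bool
alldoubled _ = true

double-none : ∀ w → double undoubled w ≡ w
double-none []      = refl
double-none (c ∷ w) = cong (c ∷_) (double-none w)

length-double-all : ∀ w → length (double alldoubled w) ≡ 2 * length w
length-double-all []      = refl
length-double-all (c ∷ w) = combine (length (double alldoubled w) ∷ length w ∷ [])
  ((# 0 ≈ κ 2 :* # 1 by length-double-all w) ∷ []) (1+ (1+ # 0)) (κ 2 :* 1+ # 1)

-- Prepending a to the directive word has the same effect on lengths as doubling the other letter.
otherDoubled : Bool → Bool → Bool
otherDoubled false c = c
otherDoubled true  c = not c

length-τ : ∀ a w → length (τ a w) ≡ length (double (otherDoubled a) w)
length-τ a []      = refl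
length-τ a (c ∷ w) = trans (length-++ (block a c))
  (trans (cong₂ _+_ (blocks a c) (length-τ a w)) (sym (length-++ (doubled (otherDoubled a) c))))
  where
  blocks : ∀ a c → length (block a c) ≡ length (doubled (otherDoubled a) c)
  blocks false false = refl
  blocks false true  = refl
  blocks true  false = refl
  blocks true  true  = refl

-- Each subtraction is recorded as a letter of D, and `img-∷ʳ-other` is the matching addition of
-- lengths. The factor g is the greatest common divisor; s bounds the recursion.
euclid : ∀ s p q → p + q ≤ s → 1 ≤ p → 1 ≤ q →
  ∃₂ λ g D → p ≡ g * length (img D false) × q ≡ g * length (img D true)
euclid zero    p q h 1≤p 1≤q = contradiction (≤-trans 1≤p (≤-trans (m≤m+n p q) h)) λ ()
euclid (suc s) p q h 1≤p 1≤q with <-cmp p q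
... | tri≈ _ refl _ = p , [] , sym (*-identityʳ p) , sym (*-identityʳ p)
... | tri< p<q _ _ with m≤n⇒∃[o]m+o≡n (<⇒≤ p<q)
... | r , refl with euclid s p r (farkas (p ∷ r ∷ s ∷ [])
  ((# 0 :+ (# 0 :+ # 1) ≼ 1+ # 2 by h) ∷ (κ 1 ≼ # 0 by 1≤p) ∷ []) (# 0 :+ # 1) (# 2)) 1≤p
    (farkas (r ∷ p ∷ []) ((1+ # 1 ≼ # 1 :+ # 0 by p<q) ∷ []) (κ 1) (# 0))
... | g , D , ep , er = g , D ∷ʳ false , trans ep (cong (λ z → g * length z) (sym (img-∷ʳ-same D false))) ,
  trans (trans (cong₂ _+_ ep er) (combine (g ∷ length (img D false) ∷ length (img D true) ∷ []) []
    (# 0 :* # 1 :+ # 0 :* # 2) (# 0 :* (# 2 :+ # 1))))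
        (cong (g *_) (trans (sym (length-++ (img D true))) (cong length (sym (img-∷ʳ-other D false)))))
euclid (suc s) p q h 1≤p 1≤q | tri> _ _ q<p with m≤n⇒∃[o]m+o≡n (<⇒≤ q<p)
... | r , refl with euclid s r q (farkas (r ∷ q ∷ s ∷ [])
  ((# 1 :+ # 0 :+ # 1 ≼ 1+ # 2 by h) ∷ (κ 1 ≼ # 1 by 1≤q) ∷ []) (# 0 :+ # 1) (# 2))
    (farkas (r ∷ q ∷ []) ((1+ # 1 ≼ # 1 :+ # 0 by q<p) ∷ []) (κ 1) (# 0)) 1≤q
... | g , D , er , eq = g , D ∷ʳ true ,
  trans (trans (cong₂ _+_ eq er) (combine (g ∷ length (img D true) ∷ length (img D false) ∷ []) []
    (# 0 :* # 1 :+ # 0 :* # 2) (# 0 :* (# 2 :+ # 1))))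
        (cong (g *_) (trans (sym (length-++ (img D false))) (cong length (sym (img-∷ʳ-other D true))))) ,
  trans eq (cong (λ z → g * length z) (sym (img-∷ʳ-same D true)))

centre : ∀ A D m {n p q} → length (imgD A D false) ≡ p → length (imgD A D true) ≡ q →
  n + 2 * m + (length (doubled A false) + length (doubled A true)) ≡ p + q → Kind n p q
centre A D m {n} {p} {q} ep eq e = centred A D false m ep eq
  (combine (length (WD A D) ∷ n ∷ m ∷ length (doubled A false) ∷ length (doubled A true) ∷
    length (imgD A D false) ∷ length (imgD A D true) ∷ p ∷ q ∷ [])
    ((# 0 :+ (# 3 :+ # 4) ≈ # 5 :+ # 6 by lengths A D) ∷ (# 5 ≈ # 7 by ep) ∷ (# 6 ≈ # 8 by eq)
     ∷ (# 7 :+ # 8 ≈ # 1 :+ κ 2 :* # 2 :+ (# 3 :+ # 4) by sym e) ∷ []) (# 0) (# 1 :+ κ 2 :* # 2))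

-- From n < 2p it follows that p + q - n exceeds q - p, so this defect is at least 2.
positive : ∀ {n p q} e M → n + (e + 2 * M) ≡ p + q → e ≤ 1 → p < q → n < 2 * p → 1 ≤ M
positive {n} {p} {q} e M eN e≤1 p<q n<2p = farkas′ 2 (M ∷ p ∷ q ∷ n ∷ e ∷ [])
  ((# 1 :+ # 2 ≃ # 3 :+ (# 4 :+ κ 2 :* # 0) by sym eN) ∷ (# 4 ≼ κ 1 by e≤1) ∷ (1+ # 1 ≼ # 2 by p<q)
   ∷ (1+ # 3 ≼ κ 2 :* # 1 by n<2p) ∷ []) (κ 1) (# 0)

-- Between p and 2p nothing but parity obstructs a central word with periods p < q.
kind-short : ∀ n p q → 1 ≤ p → p < q → q ≤ n → n < 2 * p → Kind n p q
kind-short n p q 1≤p p<q q≤n n<2p with m≤n⇒∃[o]m+o≡n {n} {p + q} (farkas (n ∷ p ∷ q ∷ [])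
  ((1+ # 1 ≼ # 2 by p<q) ∷ (1+ # 0 ≼ κ 2 :* # 1 by n<2p) ∷ []) (# 0) (# 1 :+ # 2))
  | euclid (p + q) p q ≤-refl 1≤p (<⇒≤ (≤-<-trans 1≤p p<q))
... | N , eN | zero , D , ep , eq = contradiction (subst (1 ≤_) ep 1≤p) λ ()
... | N , eN | suc zero , D , ep , eq with parity N
-- Coprime periods and an even defect 2M: the undoubled central word has length p + q - 2 and leaves
-- M - 1 positions on either side.
... | M , inj₁ refl = centre undoubled D (pred M)
  (trans (cong length (double-none (img D false))) (trans (sym (*-identityˡ _)) (sym ep)))
  (trans (cong length (double-none (img D true))) (trans (sym (*-identityˡ _)) (sym eq)))
  (combine (n ∷ pred M ∷ p ∷ q ∷ M ∷ [])
    ((# 0 :+ κ 2 :* # 4 ≈ # 2 :+ # 3 by eN) ∷ 2 ∙ (1+ # 1 ≈ # 4 by m+[n∸m]≡n 1≤M) ∷ [])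
    (# 0 :+ κ 2 :* # 1 :+ κ 2) (# 2 :+ # 3))
  where
  1≤M : 1 ≤ M
  1≤M = positive 0 M eN z≤n p<q n<2p
kind-short n p q 1≤p p<q q≤n n<2p | N , eN | suc zero , [] , ep , eq | M , inj₂ refl =
  contradiction p<q (subst₂ (λ x y → ¬ (x < y)) (sym ep) (sym eq) (<-irrefl refl))
-- An odd defect calls for length p + q - 3. The first letter b of D is traded for doubling the
-- other letter, which preserves both periods; such a b exists because p and q differ.
kind-short n p q 1≤p p<q q≤n n<2p | N , eN | suc zero , b ∷ D , ep , eq | M , inj₂ refl =
  centre (otherDoubled b) D (pred M)
  (trans (sym (length-τ b (img D false))) (trans (sym (*-identityˡ _)) (sym ep)))
  (trans (sym (length-τ b (img D true))) (trans (sym (*-identityˡ _)) (sym eq)))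
  (trans (cong (n + 2 * pred M +_) (three b)) (combine (n ∷ pred M ∷ p ∷ q ∷ M ∷ [])
    ((# 0 :+ 1+ (κ 2 :* # 4) ≈ # 2 :+ # 3 by eN) ∷ 2 ∙ (1+ # 1 ≈ # 4 by m+[n∸m]≡n 1≤M) ∷ [])
    (# 0 :+ κ 2 :* # 1 :+ κ 3) (# 2 :+ # 3)))
  where
  1≤M : 1 ≤ M
  1≤M = positive 1 M eN ≤-refl p<q n<2p
  three : ∀ b → length (doubled (otherDoubled b) false) + length (doubled (otherDoubled b) true) ≡ 3
  three false = refl
  three true  = refl
kind-short n p q 1≤p p<q q≤n n<2p | N , eN | suc (suc zero) , D , ep , eq with parity N
... | M , inj₂ refl = residue false 1 M (length (img D false)) (length (img D true))
  (length (img D false) + length (img D true)) ≤-refl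
  (trans ep (*-comm 2 (length (img D false)))) (trans eq (*-comm 2 (length (img D true))))
  (combine (n ∷ M ∷ length (img D false) ∷ length (img D true) ∷ p ∷ q ∷ [])
    ((# 0 :+ 1+ (κ 2 :* # 1) ≈ # 4 :+ # 5 by eN) ∷ (# 4 ≈ κ 2 :* # 2 by ep)
     ∷ (# 5 ≈ κ 2 :* # 3 by eq) ∷ []) (# 0 :+ κ 2 :* # 1 :+ κ 1) ((# 2 :+ # 3) :* κ 2))
-- Period 2 has no room for 11 and a 0, so both letters of a central word are doubled. Its length is
-- p + q - 4; the required 2 ≤ M holds because R - P is positive and less than M.
... | M , inj₁ refl = centre alldoubled D (M ∸ 2)
  (trans (length-double-all (img D false)) (sym ep)) (trans (length-double-all (img D true)) (sym eq))
  (combine (n ∷ (M ∸ 2) ∷ p ∷ q ∷ M ∷ [])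
    ((# 0 :+ κ 2 :* # 4 ≈ # 2 :+ # 3 by eN) ∷ 2 ∙ (κ 2 :+ # 1 ≈ # 4 by m+[n∸m]≡n 2≤M) ∷ [])
    (# 0 :+ κ 2 :* # 1 :+ κ 4) (# 2 :+ # 3))
  where
  P R : ℕ
  P = length (img D false)
  R = length (img D true)
  P<R : P < R
  P<R = farkas′ 2 (P ∷ R ∷ p ∷ q ∷ [])
    ((1+ # 2 ≼ # 3 by p<q) ∷ (κ 2 :* # 0 ≃ # 2 by sym ep) ∷ (# 3 ≃ κ 2 :* # 1 by eq) ∷ [])
    (1+ # 0) (# 1)
  R<P+M : R < P + M
  R<P+M = farkas′ 2 (R ∷ P ∷ M ∷ n ∷ p ∷ q ∷ [])
    ((1+ # 3 ≼ κ 2 :* # 4 by n<2p) ∷ (# 4 ≃ κ 2 :* # 1 by ep) ∷ (κ 2 :* # 0 ≃ # 5 by sym eq)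
     ∷ (# 4 :+ # 5 ≃ # 3 :+ κ 2 :* # 2 by sym eN) ∷ []) (1+ # 0) (# 1 :+ # 2)
  2≤M : 2 ≤ M
  2≤M = farkas (M ∷ P ∷ R ∷ [])
    ((1+ # 1 ≼ # 2 by P<R) ∷ (1+ # 2 ≼ # 1 :+ # 0 by R<P+M) ∷ []) (κ 2) (# 0)
-- A common divisor of at least 3 leaves room for 1 or 11 besides the zeros, so either parity is met
-- by a residue word with this period.
kind-short n p q 1≤p p<q q≤n n<2p | N , eN | suc (suc (suc g)) , D , ep , eq with parity N
... | M , inj₂ refl = residue false (2 + g) M P R (P + R) (s≤s z≤n)
  (combine (p ∷ P ∷ g ∷ [])
    ((# 0 ≈ (κ 3 :+ # 2) :* # 1 by ep) ∷ []) (# 0) (# 1 :* (κ 2 :+ # 2 :+ κ 1))) (combine (q ∷ R ∷ g ∷ [])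
      ((# 0 ≈ (κ 3 :+ # 2) :* # 1 by eq) ∷ []) (# 0) (# 1 :* (κ 2 :+ # 2 :+ κ 1)))
  (combine (n ∷ M ∷ P ∷ R ∷ g ∷ p ∷ q ∷ [])
    ((# 5 ≈ (κ 3 :+ # 4) :* # 2 by ep) ∷ (# 6 ≈ (κ 3 :+ # 4) :* # 3 by eq)
     ∷ (# 0 :+ 1+ (κ 2 :* # 1) ≈ # 5 :+ # 6 by eN) ∷ [])
    (# 0 :+ κ 2 :* # 1 :+ κ 1) ((# 2 :+ # 3) :* (κ 2 :+ # 4 :+ κ 1)))
  where
  P R : ℕ
  P = length (img D false)
  R = length (img D true)
... | M , inj₁ refl = residue true (1 + g) (pred M) P R (P + R) (s≤s z≤n)
  (combine (p ∷ P ∷ g ∷ [])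
    ((# 0 ≈ (κ 3 :+ # 2) :* # 1 by ep) ∷ []) (# 0) (# 1 :* (1+ # 2 :+ κ 2))) (combine (q ∷ R ∷ g ∷ [])
      ((# 0 ≈ (κ 3 :+ # 2) :* # 1 by eq) ∷ []) (# 0) (# 1 :* (1+ # 2 :+ κ 2)))
  (combine (n ∷ pred M ∷ P ∷ R ∷ g ∷ p ∷ q ∷ M ∷ [])
    ((# 5 ≈ (κ 3 :+ # 4) :* # 2 by ep) ∷ (# 6 ≈ (κ 3 :+ # 4) :* # 3 by eq)
     ∷ (# 0 :+ κ 2 :* # 7 ≈ # 5 :+ # 6 by eN) ∷ 2 ∙ (1+ # 1 ≈ # 7 by m+[n∸m]≡n 1≤M) ∷ [])
    (# 0 :+ κ 2 :* # 1 :+ κ 2) ((# 2 :+ # 3) :* (1+ # 4 :+ κ 2)))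
  where
  P R : ℕ
  P = length (img D false)
  R = length (img D true)
  1≤M : 1 ≤ M
  1≤M = positive 0 M eN z≤n p<q n<2p

-- The two reflections compose to the translation by p.
SymL-period : ∀ {B : Set} {u : ℕ → B} n p → SymL n u → SymL (n ∸ p) u → ∀ k → p + k < n → u (p + k) ≡ u k
SymL-period n p s t k h with m≤n⇒∃[o]m+o≡n h
... | l , eq = trans (s (p + k) l eq) (sym (t k l
  (sym (trans (cong (_∸ p)
    (trans (sym eq) (combine (p ∷ k ∷ l ∷ []) [] (1+ (# 0 :+ # 1 :+ # 2)) (# 0 :+ 1+ (# 1 :+ # 2)))))
    (m+n∸m≡n p _)))))

period-one : ∀ {u : ℕ → Bool} n → (∀ k → 1 + k < n → u (1 + k) ≡ u k) → ¬ NonConstant n u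
period-one {u} n h (a , b , a<n , b<n , ne) = ne (trans (const a a<n) (sym (const b b<n)))
  where
  const : ∀ k → k < n → u k ≡ u 0
  const zero    _   = refl
  const (suc k) k<n = trans (h k k<n) (const k (<-trans (n<1+n k) k<n))

-- Reflection in a word of even length exchanges even and odd positions, so the two classes modulo 2
-- carry the same letter.
period-two : ∀ {u : ℕ → Bool} m → SymL (2 * m) u →
  (∀ k → 2 + k < 2 * m → u (2 + k) ≡ u k) → ¬ NonConstant (2 * m) u
period-two {u} zero    s h (a , b , () , _)
period-two {u} (suc m) s h (a , b , a<n , b<n , ne) = ne (trans (const a a<n) (sym (const b b<n)))
  where
  odd : ∀ k → suc (2 * k) < 2 * suc m → u (suc (2 * k)) ≡ u 1
  odd zero    _  = refl
  odd (suc k) lt = trans (cong u (combine (k ∷ []) [] (1+ (κ 2 :* 1+ # 0)) (κ 2 :+ 1+ (κ 2 :* # 0))))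
    (trans (h (suc (2 * k)) (farkas (k ∷ m ∷ [])
      ((1+ (1+ (κ 2 :* 1+ # 0)) ≼ κ 2 :* 1+ # 1 by lt) ∷ [])
      (1+ (κ 2 :+ 1+ (κ 2 :* # 0))) (κ 2 :* 1+ # 1))) (odd k (farkas (k ∷ m ∷ [])
        ((1+ (1+ (κ 2 :* 1+ # 0)) ≼ κ 2 :* 1+ # 1 by lt) ∷ []) (1+ (1+ (κ 2 :* # 0))) (κ 2 :* 1+ # 1))))
  1≡0 : u 1 ≡ u 0
  1≡0 = trans (sym (odd m (farkas (m ∷ []) [] (1+ (1+ (κ 2 :* # 0))) (κ 2 :* 1+ # 0))))
    (s (suc (2 * m)) 0 (combine (m ∷ []) [] (1+ (1+ (κ 2 :* # 0) :+ κ 0)) (κ 2 :* 1+ # 0)))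
  const : ∀ k → k < 2 * suc m → u k ≡ u 0
  const zero          _   = refl
  const (suc zero)    _   = 1≡0
  const (suc (suc k)) k<n = trans (h k k<n) (const k (<-trans (n<1+n k) (<-trans (n<1+n (suc k)) k<n)))

-- The parity-refined theorem of Fine and Wilf, by the subtractive Euclidean algorithm.
fine-wilf : ∀ s n p q (u : ℕ → Bool) → p + q ≤ s → 1 ≤ p → 1 ≤ q → p ≤ n → q ≤ n →
  SymL n u → SymL (n ∸ p) u → SymL (n ∸ q) u → NonConstant n u → Kind n p q
fine-wilf-< : ∀ s n p q (u : ℕ → Bool) → p + q ≤ suc s → p < q → 1 ≤ p → q ≤ n →
  SymL n u → SymL (n ∸ p) u → SymL (n ∸ q) u → NonConstant n u → Kind n p q
fine-wilf-≡ : ∀ n p (u : ℕ → Bool) → 1 ≤ p → SymL n u → SymL (n ∸ p) u → NonConstant n u → Kind n p p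

fine-wilf zero    n p q u h 1≤p = contradiction (≤-trans 1≤p (≤-trans (m≤m+n p q) h)) λ ()
fine-wilf (suc s) n p q u h 1≤p 1≤q p≤n q≤n sn sp sq nc with <-cmp p q
... | tri< p<q _ _  = fine-wilf-< s n p q u h p<q 1≤p q≤n sn sp sq nc
... | tri≈ _ refl _ = fine-wilf-≡ n p u 1≤p sn sp nc
... | tri> _ _ q<p  = Kind-swap (fine-wilf-< s n q p u
  (subst (_≤ suc s) (+-comm p q) h) q<p 1≤q p≤n sn sq sp nc)

fine-wilf-< s n p q u h p<q 1≤p q≤n sn sp sq nc with n <? 2 * p
... | yes n<2p = kind-short n p q 1≤p p<q q≤n n<2p
... | no n≮2p with m≤n⇒∃[o]m+o≡n (<⇒≤ p<q) | m≤n⇒∃[o]m+o≡n {p} {n} (≤-trans (<⇒≤ p<q) q≤n)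
-- The prefix of length n - q is also the one of length n′ - r, so the shorter word has the periods
-- p and r. As n ≥ 2p, each position has a representative below n′ modulo p, which preserves
-- nonconstancy.
... | r , refl | n′ , refl = Kind-step (fine-wilf s n′ p r u
    (farkas (p ∷ r ∷ s ∷ [])
      ((# 0 :+ (# 0 :+ # 1) ≼ 1+ # 2 by h) ∷ (κ 1 ≼ # 0 by 1≤p) ∷ []) (# 0 :+ # 1) (# 2)) 1≤p
        (farkas (r ∷ p ∷ []) ((1+ # 1 ≼ # 1 :+ # 0 by p<q) ∷ []) (κ 1) (# 0)) p≤n′ (+-cancelˡ-≤ p r n′ q≤n)
    sn′ (SymL-∸ n′ p (subst (λ m → SymL m u) (+-comm p n′) sn) sn′)
      (subst (λ m → SymL m u) ([m+n]∸[m+o]≡n∸o p n′ r) sq) (nc′ nc))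
  where
  p≤n′ : p ≤ n′
  p≤n′ = farkas (p ∷ n′ ∷ [])
    ((κ 2 :* # 0 ≼ # 0 :+ # 1 by ≮⇒≥ n≮2p) ∷ []) (# 0) (# 1)
  sn′ : SymL n′ u
  sn′ = subst (λ m → SymL m u) (m+n∸m≡n p n′) sp
  below : ∀ a → a < p + n′ → ∃ λ a′ → a′ < n′ × u a′ ≡ u a
  below a a<n with a <? n′
  ... | yes a<n′ = a , a<n′ , refl
  ... | no a≮n′ with m≤n⇒∃[o]m+o≡n (≤-trans p≤n′ (≮⇒≥ a≮n′))
  ... | a′ , refl = a′ , +-cancelˡ-< p a′ n′ a<n , sym (SymL-period (p + n′) p sn sp a′ a<n)
  nc′ : NonConstant (p + n′) u → NonConstant n′ u
  nc′ (a , b , a<n , b<n , ne) with below a a<n | below b b<n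
  ... | a′ , a′< , ea | b′ , b′< , eb = a′ , b′ , a′< , b′< , λ e → ne (trans (sym ea) (trans e eb))

fine-wilf-≡ n p u 1≤p sn sp nc with parity n
fine-wilf-≡ n 1 u 1≤p sn sp nc | _ = contradiction nc (period-one n (SymL-period n 1 sn sp))
fine-wilf-≡ n (suc (suc f)) u 1≤p sn sp nc | m , inj₂ refl =
  -- The offset (f + 1)(m + 1) turns n + 2z + 1 into 2(m + 1)(f + 2), a multiple of the period. In
  -- the last clause (f + 2)(m + 1) does the same for n + 2z + 2 and period f + 3.
  residue false (suc f) (suc f * suc m) 1 1 (2 * suc m) (s≤s z≤n)
  (combine (f ∷ []) [] (κ 2 :+ # 0) (κ 1 :* (1+ # 0 :+ κ 1)))
    (combine (f ∷ []) [] (κ 2 :+ # 0) (κ 1 :* (1+ # 0 :+ κ 1)))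
  (combine (m ∷ f ∷ []) [] (1+ (κ 2 :* # 0) :+ κ 2 :* (1+ # 1 :* 1+ # 0) :+ κ 1)
    (κ 2 :* 1+ # 0 :* (1+ # 1 :+ κ 1)))
fine-wilf-≡ n 2 u 1≤p sn sp nc | m , inj₁ refl =
  contradiction nc (period-two m sn (SymL-period (2 * m) 2 sn sp))
fine-wilf-≡ n (suc (suc (suc f))) u 1≤p sn sp nc | m , inj₁ refl =
  residue true (suc f) (suc (suc f) * suc m) 1 1 (2 * suc m) (s≤s z≤n)
  (combine (f ∷ []) [] (κ 3 :+ # 0) (κ 1 :* (1+ # 0 :+ κ 2)))
    (combine (f ∷ []) [] (κ 3 :+ # 0) (κ 1 :* (1+ # 0 :+ κ 2)))
  (combine (m ∷ f ∷ []) [] (κ 2 :* # 0 :+ κ 2 :* (1+ (1+ # 1) :* 1+ # 0) :+ κ 2)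
    (κ 2 :* 1+ # 0 :* (1+ # 1 :+ κ 2)))

-- The word is infinite and p-periodic so that it can be continued beyond [0 , n) on both sides. The
-- second period enters only through one reflection inside [0 , n), which is the form that the third
-- palindrome takes.
record Solution (n p q : ℕ) : Set where
  field
    word    : ℕ → Bool
    period  : ∀ k → word (k + p) ≡ word k
    mirror  : ∀ k l x y → suc (k + l) + x * p ≡ n + y * p → word k ≡ word l
    second  : ∀ k l → suc (k + l) + q ≡ n → word k ≡ word l
    central : ∀ z m → Central (applyUpTo (λ k → word (z + k)) m)
    occurs  : ∀ c → ∃ λ k → word k ≡ c

∸-intro : ∀ a {p n} → a + p ≡ n → a ≡ n ∸ p
∸-intro a {p} e = trans (sym (m+n∸n≡m a p)) (cong (_∸ p) e)

solution : ∀ {n p q} → p ≤ n → q ≤ n → Kind n p q → Solution n p q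
solution {n} p≤n q≤n (centred A D a m refl refl en) = record
  { word       = λ k → Q (m + k)
  ; period  = λ k → trans (cong Q (sym (+-assoc m k p))) (Q-periodic (m + k))
  ; mirror  = λ k l x y eq → Q-mirror (m + k) (m + l) x y
      (combine (m ∷ k ∷ l ∷ x ∷ p ∷ length (WD A D) ∷ y ∷ n ∷ [])
        ((1+ (# 1 :+ # 2) :+ # 3 :* # 4 ≈ # 7 :+ # 6 :* # 4 by eq) ∷ (# 7 :+ κ 2 :* # 0 ≈ # 5 by sym en) ∷ [])
        (1+ (# 0 :+ # 1 :+ (# 0 :+ # 2)) :+ # 3 :* # 4) (# 5 :+ # 6 :* # 4))
  ; second  = λ k l eq →
      trans (Q-prefix-w (m + k) (farkas (m ∷ k ∷ length (WD A D) ∷ l ∷ q ∷ n ∷ [])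
        ((1+ (# 1 :+ # 3) :+ # 4 ≃ # 5 by eq) ∷ (# 5 :+ κ 2 :* # 0 ≃ # 2 by sym en) ∷ [])
        (1+ (# 0 :+ # 1)) (# 2)))
      (trans (WD-prefix A D (not a) (m + k) (m + l) (∸-intro (suc (m + k + (m + l)))
               (combine (m ∷ k ∷ l ∷ q ∷ length (WD A D) ∷ n ∷ [])
                 ((1+ (# 1 :+ # 2) :+ # 3 ≈ # 5 by eq) ∷ (# 5 :+ κ 2 :* # 0 ≈ # 4 by sym en) ∷ [])
                 (1+ (# 0 :+ # 1 :+ (# 0 :+ # 2)) :+ # 3) (# 4))))
             (sym (Q-prefix-w (m + l) (farkas (m ∷ l ∷ length (WD A D) ∷ k ∷ q ∷ n ∷ [])
               ((1+ (# 3 :+ # 1) :+ # 4 ≃ # 5 by eq) ∷ (# 5 :+ κ 2 :* # 0 ≃ # 2 by sym en) ∷ [])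
               (1+ (# 0 :+ # 1)) (# 2)))))
  ; central = λ z N → subst Central (applyUpTo-cong N λ k _ → cong Q (+-assoc m z k)) (Q-central (m + z) N)
  ; occurs  = occ
  }
  where
  open Limit A D a using (Q; Q-periodic; Q-mirror; Q-prefix-w; Q-central; Q-occurs-shifted)
  p q : ℕ
  p = length (imgD A D a)
  q = length (imgD A D (not a))
  n≤ : n ≤ length (WD A D)
  n≤ = farkas (n ∷ length (WD A D) ∷ m ∷ [])
    ((# 0 :+ κ 2 :* # 2 ≃ # 1 by sym en) ∷ []) (# 0) (# 1)
  -- Both return words fit into the central word, and by `long⇒∈` both letters then occur in it.
  short-enough : ∀ c → length (imgD A D c) ≤ n
  short-enough c with bool-cases c a
  ... | inj₁ refl = p≤n
  ... | inj₂ refl = q≤n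
  occ : ∀ c → ∃ λ k → Q (m + k) ≡ c
  occ c = commute (Q-occurs-shifted m (∈-++⁺ˡ (long⇒∈ A D c (≤-trans (short-enough c) n≤))))
    where
    commute : (∃ λ k → Q (k + m) ≡ c) → ∃ λ k → Q (m + k) ≡ c
    commute (k , eq) = k , trans (cong Q (+-comm m k)) eq
solution {n} p≤n q≤n (residue two f z X Y Z 1≤f refl refl en) = record
  { word       = λ k → Q (z + k)
  ; period  = λ k → trans (cong Q (trans (sym (+-assoc z k _)) (cong (λ e → z + k + X * e) (sym g≡f+d))))
    (Q-shift (z + k) X)
  ; mirror  = λ k l x y eq → congruent k l (x * X) (y * X)
      (combine (k ∷ l ∷ x ∷ X ∷ f ∷ d ∷ n ∷ y ∷ [])
        ((1+ (# 0 :+ # 1) :+ # 2 :* (# 3 :* (# 4 :+ # 5)) ≈ # 6 :+ # 7 :* (# 3 :* (# 4 :+ # 5)) by eq) ∷ [])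
        (1+ (# 0 :+ # 1) :+ # 2 :* # 3 :* (# 4 :+ # 5)) (# 6 :+ # 7 :* # 3 :* (# 4 :+ # 5)))
  ; second  = λ k l eq → congruent k l Y 0 (trans eq (sym (+-identityʳ n)))
  ; central = λ o N → subst Central (applyUpTo-cong N λ k _ → cong Q (+-assoc z o k)) (Q-central (z + o) N)
  ; occurs  = occ
  }
  where
  open Residue two f 1≤f using (Q; Q-shift; Q-mirror; Q-central; Q-occurs-shifted; Q-true; Q-false; g; d; g≡f+d;
    n≡f; w; 1≤g)
  congruent : ∀ k l x y → suc (k + l) + x * (f + d) ≡ n + y * (f + d) → Q (z + k) ≡ Q (z + l)
  congruent k l x y eq = Q-mirror (z + k) (z + l) (x + 1) (Z + y)
    (subst₂ (λ e m → suc (z + k + (z + l)) + (x + 1) * e ≡ m + (Z + y) * e) (sym g≡f+d) (sym n≡f)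
      (combine (z ∷ k ∷ l ∷ x ∷ f ∷ d ∷ Z ∷ y ∷ n ∷ [])
        ((1+ (# 1 :+ # 2) :+ # 3 :* (# 4 :+ # 5) ≈ # 8 :+ # 7 :* (# 4 :+ # 5) by eq)
         ∷ (# 8 :+ κ 2 :* # 0 :+ # 5 ≈ # 6 :* (# 4 :+ # 5) by en) ∷ [])
        (1+ (# 0 :+ # 1 :+ (# 0 :+ # 2)) :+ (# 3 :+ κ 1) :* (# 4 :+ # 5))
          (# 4 :+ (# 6 :+ # 7) :* (# 4 :+ # 5))))
  unshift : ∀ k → z + (k + z * pred g) ≡ k + z * g
  unshift k = combine (z ∷ k ∷ pred g ∷ g ∷ [])
    ((# 0 :* 1+ # 2 ≈ # 0 :* # 3 by cong (z *_) (m+[n∸m]≡n 1≤g)) ∷ [])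
    (# 0 :+ (# 1 :+ # 0 :* # 2)) (# 1 :+ # 0 :* # 3)
  occ : ∀ c → ∃ λ k → Q (z + k) ≡ c
  occ true  = f + z * pred g , trans (cong Q (unshift f)) (Q-true z)
  occ false = 0 + z * pred g , trans (cong Q (unshift 0)) (Q-false 0 z 1≤f)

-- Reduction of three palindromes to two periods

periodic-mod : ∀ {B : Set} {v : ℕ → B} p → 1 ≤ p → (∀ k → v (k + p) ≡ v k) → ∀ k → ∃ λ j → j < p × v j ≡ v k
periodic-mod {v = v} (suc p) _ per k = k % suc p , m%n<n k (suc p) ,
  sym (trans (cong v (m≡m%n+[m/n]*n k (suc p))) (multiple (k % suc p) (k / suc p)))
  where
  multiple : ∀ k x → v (k + x * suc p) ≡ v k
  multiple k zero    = cong v (+-identityʳ k)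
  multiple k (suc x) =
    trans (cong v (combine (k ∷ p ∷ x ∷ []) [] (# 0 :+ (1+ # 1 :+ # 2 :* 1+ # 1))
    (# 0 :+ # 2 :* 1+ # 1 :+ 1+ # 1))) (trans (per (k + x * suc p)) (multiple k x))

-- If S generates u and v satisfies S, then v is a renaming of u; a nonconstant v makes this
-- renaming injective, so u is v or its complement. A constant v would reveal nothing about u.
Realisation : ℕ → ((ℕ → Bool) → Set) → Set
Realisation n P = ∃ λ v → P v × NonConstant n v × Central (applyUpTo v n)

Realisation-map : ∀ {n} {P Q : (ℕ → Bool) → Set} → (∀ v → P v → Q v) → Realisation n P → Realisation n Q
Realisation-map f (v , p , rest) = v , f v p , rest

both-letters : ∀ {n} {v : ℕ → Bool} → (∃ λ k → k < n × v k ≡ true) →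
  (∃ λ k → k < n × v k ≡ false) → NonConstant n v
both-letters (a , a< , ea) (b , b< , eb) = a , b , a< , b< , λ e → case trans (sym ea) (trans e eb) of λ ()

-- A third palindrome filling the whole of [0, n) adds nothing, and p then serves as second period.
threefold : ∀ n p r (u : ℕ → Bool) → 1 ≤ p → p ≤ n → suc r ≤ n → SymL n u → SymL (n ∸ p) u → SymL (suc r) u →
  NonConstant n u →
  ∃ λ q → Σ (Solution n p q) λ S → SymL (suc r) (Solution.word S)
threefold n p r u 1≤p p≤n r<n sn sp s3 nc with m≤n⇒∃[o]m+o≡n r<n
... | zero  , e = p , S , λ k l kl → Solution.mirror S k l 0 0 (combine (k ∷ l ∷ p ∷ n ∷ r ∷ [])
  ((1+ (# 0 :+ # 1) ≈ 1+ # 4 by kl) ∷ (1+ # 4 :+ κ 0 ≈ # 3 by e) ∷ [])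
  (1+ (# 0 :+ # 1) :+ κ 0 :* # 2) (# 3 :+ κ 0 :* # 2))
  where
  S : Solution n p p
  S = solution p≤n p≤n (fine-wilf (p + p) n p p u ≤-refl 1≤p 1≤p p≤n p≤n sn sp sp nc)
... | suc q , e = suc q , S , λ k l kl → Solution.second S k l (trans (cong (_+ suc q) kl) e)
  where
  q≤n : suc q ≤ n
  q≤n = farkas (q ∷ n ∷ r ∷ [])
    ((1+ # 2 :+ 1+ # 0 ≃ # 1 by e) ∷ []) (1+ # 0) (# 1)
  S : Solution n p (suc q)
  S = solution p≤n q≤n (fine-wilf (p + suc q) n p (suc q) u ≤-refl 1≤p (s≤s z≤n) p≤n q≤n sn sp
    (subst (λ m → SymL m u) (∸-intro (suc r) e) s3) nc)

module Window (n′ i p r : ℕ) (1≤p : 1 ≤ p) (p≤n′ : p ≤ n′) where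
  n : ℕ
  n = i + n′ + i

  TwoSym : (ℕ → Bool) → Set
  TwoSym v = (∀ k l → suc (k + l) ≡ n → v k ≡ v l) × (∀ k l → suc (k + l) + p ≡ n → v k ≡ v l)

  module Restrict (u : ℕ → Bool) (sn : ∀ k l → suc (k + l) ≡ n → u k ≡ u l)
    (sp : ∀ k l → suc (k + l) + p ≡ n → u k ≡ u l) where
    u′ : ℕ → Bool
    u′ k = u (i + k)

    private
      per : ∀ k → k + p < n → u (k + p) ≡ u k
      per k h with m≤n⇒∃[o]m+o≡n h
      ... | l , e = trans (sn (k + p) l e) (sym
        (sp k l (trans (combine (k ∷ l ∷ p ∷ []) [] (1+ (# 0 :+ # 1) :+ # 2) (1+ (# 0 :+ # 2 :+ # 1))) e)))

      -- positions below the window move up, and those above it down, by multiples of p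
      down : ∀ s c → c ≤ s → i + c < n → ∃ λ a′ → a′ < n′ × u′ a′ ≡ u (i + c)
      down s c c≤s c<n with c <? n′
      ... | yes c<n′ = c , c<n′ , refl
      down zero    c c≤s c<n | no c≮n′ = ⊥-elim (contra (c ∷ n′ ∷ p ∷ [])
        ((# 0 ≼ κ 0 by c≤s) ∷ (# 1 ≼ # 0 by ≮⇒≥ c≮n′) ∷ (# 2 ≼ # 1 by p≤n′) ∷ (κ 1 ≼ # 2 by 1≤p) ∷ []))
      down (suc s) c c≤s c<n | no c≮n′ with m≤n⇒∃[o]m+o≡n (≤-trans p≤n′ (≮⇒≥ c≮n′))
      ... | e , refl with down s e (farkas (e ∷ s ∷ p ∷ [])
        ((# 2 :+ # 0 ≼ 1+ # 1 by c≤s) ∷ (κ 1 ≼ # 2 by 1≤p) ∷ []) (# 0) (# 1)) (farkas (i ∷ e ∷ n′ ∷ p ∷ [])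
          ((1+ (# 0 :+ (# 3 :+ # 1)) ≼ # 0 :+ # 2 :+ # 0 by c<n) ∷ [])
          (1+ (# 0 :+ # 1)) (# 0 :+ # 2 :+ # 0))
      ... | a′ , a′< , eq = a′ , a′< , trans eq
        (sym (trans (cong u (combine (i ∷ p ∷ e ∷ []) [] (# 0 :+ (# 1 :+ # 2)) (# 0 :+ # 2 :+ # 1)))
        (per (i + e) (farkas (i ∷ e ∷ p ∷ n′ ∷ [])
        ((1+ (# 0 :+ (# 2 :+ # 1)) ≼ # 0 :+ # 3 :+ # 0 by c<n) ∷ [])
        (1+ (# 0 :+ # 1 :+ # 2)) (# 0 :+ # 3 :+ # 0)))))

      up : ∀ s a → i ≤ a + s → a < n → ∃ λ a′ → a′ < n′ × u′ a′ ≡ u a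
      up s a h a<n with i ≤? a
      ... | yes i≤a with m≤n⇒∃[o]m+o≡n i≤a
      ... | c , refl = down c c ≤-refl a<n
      up zero    a h a<n | no i≰a = contradiction (subst (i ≤_) (+-identityʳ a) h) i≰a
      up (suc s) a h a<n | no i≰a with up s (a + p) (farkas (i ∷ a ∷ p ∷ s ∷ [])
        ((# 0 ≼ # 1 :+ 1+ # 3 by h) ∷ (κ 1 ≼ # 2 by 1≤p) ∷ []) (# 0) (# 1 :+ # 2 :+ # 3))
          (farkas (a ∷ p ∷ i ∷ n′ ∷ [])
          (2 · (1+ # 0 ≼ # 2 by ≰⇒> i≰a) ∷ (# 1 ≼ # 3 by p≤n′) ∷ []) (1+ (# 0 :+ # 1)) (# 2 :+ # 3 :+ # 2))
      ... | a′ , a′< , eq = a′ , a′< , trans eq (per a (farkas (a ∷ p ∷ i ∷ n′ ∷ [])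
        (2 · (1+ # 0 ≼ # 2 by ≰⇒> i≰a) ∷ (# 1 ≼ # 3 by p≤n′) ∷ []) (1+ (# 0 :+ # 1)) (# 2 :+ # 3 :+ # 2)))

    restrict-nonconstant : NonConstant n u → NonConstant n′ u′
    restrict-nonconstant (a , b , a<n , b<n , ne) with up i a (m≤n+m i a) a<n | up i b (m≤n+m i b) b<n
    ... | a′ , a′< , ea | b′ , b′< , eb = a′ , b′ , a′< , b′< , λ e → ne (trans (sym ea) (trans e eb))

    restrict-sym : SymL n′ u′
    restrict-sym k l e = sn (i + k) (i + l) (combine (i ∷ k ∷ l ∷ n′ ∷ [])
      ((1+ (# 1 :+ # 2) ≈ # 3 by e) ∷ []) (1+ (# 0 :+ # 1 :+ (# 0 :+ # 2))) (# 0 :+ # 3 :+ # 0))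

    restrict-period : SymL (n′ ∸ p) u′
    restrict-period k l e = sp (i + k) (i + l) (combine (i ∷ k ∷ l ∷ p ∷ n′ ∷ [])
      ((1+ (# 1 :+ # 2) :+ # 3 ≈ # 4 by ∸-suc-+ n′ p e) ∷ [])
      (1+ (# 0 :+ # 1 :+ (# 0 :+ # 2)) :+ # 3) (# 0 :+ # 4 :+ # 0))

  module Extend {q : ℕ} (S : Solution n′ p q) (s3 : SymL (suc r) (Solution.word S)) where
    open Solution S

    private
      z : ℕ
      -- Congruent to -i modulo p, so that `v (i + k)` is `word k`.
      z = i * pred p

      zp : z + i ≡ i * p
      zp = combine (i ∷ pred p ∷ p ∷ [])
        ((# 0 :* 1+ # 1 ≈ # 0 :* # 2 by cong (i *_) (m+[n∸m]≡n 1≤p)) ∷ [])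
        (# 0 :* # 1 :+ # 0) (# 0 :* # 2)

    v : ℕ → Bool
    v k = word (z + k)

    private
      shifted : ∀ k x → word (k + x * p) ≡ word k
      shifted k zero    = cong word (+-identityʳ k)
      shifted k (suc x) =
        trans (cong word (combine (k ∷ p ∷ x ∷ []) [] (# 0 :+ (# 1 :+ # 2 :* # 1)) (# 0 :+ # 2 :* # 1 :+ # 1)))
        (trans (period (k + x * p)) (shifted k x))

      v-window : ∀ k → v (i + k) ≡ word k
      v-window k = trans (cong word (combine (z ∷ i ∷ k ∷ p ∷ [])
        ((# 0 :+ # 1 ≈ # 1 :* # 3 by zp) ∷ []) (# 0 :+ (# 1 :+ # 2)) (# 2 :+ # 1 :* # 3))) (shifted k i)

      find : ∀ c → ∃ λ k → k < n × v k ≡ c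
      find c with occurs c
      ... | k , e with periodic-mod {v = v} p 1≤p
        (λ k → trans (cong word (sym (+-assoc z k p))) (period (z + k))) (i + k)
      ... | j , j<p , e′ = j , (farkas (j ∷ i ∷ n′ ∷ p ∷ [])
        ((1+ # 0 ≼ # 3 by j<p) ∷ (# 3 ≼ # 2 by p≤n′) ∷ []) (1+ # 0) (# 1 :+ # 2 :+ # 1)) ,
          trans e′ (trans (v-window k) e)

    twoSym : TwoSym v
    twoSym = (λ k l eq → mirror (z + k) (z + l) 0 (2 * i)
        (combine (z ∷ k ∷ l ∷ p ∷ n′ ∷ i ∷ [])
          ((1+ (# 1 :+ # 2) ≈ # 5 :+ # 4 :+ # 5 by eq) ∷ 2 ∙ (# 0 :+ # 5 ≈ # 5 :* # 3 by zp) ∷ [])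
          (1+ (# 0 :+ # 1 :+ (# 0 :+ # 2)) :+ κ 0 :* # 3) (# 4 :+ κ 2 :* # 5 :* # 3))) ,
      λ k l eq → mirror (z + k) (z + l) 1 (2 * i)
        (combine (z ∷ k ∷ l ∷ p ∷ n′ ∷ i ∷ [])
          ((1+ (# 1 :+ # 2) :+ # 3 ≈ # 5 :+ # 4 :+ # 5 by eq) ∷ 2 ∙ (# 0 :+ # 5 ≈ # 5 :* # 3 by zp) ∷ [])
          (1+ (# 0 :+ # 1 :+ (# 0 :+ # 2)) :+ κ 1 :* # 3) (# 4 :+ κ 2 :* # 5 :* # 3))

    third : Sym (i , i + r) v
    third k l i≤k i≤l e with m≤n⇒∃[o]m+o≡n i≤k | m≤n⇒∃[o]m+o≡n i≤l
    ... | k′ , refl | l′ , refl = trans (v-window k′) (trans (s3 k′ l′ (combine (k′ ∷ l′ ∷ r ∷ i ∷ [])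
      ((# 3 :+ # 0 :+ (# 3 :+ # 1) ≈ # 3 :+ (# 3 :+ # 2) by e) ∷ []) (1+ (# 0 :+ # 1)) (1+ # 2)))
        (sym (v-window l′)))

    nonconstant : NonConstant n v
    nonconstant = both-letters (find true) (find false)

    v-central : Central (applyUpTo v n)
    v-central = central z n

-- Solved on the window [i, n ∸ i), where (i , k) becomes a prefix, and extended with period p.
window : ∀ n i p j k (u : ℕ → Bool) → 1 ≤ p → p + j ≡ n → 2 * i ≤ j → i ≤ k → i + k < n →
  SymL n u → SymL j u → Sym (i , k) u → NonConstant n u →
  Realisation n λ v → SymL n v × SymL j v × Sym (i , k) v
window n i p j k u 1≤p pj 2i≤j i≤k ik<n sn sj s3 nc with m≤n⇒∃[o]m+o≡n i≤k | m≤n⇒∃[o]m+o≡n 2i≤j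
... | r , refl | x , refl = conclude (threefold n′ p r u′ 1≤p p≤n′ (farkas (r ∷ n′ ∷ i ∷ n ∷ [])
  ((1+ (# 2 :+ (# 2 :+ # 0)) ≼ # 3 by ik<n) ∷ (# 3 ≃ # 2 :+ # 1 :+ # 2 by sym eq) ∷ [])
  (1+ # 0) (# 1))
    restrict-sym restrict-period s3′ (restrict-nonconstant (subst (λ m → NonConstant m u) (sym eq) nc)))
  where
  n′ : ℕ
  n′ = p + x
  p≤n′ : p ≤ n′
  p≤n′ = m≤m+n p x
  eq : i + n′ + i ≡ n
  eq = combine (i ∷ p ∷ x ∷ n ∷ [])
    ((# 1 :+ (κ 2 :* # 0 :+ # 2) ≈ # 3 by pj) ∷ []) (# 0 :+ (# 1 :+ # 2) :+ # 0) (# 3)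
  open Window n′ i p r 1≤p p≤n′ hiding (n)
  sn′ : ∀ k l → suc (k + l) ≡ i + n′ + i → u k ≡ u l
  sn′ k l e = sn k l (trans e eq)
  sp′ : ∀ k l → suc (k + l) + p ≡ i + n′ + i → u k ≡ u l
  sp′ k l e = sj k l (combine (k ∷ l ∷ i ∷ x ∷ p ∷ n′ ∷ n ∷ [])
    ((1+ (# 0 :+ # 1) :+ # 4 ≈ # 2 :+ # 5 :+ # 2 by e) ∷ (# 2 :+ # 5 :+ # 2 ≈ # 6 by eq)
     ∷ (# 6 ≈ # 4 :+ (κ 2 :* # 2 :+ # 3) by sym pj) ∷ []) (1+ (# 0 :+ # 1)) (κ 2 :* # 2 :+ # 3))
  open Restrict u sn′ sp′
  s3′ : SymL (suc r) u′
  s3′ k l e = s3 (i + k) (i + l) (m≤m+n i k) (m≤m+n i l) (combine (i ∷ k ∷ l ∷ r ∷ [])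
    ((1+ (# 1 :+ # 2) ≈ 1+ # 3 by e) ∷ []) (# 0 :+ # 1 :+ (# 0 :+ # 2)) (# 0 :+ (# 0 :+ # 3)))
  conclude : (∃ λ q → Σ (Solution n′ p q) λ S → SymL (suc r) (Solution.word S)) → Realisation n λ v → SymL n v ×
    SymL j v × Sym (i , k) v
  conclude (q , S , s) = v ,
    ((λ k l h → proj₁ twoSym k l (trans h (sym eq))) ,
     (λ k l h → proj₂ twoSym k l (combine (k ∷ l ∷ p ∷ i ∷ n′ ∷ x ∷ n ∷ [])
       ((1+ (# 0 :+ # 1) ≈ κ 2 :* # 3 :+ # 5 by h) ∷ (# 6 ≈ # 3 :+ # 4 :+ # 3 by sym eq)
        ∷ (# 2 :+ (κ 2 :* # 3 :+ # 5) ≈ # 6 by pj) ∷ []) (1+ (# 0 :+ # 1) :+ # 2) (# 3 :+ # 4 :+ # 3))) , third)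
          ,
    subst (λ m → NonConstant m v) eq nonconstant , subst (λ m → Central (applyUpTo v m)) eq v-central
    where open Extend S s

-- The residue word whose letter 1 sits at the centre [h, h + d) of the prefix [0, 2h + d).
avoid : ∀ two h f n j → 1 ≤ f → let d = length (doubled (_∧ two) true) in j ≡ 2 * h + d → n ≡ 2 * h + d + (f + d) →
  Realisation n λ v → SymL n v × SymL j v × (∀ i k → h + d ≤ i → i + k < n → Sym (i , k) v)
avoid two h f n j 1≤f refl refl = v ,
    ((λ k l e → mirror k l (2 + 2 * h) (combine (z ∷ k ∷ l ∷ f ∷ h ∷ d ∷ [])
      ((1+ (# 1 :+ # 2) ≈ κ 2 :* # 4 :+ # 5 :+ (# 3 :+ # 5) by e)
       ∷ 2 ∙ (# 0 :+ # 4 ≈ # 3 :+ # 4 :* (# 3 :+ # 5) by zp) ∷ [])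
      (1+ (# 0 :+ # 1 :+ (# 0 :+ # 2))) (# 3 :+ (κ 2 :+ κ 2 :* # 4) :* (# 3 :+ # 5)))) ,
     (λ k l e → mirror k l (1 + 2 * h) (combine (z ∷ k ∷ l ∷ f ∷ h ∷ d ∷ [])
       ((1+ (# 1 :+ # 2) ≈ κ 2 :* # 4 :+ # 5 by e) ∷ 2 ∙ (# 0 :+ # 4 ≈ # 3 :+ # 4 :* (# 3 :+ # 5) by zp) ∷ [])
       (1+ (# 0 :+ # 1 :+ (# 0 :+ # 2))) (# 3 :+ 1+ (κ 2 :* # 4) :* (# 3 :+ # 5)))) ,
     -- An interval that starts at h + d or later and has i + k < n ends before h + d + f, hence
     -- lies in a block of zeros.
     λ i k h≤i ik k′ l′ i≤k i≤l e → trans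
      (zero-at k′ (≤-trans h≤i i≤k) (farkas (k′ ∷ h ∷ d ∷ f ∷ l′ ∷ i ∷ k ∷ [])
        ((# 0 :+ # 4 ≃ # 5 :+ # 6 by e) ∷ (1+ (# 5 :+ # 6) ≼ κ 2 :* # 1 :+ # 2 :+ (# 3 :+ # 2) by ik)
         ∷ (# 1 :+ # 2 ≼ # 5 by h≤i) ∷ (# 5 ≼ # 4 by i≤l) ∷ []) (1+ # 0) (# 1 :+ # 2 :+ # 3)))
      (sym (zero-at l′ (≤-trans h≤i i≤l) (farkas (l′ ∷ h ∷ d ∷ f ∷ k′ ∷ i ∷ k ∷ [])
        ((# 4 :+ # 0 ≃ # 5 :+ # 6 by e) ∷ (1+ (# 5 :+ # 6) ≼ κ 2 :* # 1 :+ # 2 :+ (# 3 :+ # 2) by ik)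
         ∷ (# 1 :+ # 2 ≼ # 5 by h≤i) ∷ (# 5 ≼ # 4 by i≤k) ∷ []) (1+ # 0) (# 1 :+ # 2 :+ # 3))))) ,
    (h , h + d , (farkas (h ∷ d ∷ f ∷ [])
      ((κ 1 ≼ # 2 by 1≤f) ∷ []) (1+ # 0) (κ 2 :* # 0 :+ # 1 :+ (# 2 :+ # 1))) , (farkas (h ∷ d ∷ f ∷ [])
        ((κ 1 ≼ # 2 by 1≤f) ∷ []) (1+ (# 0 :+ # 1)) (κ 2 :* # 0 :+ # 1 :+ (# 2 :+ # 1))) ,
      λ e → case trans (sym one-at) (trans e (zero-at (h + d) ≤-refl (farkas (h ∷ d ∷ f ∷ [])
        ((κ 1 ≼ # 2 by 1≤f) ∷ []) (1+ (# 0 :+ # 1)) (# 0 :+ # 1 :+ # 2)))) of λ ()) ,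
    Q-central z (2 * h + d + (f + d))
  where
  open Residue two f 1≤f using (Q; Q-mirror; Q-true; Q-false; Q-central; g; d; g≡f+d; n≡f)
  z : ℕ
  -- A block of letters 1 starts at f + h * (f + d) in Q; this offset moves its start to h.
  z = f + h * pred (f + d)
  zp : z + h ≡ f + h * (f + d)
  zp = combine (f ∷ h ∷ pred (f + d) ∷ d ∷ [])
    ((# 1 :* 1+ # 2 ≈ # 1 :* (# 0 :+ # 3) by cong (h *_) (m+[n∸m]≡n {1} {f + d} (≤-trans 1≤f (m≤m+n f d)))) ∷
      [])
    (# 0 :+ # 1 :* # 2 :+ # 1) (# 0 :+ # 1 :* (# 0 :+ # 3))
  v : ℕ → Bool
  v k = Q (z + k)
  mirror : ∀ k l y → suc (z + k + (z + l)) ≡ f + y * (f + d) → v k ≡ v l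
  mirror k l y e = Q-mirror (z + k) (z + l) 0 y
    (trans (+-identityʳ _) (trans e (cong₂ (λ m g → m + y * g) (sym n≡f) (sym g≡f+d))))
  one-at : v h ≡ true
  one-at = trans (cong Q (trans zp (cong (λ g → f + h * g) (sym g≡f+d)))) (Q-true h)
  zero-at : ∀ k → h + d ≤ k → k < h + d + f → v k ≡ false
  zero-at k le lt with m≤n⇒∃[o]m+o≡n le
  ... | x , refl = trans (cong Q (trans (combine (z ∷ h ∷ d ∷ x ∷ f ∷ [])
    ((# 0 :+ # 1 ≈ # 4 :+ # 1 :* (# 4 :+ # 2) by zp) ∷ [])
    (# 0 :+ (# 1 :+ # 2 :+ # 3)) (# 3 :+ (# 1 :+ κ 1) :* (# 4 :+ # 2)))
      (cong (λ g → x + (h + 1) * g) (sym g≡f+d))))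
    (Q-false x (h + 1) (+-cancelˡ-< (h + d) x f lt))

3≤n : ∀ n {u : ℕ → Bool} → SymL n u → NonConstant n u → 3 ≤ n
3≤n n {u} s (a , b , a<n , b<n , ne) = ≰⇒> λ n≤2 → ne (trans (const n≤2 a a<n) (sym (const n≤2 b b<n)))
  where
  const : n ≤ 2 → ∀ a → a < n → u a ≡ u 0
  const n≤2 zero          _   = refl
  const n≤2 (suc zero)    a<n = s 1 0 (≤-antisym a<n n≤2)
  const n≤2 (suc (suc a)) a<n = contradiction (≤-trans a<n n≤2) λ { (s≤s (s≤s ())) }

-- i + j < n says that the centre of (i , j) lies in the left half.
realise-sorted : ∀ n i₂ j₂ i₃ j₃ (u : ℕ → Bool) → i₂ ≤ i₃ → i₂ ≤ j₂ → i₃ ≤ j₃ → i₂ + j₂ < n → i₃ + j₃ < n →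
  SymL n u → Sym (i₂ , j₂) u → Sym (i₃ , j₃) u → NonConstant n u →
  Realisation n λ v → SymL n v × Sym (i₂ , j₂) v × Sym (i₃ , j₃) v
realise-sorted n i₂ j₂ i₃ j₃ u i₂≤i₃ i₂≤j₂ i₃≤j₃ b₂ b₃ sn s₂ s₃ nc = cases i₂ refl
  where
  Goal : Set
  Goal = Realisation n λ v → SymL n v × Sym (i₂ , j₂) v × Sym (i₃ , j₃) v
  3≤ : 3 ≤ n
  3≤ = 3≤n n sn nc
  whole⇒Sym : ∀ {j} {v : ℕ → Bool} → suc j ≡ n → SymL n v → Sym (0 , j) v
  whole⇒Sym {j} {v} refl s = SymL⇒Sym (suc j) s
  -- The word 10...01: an interval in the left half that misses position 0 sees only zeros.
  ends : Realisation n λ v → SymL n v × SymL 1 v × (∀ i k → 1 ≤ i → i + k < n → Sym (i , k) v)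
  ends = avoid false 0 (n ∸ 2) n 1 (∸-monoˡ-≤ 2 3≤) refl (combine (n ∷ (n ∸ 2) ∷ [])
    ((# 0 ≈ κ 2 :+ # 1 by sym (m+[n∸m]≡n (≤-trans (n≤1+n 2) 3≤))) ∷ []) (# 0) (1+ (# 1 :+ κ 1)))
  touching : i₂ ≡ 0 → Goal
  touching refl with suc j₂ ≟ n | i₃ ≟ 0 | suc j₃ ≟ n
  ... | yes w₂ | yes refl | yes w₃ = Realisation-map
    (λ v (s , _ , _) → s , whole⇒Sym w₂ s , whole⇒Sym w₃ s) ends
  ... | yes w₂ | yes refl | no w₃  with m≤n⇒∃[o]m+o≡n b₃
  ... | p , e = Realisation-map (λ v (s , _ , t) → s , whole⇒Sym w₂ s , t)
    (window n 0 p (suc j₃) j₃ u (n≢0⇒n>0 λ { refl → w₃ (trans (sym (+-identityʳ _)) e) })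
      (trans (+-comm p _) e) z≤n z≤n b₃ sn (Sym⇒SymL (suc j₃) s₃) s₃ nc)
  touching refl | yes w₂ | no i₃≢0 | _ = Realisation-map
    (λ v (s , _ , a) → s , whole⇒Sym w₂ s , a i₃ j₃ (n≢0⇒n>0 i₃≢0) b₃) ends
  -- Together with the whole, [0 , j₂] gives the period p = n - j₂ - 1. The window [i₃ , n - i₃) has
  -- length at least p exactly if 2 i₃ ≤ j₂ + 1. Otherwise the third interval starts to the right of
  -- the centre of [0 , j₂] and is avoided by putting 1 or 11 at that centre, depending on the
  -- parity of j₂.
  touching refl | no w₂ | _ | _ with m≤n⇒∃[o]m+o≡n b₂ | 2 * i₃ ≤? suc j₂ | parity j₂
  ... | p , e | yes le | _ = Realisation-map (λ v (s , t , a) → s , SymL⇒Sym (suc j₂) t , a)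
    (window n i₃ p (suc j₂) j₃ u (n≢0⇒n>0 λ { refl → w₂ (trans (sym (+-identityʳ _)) e) })
      (trans (+-comm p _) e) le i₃≤j₃ b₃ sn (Sym⇒SymL (suc j₂) s₂) s₃ nc)
  ... | p , e | no gt | h , inj₁ refl = Realisation-map
    (λ v (s , t , a) → s , SymL⇒Sym (suc j₂) t , a i₃ j₃ h<i₃ b₃)
    (avoid false h (p ∸ 1) n (suc j₂) (∸-monoˡ-≤ 1 2≤p) (+-comm 1 (2 * h)) (combine (n ∷ h ∷ (p ∸ 1) ∷ p ∷ [])
      ((# 0 ≈ 1+ (κ 2 :* # 1) :+ # 3 by sym e)
       ∷ (# 3 ≈ 1+ # 2 by sym (m+[n∸m]≡n (≤-trans (n≤1+n 1) 2≤p))) ∷ [])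
      (# 0) (κ 2 :* # 1 :+ κ 1 :+ (# 2 :+ κ 1))))
    where
    h<i₃ : h + 1 ≤ i₃
    h<i₃ = farkas′ 2 (h ∷ i₃ ∷ [])
      ((1+ (1+ (κ 2 :* # 0)) ≼ κ 2 :* # 1 by ≰⇒> gt) ∷ []) (# 0 :+ κ 1) (# 1)
    2≤p : 2 ≤ p
    2≤p = farkas (p ∷ h ∷ i₃ ∷ j₃ ∷ n ∷ [])
      (2 · (# 1 :+ κ 1 ≼ # 2 by h<i₃) ∷ (# 2 ≼ # 3 by i₃≤j₃) ∷ (1+ (# 2 :+ # 3) ≼ # 4 by b₃)
       ∷ (# 4 ≃ 1+ (κ 2 :* # 1) :+ # 0 by sym e) ∷ []) (κ 2) (# 0)
  ... | p , e | no gt | h , inj₂ refl = Realisation-map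
    (λ v (s , t , a) → s , SymL⇒Sym (suc j₂) t , a i₃ j₃ h<i₃ b₃)
    (avoid true h (p ∸ 2) n (suc j₂) (∸-monoˡ-≤ 2 3≤p) (+-comm 2 (2 * h)) (combine (n ∷ h ∷ (p ∸ 2) ∷ p ∷ [])
      ((# 0 ≈ 1+ (1+ (κ 2 :* # 1)) :+ # 3 by sym e)
       ∷ (# 3 ≈ κ 2 :+ # 2 by sym (m+[n∸m]≡n (≤-trans (n≤1+n 2) 3≤p))) ∷ [])
      (# 0) (κ 2 :* # 1 :+ κ 2 :+ (# 2 :+ κ 2))))
    where
    h+1<i₃ : h + 1 < i₃
    h+1<i₃ = farkas′ 2 (h ∷ i₃ ∷ [])
      ((1+ (1+ (1+ (κ 2 :* # 0))) ≼ κ 2 :* # 1 by ≰⇒> gt) ∷ []) (1+ (# 0 :+ κ 1)) (# 1)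
    h<i₃ : h + 2 ≤ i₃
    h<i₃ = farkas (h ∷ i₃ ∷ [])
      ((1+ (# 0 :+ κ 1) ≼ # 1 by h+1<i₃) ∷ []) (# 0 :+ κ 2) (# 1)
    3≤p : 3 ≤ p
    3≤p = farkas (p ∷ h ∷ i₃ ∷ j₃ ∷ n ∷ [])
      (2 · (# 1 :+ κ 2 ≼ # 2 by h<i₃) ∷ (# 2 ≼ # 3 by i₃≤j₃) ∷ (1+ (# 2 :+ # 3) ≼ # 4 by b₃)
       ∷ (# 4 ≃ 1+ (1+ (κ 2 :* # 1)) :+ # 0 by sym e) ∷ []) (κ 3) (# 0)
  cases : ∀ i → i₂ ≡ i → Goal
  cases zero    e = touching e
  cases (suc i) e = Realisation-map (λ v (s , _ , a) → s , a i₂ j₂ 1≤i₂ b₂ , a i₃ j₃ (≤-trans 1≤i₂ i₂≤i₃) b₃)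
    ends
    where
    1≤i₂ : 1 ≤ i₂
    1≤i₂ = subst (1 ≤_) (sym e) (s≤s z≤n)

-- When the whole word is symmetric, an interval and its mirror image impose the same condition, so
-- every centre may be assumed to lie in the left half.
record LeftHalf (n : ℕ) (I : ℕ × ℕ) : Set₁ where
  field
    i j    : ℕ
    i≤j    : i ≤ j
    left   : i + j < n
    to     : ∀ (v : ℕ → Bool) → SymL n v → Sym I v → Sym (i , j) v
    from   : ∀ (v : ℕ → Bool) → SymL n v → Sym (i , j) v → Sym I v

leftHalf : ∀ n I → Valid n I → LeftHalf n I
leftHalf n (i , j) (i≤j , j<n) with i + j <? n
... | yes h = record { i = i ; j = j ; i≤j = i≤j ; left = h ; to = λ _ _ s → s ; from = λ _ _ s → s }
... | no h  = record { i = n ∸ suc j ; j = n ∸ suc i ; i≤j = proj₁ valid ; left =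
  farkas ((n ∸ suc j) ∷ (n ∸ suc i) ∷ n ∷ i ∷ j ∷ [])
  ((# 2 ≼ # 3 :+ # 4 by ≮⇒≥ h) ∷ (1+ # 4 :+ # 0 ≃ # 2 by m+[n∸m]≡n j<n)
   ∷ (1+ # 3 :+ # 1 ≃ # 2 by m+[n∸m]≡n i<n) ∷ []) (1+ (# 0 :+ # 1)) (# 2)
  ; to   = λ v s t → Sym-cong (proj₂ valid) (λ k k<n → s (n ∸ suc k) k (flip k k<n))
    (mirrorInterval-sym n (i≤j , j<n) t)
  ; from = λ v s t → Sym-cong j<n (λ k k<n → s (n ∸ suc k) k (flip k k<n))
      (subst (λ I → Sym I (λ k → v (n ∸ suc k))) (cong₂ _,_ (mirror² i<n) (mirror² j<n))
        (mirrorInterval-sym n valid t)) }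
  where
  i<n : i < n
  i<n = ≤-<-trans i≤j j<n
  valid : Valid n (n ∸ suc j , n ∸ suc i)
  valid = mirrorInterval-valid n (i≤j , j<n)
  flip : ∀ k → k < n → suc (n ∸ suc k + k) ≡ n
  flip k k<n = trans (cong suc (+-comm (n ∸ suc k) k)) (m+[n∸m]≡n k<n)

realise-whole : ∀ n I J (u : ℕ → Bool) → Valid n I → Valid n J → SymL n u → Sym I u → Sym J u →
  NonConstant n u →
  Realisation n λ v → SymL n v × Sym I v × Sym J v
realise-whole n I J u vI vJ sn sI sJ nc = sorted (≤-total I′.i J′.i)
  where
  module I′ = LeftHalf (leftHalf n I vI)
  module J′ = LeftHalf (leftHalf n J vJ)
  sorted : I′.i ≤ J′.i ⊎ J′.i ≤ I′.i → Realisation n λ v → SymL n v × Sym I v × Sym J v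
  sorted (inj₁ le) = Realisation-map (λ v (s , a , b) → s , I′.from v s a , J′.from v s b)
    (realise-sorted n _ _ _ _ u le I′.i≤j J′.i≤j I′.left J′.left sn (I′.to u sn sI) (J′.to u sn sJ) nc)
  sorted (inj₂ le) = Realisation-map (λ v (s , b , a) → s , I′.from v s a , J′.from v s b)
    (realise-sorted n _ _ _ _ u le J′.i≤j I′.i≤j J′.left I′.left sn (J′.to u sn sJ) (I′.to u sn sI) nc)

applyUpTo-prefix : ∀ {B : Set} (v : ℕ → B) n x → applyUpTo v n ⊑ applyUpTo v (n + x)
applyUpTo-prefix v n x = [] , go v n
  where
  go : ∀ v n → ∃ λ y → applyUpTo v (n + x) ≡ applyUpTo v n ++ y
  go v zero    = applyUpTo v x , refl
  go v (suc n) with go (v ∘ suc) n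
  ... | y , e = y , cong (v 0 ∷_) e

-- If a palindrome (i , n - 1) reaches the right end, reflecting it makes it the whole of [0, i + n).
realise-touching : ∀ n i I J (u : ℕ → Bool) → i < n → Valid n I → Valid n J → Sym (i , pred n) u → Sym I u →
  Sym J u → NonConstant n u →
  Realisation n λ v → Sym (i , pred n) v × Sym I v × Sym J v
realise-touching n i I J u i<n vI vJ s sI sJ (a , b , a<n , b<n , ne) = restrict
  (realise-whole (n + i) I J u₁ (widen vI) (widen vJ) whole (Sym-cong (proj₂ vI) (λ k h → sym (below k h)) sI)
    (Sym-cong (proj₂ vJ) (λ k h → sym (below k h)) sJ)
    (a , b , ≤-trans a<n (m≤m+n n i) , ≤-trans b<n (m≤m+n n i) , λ e →
      ne (trans (sym (below a a<n)) (trans e (below b b<n)))))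
  where
  suc-pred-n : suc (pred n) ≡ n
  suc-pred-n = m+[n∸m]≡n (≤-trans (s≤s z≤n) i<n)
  u₁ : ℕ → Bool
  u₁ k with k <? n
  ... | yes _ = u k
  ... | no _  = u (n + i ∸ suc k)
  below : ∀ k → k < n → u₁ k ≡ u k
  below k k<n with k <? n
  ... | yes _  = refl
  ... | no k≮n = contradiction k<n k≮n
  whole : SymL (n + i) u₁
  whole k l e with k <? n | l <? n
  ... | yes k<n | yes l<n = s k l
    (farkas (i ∷ k ∷ n ∷ l ∷ [])
      ((# 2 :+ # 0 ≃ 1+ (# 1 :+ # 3) by sym e) ∷ (1+ # 3 ≼ # 2 by l<n) ∷ []) (# 0) (# 1))
        (farkas (i ∷ l ∷ n ∷ k ∷ [])
        ((# 2 :+ # 0 ≃ 1+ (# 3 :+ # 1) by sym e) ∷ (1+ # 3 ≼ # 2 by k<n) ∷ []) (# 0) (# 1))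
          (combine (k ∷ l ∷ i ∷ pred n ∷ n ∷ [])
          ((1+ (# 0 :+ # 1) ≈ # 4 :+ # 2 by e) ∷ (# 4 ≈ 1+ # 3 by sym suc-pred-n) ∷ [])
          (# 0 :+ # 1) (# 2 :+ # 3))
  ... | yes k<n | no l≮n  = cong u (trans (sym (m+n∸n≡m k (suc l))) (cong (_∸ suc l) (trans (+-suc k l) e)))
  ... | no k≮n  | yes l<n = cong u (trans (cong (_∸ suc k) (sym e)) (m+n∸m≡n (suc k) l))
  ... | no k≮n  | no l≮n  = ⊥-elim (contra (k ∷ l ∷ n ∷ i ∷ [])
    ((1+ (# 0 :+ # 1) ≃ # 2 :+ # 3 by e) ∷ (# 2 ≼ # 0 by ≮⇒≥ k≮n) ∷ (# 2 ≼ # 1 by ≮⇒≥ l≮n)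
     ∷ (1+ # 3 ≼ # 2 by i<n) ∷ []))
  widen : ∀ {I} → Valid n I → Valid (n + i) I
  widen (i≤j , j<n) = i≤j , ≤-trans j<n (m≤m+n n i)
  restrict : Realisation (n + i) (λ v → SymL (n + i) v × Sym I v × Sym J v) → Realisation n λ v →
    Sym (i , pred n) v × Sym I v × Sym J v
  restrict (v , (sv , tI , tJ) , (a , b , a< , b< , ne) , cen) = v ,
    ((λ k l _ _ e → sv k l (combine (k ∷ l ∷ n ∷ i ∷ pred n ∷ [])
      ((# 0 :+ # 1 ≈ # 3 :+ # 4 by e) ∷ (1+ # 4 ≈ # 2 by suc-pred-n) ∷ [])
      (1+ (# 0 :+ # 1)) (# 2 :+ # 3))) , tI , tJ) ,
    differ (into a a<) (into b b<) , proj₁ cen , proj₁ (proj₂ cen) ,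
      ⊑-trans (applyUpTo-prefix v n i) (proj₂ (proj₂ cen))
    where
    -- Positions from n on are mirrored to positions below i, so both letters of v already occur in
    -- [0 , n).
    into : ∀ a → a < n + i → ∃ λ a′ → a′ < n × v a′ ≡ v a
    into a a< with a <? n | m≤n⇒∃[o]m+o≡n a<
    ... | yes a<n | _     = a , a<n , refl
    ... | no a≮n | l , e = l , (farkas (l ∷ n ∷ a ∷ i ∷ [])
      ((1+ # 2 :+ # 0 ≃ # 1 :+ # 3 by e) ∷ (# 1 ≼ # 2 by ≮⇒≥ a≮n) ∷ (1+ # 3 ≼ # 1 by i<n) ∷ [])
      (1+ # 0) (# 1)) , sym (sv a l e)
    differ : (∃ λ a′ → a′ < n × v a′ ≡ v a) → (∃ λ b′ → b′ < n × v b′ ≡ v b) → NonConstant n v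
    differ (a′ , a′< , ea) (b′ , b′< , eb) = a′ , b′ , a′< , b′< , λ e → ne (trans (sym ea) (trans e eb))

-- The word 0...01 satisfies all palindromes that do not reach the last position.
realise-lastLetter : ∀ n → 2 ≤ n → Realisation n λ v → ∀ i j → suc j < n → Sym (i , j) v
realise-lastLetter (suc zero) (s≤s ())
realise-lastLetter (suc (suc f)) _ = Q , symmetric ,
  (0 , suc f , z<s , ≤-refl , λ e → case trans (sym (zero-at 0 z<s))
    (trans e (trans (cong Q (sym (+-identityʳ (suc f)))) (Q-true 0))) of λ ()) ,
  Q-central 0 (suc (suc f))
  where
  open Residue false (suc f) (s≤s z≤n) using (Q; Q-true; Q-false; Q-central; n≡f)
  zero-at : ∀ k → k < suc f → Q k ≡ false
  zero-at k h = trans (cong Q (sym (+-identityʳ k))) (Q-false k 0 h)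
  symmetric : ∀ i j → suc j < suc (suc f) → Sym (i , j) Q
  symmetric i j (s≤s j<) k l i≤k i≤l e = trans
    (zero-at k (farkas (k ∷ f ∷ j ∷ l ∷ i ∷ [])
      ((1+ # 2 ≼ 1+ # 1 by j<) ∷ (# 0 :+ # 3 ≃ # 4 :+ # 2 by e) ∷ (# 4 ≼ # 3 by i≤l) ∷ [])
      (1+ # 0) (1+ # 1)))
    (sym (zero-at l (farkas (l ∷ f ∷ j ∷ k ∷ i ∷ [])
      ((1+ # 2 ≼ 1+ # 1 by j<) ∷ (# 3 :+ # 0 ≃ # 4 :+ # 2 by e) ∷ (# 4 ≼ # 3 by i≤k) ∷ [])
      (1+ # 0) (1+ # 1))))

-- Only statements about all intervals of a list are ever transferred, so this suffices for moving
-- one interval to the front.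
SameConstraints : List (ℕ × ℕ) → List (ℕ × ℕ) → Set₁
SameConstraints S R = (∀ (P : ℕ × ℕ → Set) → All P S → All P R) × (∀ (P : ℕ × ℕ → Set) → All P R → All P S)

touchingFirst : ∀ n (S : List (ℕ × ℕ)) → All (λ I → suc (proj₂ I) ≢ n) S ⊎
  ∃₂ λ i j → suc j ≡ n × ∃ λ R → suc (length R) ≡ length S × SameConstraints S ((i , j) ∷ R)
touchingFirst n []            = inj₁ []
touchingFirst n ((i , j) ∷ S) with suc j ≟ n | touchingFirst n S
... | yes e | _      = inj₂ (i , j , e , S , refl , (λ P p → p) , λ P p → p)
... | no ne | inj₁ h = inj₁ (ne ∷ h)
... | no _  | inj₂ (i′ , j′ , e , R , len , to , from) = inj₂ (i′ , j′ , e , (i , j) ∷ R , cong suc len ,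
  (λ { P (p ∷ ps) → case to P ps of λ { (q ∷ qs) → q ∷ p ∷ qs } }) , λ { P (q ∷ p ∷ qs) → p ∷ from P (q ∷ qs) })

two-of : ∀ n → 1 ≤ n → (R : List (ℕ × ℕ)) → length R ≤ 2 → All (Valid n) R → ∃₂ λ I J → Valid n I × Valid n J ×
  (∀ (u : ℕ → Bool) → All (λ I → Sym I u) R → Sym I u × Sym J u) ×
    (∀ (u : ℕ → Bool) → Sym I u → Sym J u → All (λ I → Sym I u) R)
two-of n 1≤n []              _ []          = (0 , 0) , (0 , 0) , (z≤n , 1≤n) , (z≤n , 1≤n) ,
  (λ u _ → zeroSym u , zeroSym u) , λ _ _ _ → []
two-of n 1≤n (I ∷ [])        _ (v ∷ [])    = I , (0 , 0) , v , (z≤n , 1≤n) ,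
  (λ { u (s ∷ []) → s , zeroSym u }) , λ _ s _ → s ∷ []
two-of n 1≤n (I ∷ J ∷ [])    _ (v ∷ w ∷ []) = I , J , v , w ,
  (λ { u (s ∷ t ∷ []) → s , t }) , λ _ s t → s ∷ t ∷ []
two-of n 1≤n (_ ∷ _ ∷ _ ∷ _) (s≤s (s≤s ()))

realise : ∀ n S (u : ℕ → Bool) → length S ≤ 3 → All (Valid n) S → All (λ I → Sym I u) S → NonConstant n u →
  Realisation n λ v → All (λ I → Sym I v) S
realise n S u len valid syms nc@(a , b , a<n , b<n , ne) = cases (touchingFirst n S)
  where
  1≤n : 1 ≤ n
  1≤n = ≤-trans (s≤s z≤n) a<n
  2≤n : ∀ m → m ≡ n → 2 ≤ n
  2≤n zero          refl = contradiction a<n λ ()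
  2≤n (suc zero)    refl = contradiction (cong u (trans (n<1⇒n≡0 a<n) (sym (n<1⇒n≡0 b<n)))) ne
  2≤n (suc (suc m)) refl = s≤s (s≤s z≤n)
  cases : (All (λ I → suc (proj₂ I) ≢ n) S ⊎ ∃₂ λ i j → suc j ≡ n × ∃ λ R → suc (length R) ≡ length S ×
    SameConstraints S ((i , j) ∷ R)) →
    Realisation n λ v → All (λ I → Sym I v) S
  cases (inj₁ none) = Realisation-map (λ v h → all h valid none) (realise-lastLetter n (2≤n n refl))
    where
    all : ∀ {v S} → (∀ i j → suc j < n → Sym (i , j) v) → All (Valid n) S → All (λ I → suc (proj₂ I) ≢ n) S →
      All (λ I → Sym I v) S
    all h []              []         = []
    all h ((_ , j<n) ∷ vs) (x ∷ xs) = h _ _ (≤∧≢⇒< j<n x) ∷ all h vs xs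
  cases (inj₂ (i , j , refl , R , lenR , to , from)) =
    go (two-of n 1≤n R (≤-pred (subst (_≤ 3) (sym lenR) len)) (All.tail (to _ valid)))
    where
    go : (∃₂ λ I J → Valid n I × Valid n J × (∀ (u : ℕ → Bool) → All (λ I → Sym I u) R → Sym I u × Sym J u) ×
      (∀ (u : ℕ → Bool) → Sym I u → Sym J u → All (λ I → Sym I u) R)) →
      Realisation n λ v → All (λ I → Sym I v) S
    go (I , J , vI , vJ , split , join) = Realisation-map (λ v (s , sI , sJ) → from _ (s ∷ join v sI sJ))
      (realise-touching n i I J u (s≤s (proj₁ (All.head (to _ valid)))) vI vJ (All.head (to _ syms))
        (proj₁ rest) (proj₂ rest) nc)
      where
      rest : Sym I u × Sym J u
      rest = split u (All.tail (to _ syms))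

constant? : ∀ n (v : ℕ → Bool) → (∀ k → k < n → v k ≡ v 0) ⊎ NonConstant n v
constant? zero    v = inj₁ λ k ()
constant? (suc n) v with constant? n v | v n ≟ᵇ v 0
... | inj₂ (a , b , a<n , b<n , ne) | _     = inj₂ (a , b , m<n⇒m<1+n a<n , m<n⇒m<1+n b<n , ne)
... | inj₁ h | no ne = inj₂ (n , 0 , ≤-refl , z<s , ne)
... | inj₁ h | yes e = inj₁ λ k k<sn → case m≤n⇒m<n∨m≡n
  (≤-pred k<sn) of λ { (inj₁ k<n) → h k k<n ; (inj₂ refl) → e }

-- Exchange of letters, constant words and the return to u

map-not-τ : ∀ a w → map not (τ a w) ≡ τ (not a) (map not w)
map-not-τ a []      = refl
map-not-τ a (c ∷ w) = trans (map-++ not (block a c) (τ a w)) (cong₂ _++_ (blocks a c) (map-not-τ a w))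
  where
  blocks : ∀ a c → map not (block a c) ≡ block (not a) (not c)
  blocks false false = refl
  blocks false true  = refl
  blocks true  false = refl
  blocks true  true  = refl

map-not-W : ∀ D → map not (W D) ≡ W (map not D)
map-not-W []      = refl
map-not-W (a ∷ D) = cong (not a ∷_) (trans (map-not-τ a (W D)) (cong (τ (not a)) (map-not-W D)))

map-not-double : ∀ A w → map not (double A w) ≡ double (A ∘ not) (map not w)
map-not-double A []      = refl
map-not-double A (c ∷ w) = trans (map-++ not (doubled A c) (double A w))
  (cong₂ _++_ letter (map-not-double A w))
  where
  letter : map not (doubled A c) ≡ doubled (A ∘ not) (not c)
  letter rewrite not-involutive c with A c
  ... | true  = refl
  ... | false = refl

Central-map-not : ∀ {u} → Central u → Central (map not u)
Central-map-not {u} (A , D , h) = A ∘ not , map not D ,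
  subst (map not u ⊑_) (trans (map-not-double A (W D)) (cong (double (A ∘ not)) (map-not-W D))) (⊑-map not h)

Central-replicate : ∀ n c → Central (replicate n c)
Central-replicate n c = undoubled , replicate n c ,
  subst (replicate n c ⊑_) (sym (trans (double-none (W (replicate n c))) (word n))) (⊑-refl (replicate n c))
  where
  blocks : ∀ c → block c c ≡ c ∷ []
  blocks false = refl
  blocks true  = refl
  fixed : ∀ n → τ c (replicate n c) ≡ replicate n c
  fixed zero    = refl
  fixed (suc n) = cong₂ _++_ (blocks c) (fixed n)
  word : ∀ n → W (replicate n c) ≡ replicate n c
  word zero    = refl
  word (suc n) = cong (c ∷_) (trans (cong (τ c) (word n)) (fixed n))

applyUpTo-replicate : ∀ {B : Set} n (c : B) → applyUpTo (λ _ → c) n ≡ replicate n c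
applyUpTo-replicate zero    c = refl
applyUpTo-replicate (suc n) c = cong (c ∷_) (applyUpTo-replicate n c)

injective-Bool : ∀ (c : Bool → Bool) → c false ≢ c true → (∀ x → x ≡ c x) ⊎ (∀ x → x ≡ not (c x))
injective-Bool c ne with c false in e₀ | c true in e₁
... | false | false = contradiction refl ne
... | false | true  = inj₁ λ { false → sym e₀ ; true → sym e₁ }
... | true  | false = inj₂ λ { false → sym (cong not e₀) ; true → sym (cong not e₁) }
... | true  | true  = contradiction refl ne

MuLe⇒Central : ∀ u → MuLe u 3 → Central u
MuLe⇒Central u h = main (MuLe⇒Mu≤3 u h)
  where
  n : ℕ
  n = length u
  û : ℕ → Bool
  û = nth false u
  u-eq : applyUpTo û n ≡ u
  u-eq = trans (applyUpTo-nth false n u ≤-refl) (take-all n u ≤-refl)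
  main : Mu≤3 n û → Central u
  main (S , len , valid , syms , gen) = cases (constant? n û)
    where
    generated : (Realisation n λ v → All (λ I → Sym I v) S) → Central u
    generated (v , sv , (a , b , a<n , b<n , ne) , cen) = finish (gen Bool v sv)
      where
      finish : (Σ (Bool → Bool) λ c → ∀ k → k < n → v k ≡ c (û k)) → Central u
      finish (c , eq) = recover (injective-Bool c λ e →
        ne (trans (eq a a<n) (trans (merge e (û a) (û b)) (sym (eq b b<n)))))
        where
        merge : c false ≡ c true → ∀ x y → c x ≡ c y
        merge e false false = refl
        merge e false true  = e
        merge e true  false = sym e
        merge e true  true  = refl
        recover : (∀ x → x ≡ c x) ⊎ (∀ x → x ≡ not (c x)) → Central u
        recover (inj₁ id-c)  = subst Central (trans
          (applyUpTo-cong n λ k k<n → trans (eq k k<n) (sym (id-c (û k)))) u-eq) cen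
        recover (inj₂ not-c) = subst Central
          (trans (map-applyUpTo v not n) (trans
            (applyUpTo-cong n λ k k<n → trans (cong not (eq k k<n)) (sym (not-c (û k)))) u-eq))
          (Central-map-not cen)
    cases : (∀ k → k < n → û k ≡ û 0) ⊎ NonConstant n û → Central u
    cases (inj₁ const) = subst Central
      (trans (sym (applyUpTo-replicate n (û 0))) (trans (applyUpTo-cong n λ k k<n → sym (const k k<n)) u-eq))
      (Central-replicate n (û 0))
    cases (inj₂ nc)    = generated (realise n S û len valid syms nc)

-- Right special factors

-- Recursion on the word, instead of an equation with `factorAt`, lets occurrences be split, joined
-- and shifted letter by letter.
At : (ℕ → Bool) → ℕ → List Bool → Set
At x k []      = ⊤
At x k (c ∷ w) = x k ≡ c × At x (suc k) w

Fac : (ℕ → Bool) → List Bool → Set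
Fac x w = ∃ λ k → At x k w

At-++⁻ : ∀ {x k} u {v} → At x k (u ++ v) → At x k u × At x (k + length u) v
At-++⁻ {x} {k} []      {v} h       = tt , subst (λ m → At x m v) (sym (+-identityʳ k)) h
At-++⁻ {x} {k} (c ∷ u) {v} (e , h) = (e , proj₁ (At-++⁻ u h)) ,
  subst (λ m → At x m v) (sym (+-suc k (length u))) (proj₂ (At-++⁻ u h))

At-++⁺ : ∀ {x k} u {v} → At x k u → At x (k + length u) v → At x k (u ++ v)
At-++⁺ {x} {k} []      {v} _       q = subst (λ m → At x m v) (+-identityʳ k) q
At-++⁺ {x} {k} (c ∷ u) {v} (e , p) q = e , At-++⁺ u p (subst (λ m → At x m v) (+-suc k (length u)) q)

At-unique : ∀ {x k} u v → length u ≡ length v → At x k u → At x k v → u ≡ v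
At-unique []      []      _  _       _       = refl
At-unique (c ∷ u) (d ∷ v) eq (e , p) (f , q) =
  cong₂ _∷_ (trans (sym e) f) (At-unique u v (suc-injective eq) p q)

At-shift : ∀ {x y k l} w → (∀ n → x (k + n) ≡ y (l + n)) → At y l w → At x k w
At-shift             []      h _       = tt
At-shift {x} {y} {k} {l} (c ∷ w) h (e , p) = trans
  (subst₂ (λ i j → x i ≡ y j) (+-identityʳ k) (+-identityʳ l) (h 0)) e ,
  At-shift w (λ n → subst₂ (λ i j → x i ≡ y j) (+-suc k n) (+-suc l n) (h (suc n))) p

segment : (ℕ → Bool) → ℕ → ℕ → List Bool
segment x k zero    = []
segment x k (suc m) = x k ∷ segment x (suc k) m

At-segment : ∀ x k m → At x k (segment x k m)
At-segment x k zero    = tt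
At-segment x k (suc m) = refl , At-segment x (suc k) m

length-segment : ∀ x k m → length (segment x k m) ≡ m
length-segment x k zero    = refl
length-segment x k (suc m) = cong suc (length-segment x (suc k) m)

At-factorAt : ∀ x k m → At x k (factorAt x k m)
At-factorAt x k m = subst (At x k) (sym (map-upTo (λ i → x (k + i)) m)) (go x k m)
  where
  go : ∀ x k m → At x k (applyUpTo (λ i → x (k + i)) m)
  go x k zero    = tt
  go x k (suc m) = cong x (sym (+-identityʳ k)) ,
    subst (At x (suc k)) (applyUpTo-cong m λ i _ → cong x (sym (+-suc k i))) (go x (suc k) m)

length-factorAt : ∀ x k m → length (factorAt x k m) ≡ m
length-factorAt x k m = trans (length-map _ (upTo m)) (length-upTo m)

At⇒factorAt : ∀ {x k} w → At x k w → factorAt x k (length w) ≡ w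
At⇒factorAt {x} {k} w h = At-unique _ w (length-factorAt x k (length w)) (At-factorAt x k (length w)) h

At-drop : ∀ {x k} d w → At x k w → d ≤ length w → At x (k + d) (drop d w)
At-drop {x} {k} d w h d≤ = subst (λ m → At x (k + m) (drop d w)) (trans (length-take d w) (m≤n⇒m⊓n≡m d≤))
  (proj₂ (At-++⁻ (take d w) (subst (At x k) (sym (take++drop≡id d w)) h)))

At-take : ∀ {x k} d w → At x k w → At x k (take d w)
At-take {x} {k} d w h = proj₁ (At-++⁻ (take d w) (subst (At x k) (sym (take++drop≡id d w)) h))

At-⊑ : ∀ {x j k} u v → At x k u → At x j v → j ≤ k → k + length u ≤ j + length v → u ⊑ v
At-⊑ {x} {j} {k} u v hu hv j≤k bound with m≤n⇒∃[o]m+o≡n j≤k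
... | d , refl = subst (_⊑ v) (sym eq) (⊑-trans (take-⊑ (length u) (drop d v)) (drop-⊑ d v))
  where
  d≤ : d + length u ≤ length v
  d≤ = farkas (d ∷ length u ∷ length v ∷ j ∷ [])
    ((# 3 :+ # 0 :+ # 1 ≼ # 3 :+ # 2 by bound) ∷ []) (# 0 :+ # 1) (# 2)
  u≤ : length u ≤ length (drop d v)
  u≤ = subst (length u ≤_) (sym (length-drop d v))
    (subst (_≤ length v ∸ d) (m+n∸m≡n d (length u)) (∸-monoˡ-≤ d d≤))
  eq : u ≡ take (length u) (drop d v)
  eq = At-unique u _ (sym (trans (length-take (length u) (drop d v)) (m≤n⇒m⊓n≡m u≤))) hu
    (At-take (length u) (drop d v) (At-drop d v hv (≤-trans (m≤m+n d _) d≤)))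

Suffix : List Bool → List Bool → Set
Suffix w v = ∃ λ y → v ≡ y ++ w

At-suffix : ∀ {x j k} w v → At x k w → At x j v → k + length w ≡ j + length v → length w ≤ length v → Suffix w v
At-suffix {x} {j} {k} w v hw hv ends w≤v with m≤n⇒∃[o]m+o≡n w≤v
... | d , e = take d v , trans (sym (take++drop≡id d v)) (cong (take d v ++_) (sym eq))
  where
  start : k ≡ j + d
  start = combine (k ∷ j ∷ d ∷ length w ∷ length v ∷ [])
    ((# 0 :+ # 3 ≈ # 1 :+ # 4 by ends) ∷ (# 4 ≈ # 3 :+ # 2 by sym e) ∷ []) (# 0) (# 1 :+ # 2)
  eq : w ≡ drop d v
  eq = At-unique w _ (sym (trans (length-drop d v) (trans (cong (_∸ d) (sym e)) (m+n∸n≡m (length w) d)))) hw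
    (subst (λ m → At x m (drop d v)) (sym start) (At-drop d v hv (subst (d ≤_) e (m≤n+m d (length w)))))

++-split : ∀ (y y′ : List Bool) {w w′} → length y ≡ length y′ → y ++ w ≡ y′ ++ w′ → w ≡ w′
++-split []      []       _ eq = eq
++-split (c ∷ y) (d ∷ y′) l eq = ++-split y y′ (suc-injective l) (∷-injectiveʳ eq)

suffix-unique : ∀ {v} w w′ → Suffix w v → Suffix w′ v → length w ≡ length w′ → w ≡ w′
suffix-unique w w′ (y , refl) (y′ , e) len = ++-split y y′ same-length e
  where
  same-length : length y ≡ length y′
  same-length = combine (length y ∷ length y′ ∷ length w ∷ length w′ ∷ [])
    ((# 0 :+ # 2 ≈ # 1 :+ # 3 by trans (sym (length-++ y)) (trans (cong length e) (length-++ y′)))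
     ∷ (# 3 ≈ # 2 by sym len) ∷ []) (# 0) (# 1)

Suffix-trans : ∀ {u v w} → Suffix u v → Suffix v w → Suffix u w
Suffix-trans {u} (y , refl) (y′ , refl) = y′ ++ y , sym (++-assoc y′ y u)

Suffix-cut : ∀ m v → m ≤ length v → ∃ λ w → length w ≡ m × Suffix w v
Suffix-cut m v m≤ = drop (length v ∸ m) v ,
  trans (length-drop (length v ∸ m) v) (m∸[m∸n]≡n m≤) , take (length v ∸ m) v ,
    sym (take++drop≡id (length v ∸ m) v)

Fac-suffix : ∀ {x w v} → Suffix w v → Fac x v → Fac x w
Fac-suffix (y , refl) (k , h) = k + length y , proj₂ (At-++⁻ y h)

Fac-prefix : ∀ {x} u v → Fac x (u ++ v) → Fac x u
Fac-prefix u v (k , h) = k , proj₁ (At-++⁻ u h)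

Fac-⊑ : ∀ {x u v} → u ⊑ v → Fac x v → Fac x u
Fac-⊑ {u = u} (y , z , refl) h = Fac-prefix u z (Fac-suffix (y , refl) h)

RightSpecial : (ℕ → Bool) → List Bool → Set
RightSpecial x w = ∀ c → Fac x (w ∷ʳ c)

RightSpecial-suffix : ∀ {x w v} → Suffix w v → RightSpecial x v → RightSpecial x w
RightSpecial-suffix {w = w} (y , refl) h c = Fac-suffix (y , ++-assoc y w [ c ]) (h c)

HasSpecial : (ℕ → Bool) → Set
HasSpecial x = ∀ m → ∃ λ w → length w ≡ m × RightSpecial x w

-- One desubstitution lowers the bound m by 1. This permits induction for words that are images of
-- each other, such as `fibonacci false` and `fibonacci true`.
UniqueSpecial : ℕ → (ℕ → Bool) → Set
UniqueSpecial m x = ∀ w w′ → RightSpecial x w → RightSpecial x w′ → length w ≡ length w′ → length w ≤ m → w ≡ w′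

-- The form in which the Sturmian property is inherited by images and preimages under τ.
Special : (ℕ → Bool) → Set
Special x = HasSpecial x × (∀ m → UniqueSpecial m x)

special-cut : ∀ {x} m v → m ≤ length v → RightSpecial x v → ∃ λ w → length w ≡ m × RightSpecial x w
special-cut m v m≤ h with Suffix-cut m v m≤
... | w , len , s = w , len , RightSpecial-suffix s h

-- One occurring right extension is chosen for each word of K. A right special word contributes
-- exactly one more, so counting factors of length m + 1 amounts to counting right special words of
-- length m.
record Extension (x : ℕ → Bool) (m : ℕ) (K : List (List Bool)) : Set where
  field
    M        : List (List Bool)
    size     : length M ≡ length K
    unique   : Unique M
    factors  : All (λ w → length w ≡ suc m × Fac x w) M
    initial  : ∀ {w c} → w ∷ʳ c ∈ M → w ∈ K
    not-both : ∀ {w} → w ∷ʳ false ∈ M → w ∷ʳ true ∉ M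
    extends  : ∀ {w} → w ∈ K → ∃ λ c → w ∷ʳ c ∈ M

module _ {x : ℕ → Bool} {m : ℕ} where

  extension : ∀ {K} → Unique K → All (λ w → length w ≡ m × Fac x w) K → Extension x m K
  extension [] [] = record
    { M = [] ; size = refl ; unique = [] ; factors = [] ; initial = λ () ; not-both = λ () ; extends = λ () }
  extension {w₀ ∷ K} (w₀∉K ∷ uK) ((len , k , h) ∷ fK) = record
    { M        = w₀ ∷ʳ c₀ ∷ E.M
    ; size     = cong suc E.size
    ; unique   = All.tabulate (λ {w} w∈M e → fresh c₀ (subst (_∈ E.M) (sym e) w∈M)) ∷ E.unique
    ; factors  = (trans (length-++ w₀) (trans (+-comm (length w₀) 1) (cong suc len)) , k ,
      At-++⁺ w₀ h (refl , tt)) ∷ E.factors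
    ; initial  = λ { (here e) → here (∷ʳ-injectiveˡ _ w₀ e) ; (there i) → there (E.initial i) }
    ; not-both = both
    ; extends  = λ { (here refl) → c₀ , here refl ; (there i) → proj₁ (E.extends i) ,
      there (proj₂ (E.extends i)) }
    }
    where
    module E = Extension (extension uK fK)
    c₀ : Bool
    c₀ = x (k + length w₀)
    fresh : ∀ c → w₀ ∷ʳ c ∉ E.M
    fresh c i = All.lookup w₀∉K (E.initial i) refl
    both : ∀ {w} → w ∷ʳ false ∈ w₀ ∷ʳ c₀ ∷ E.M → w ∷ʳ true ∉ w₀ ∷ʳ c₀ ∷ E.M
    both {w} (here e)  (here f)  = case trans (∷ʳ-injectiveʳ w w₀ e) (sym (∷ʳ-injectiveʳ w w₀ f)) of λ ()
    both {w} (here e)  (there j) = fresh true (subst (λ z → z ∷ʳ true ∈ E.M) (∷ʳ-injectiveˡ w w₀ e) j)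
    both {w} (there i) (here f)  = fresh false (subst (λ z → z ∷ʳ false ∈ E.M) (∷ʳ-injectiveˡ w w₀ f) i)
    both     (there i) (there j) = E.not-both i j

_∈?ᴸ_ : (w : List Bool) (L : List (List Bool)) → Dec (w ∈ L)
w ∈?ᴸ L = Any.any? (≡ᴸ-dec _≟ᵇ_ w) L

missing : ∀ {x m K} (E : Extension x m K) r → ∃ λ c → r ∷ʳ c ∉ Extension.M E
missing E r with (r ∷ʳ false) ∈?ᴸ Extension.M E
... | no ∉  = false , ∉
... | yes i = true , Extension.not-both E i

record Sublisting (x : ℕ → Bool) (m : ℕ) : Set where
  field
    L       : List (List Bool)
    size    : length L ≡ suc m
    unique  : Unique L
    factors : All (λ w → length w ≡ m × Fac x w) L

record Listing (x : ℕ → Bool) (m : ℕ) : Set where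
  field
    sub      : Sublisting x m
    complete : ∀ {w} → length w ≡ m → Fac x w → w ∈ Sublisting.L sub
  open Sublisting sub public

≢⇒Unique-head : ∀ {w : List Bool} {L} → w ∉ L → All (w ≢_) L
≢⇒Unique-head ∉ = All.tabulate λ i e → ∉ (subst (_∈ _) (sym e) i)

-- Existence of right special words alone yields m + 1 distinct factors; their uniqueness enters in
-- `listing`, which shows that there are no others.
sublisting : ∀ {x} → HasSpecial x → ∀ m → Sublisting x m
sublisting         E zero    = record { L = [] ∷ [] ; size = refl ; unique = [] ∷ [] ; factors =
  (refl , 0 , tt) ∷ [] }
sublisting {x = x} E (suc m) = record
  { L       = r ∷ʳ c ∷ X.M
  ; size    = cong suc (trans X.size K.size)
  ; unique  = ≢⇒Unique-head (proj₂ new) ∷ X.unique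
  ; factors = (trans (length-++ r) (trans (+-comm (length r) 1) (cong suc (proj₁ (proj₂ (E m))))) ,
    proj₂ (proj₂ (E m)) c) ∷ X.factors
  }
  where
  module K = Sublisting (sublisting E m)
  ext : Extension x m K.L
  ext = extension K.unique K.factors
  module X = Extension ext
  r : List Bool
  r = proj₁ (E m)
  new : ∃ λ c → r ∷ʳ c ∉ X.M
  new = missing ext r
  c : Bool
  c = proj₁ new

snoc-split : ∀ {m} (w : List Bool) → length w ≡ suc m → ∃₂ λ v c → w ≡ v ∷ʳ c × length v ≡ m
snoc-split w e with reverseView w
... | v ∶ _ ∶ʳ c = v , c , refl , suc-injective (trans (+-comm 1 (length v)) (trans (sym (length-++ v)) e))

listing : ∀ {x} → Special x → ∀ m → Listing x m
listing (E , U) m = record { sub = sublisting E m ; complete = complete m }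
  where
  complete : ∀ m {w} → length w ≡ m → Fac _ w → w ∈ Sublisting.L (sublisting E m)
  complete zero    {[]} _   _ = here refl
  complete (suc m) {w}  len h with snoc-split w len
  ... | v , d , refl , len-v = go (X.extends (complete m len-v (Fac-prefix v [ d ] h)))
    where
    module K = Sublisting (sublisting E m)
    ext : Extension _ m K.L
    ext = extension K.unique K.factors
    module X = Extension ext
    r : List Bool
    r = proj₁ (E m)
    new : ∃ λ c → r ∷ʳ c ∉ X.M
    new = missing ext r
    go : (∃ λ e → v ∷ʳ e ∈ X.M) → v ∷ʳ d ∈ r ∷ʳ proj₁ new ∷ X.M
    go (e , i) with bool-cases d e
    ... | inj₁ refl = there i
    ... | inj₂ refl = here (cong₂ _∷ʳ_ v≡r (d≡c (bool-cases (proj₁ new) e)))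
      where
      special : RightSpecial _ v
      special f with bool-cases f e
      ... | inj₁ refl = proj₂ (All.lookup X.factors i)
      ... | inj₂ refl = h
      v≡r : v ≡ r
      v≡r = U m v r special (proj₂ (proj₂ (E m))) (trans len-v (sym (proj₁ (proj₂ (E m))))) (≤-reflexive len-v)
      d≡c : proj₁ new ≡ e ⊎ proj₁ new ≡ not e → not e ≡ proj₁ new
      d≡c (inj₁ eq) = contradiction (subst₂ (λ z b → z ∷ʳ b ∈ X.M) v≡r (sym eq) i) (proj₂ new)
      d≡c (inj₂ eq) = sym eq

unique-⊆-length : ∀ {K L : List (List Bool)} → Unique K → (∀ {w} → w ∈ K → w ∈ L) → length K ≤ length L
unique-⊆-length []                    sub = z≤n
unique-⊆-length {w ∷ K} {L} (w∉K ∷ uK) sub with ∈-∃++ (sub (here refl))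
... | L₁ , L₂ , refl = subst (suc (length K) ≤_) (sym (length-++-sucʳ L₁ w L₂))
  (s≤s (unique-⊆-length uK shrink))
  where
  shrink : ∀ {v} → v ∈ K → v ∈ L₁ ++ L₂
  shrink i with ∈-++⁻ L₁ (sub (there i))
  ... | inj₁ j           = ∈-++⁺ˡ j
  ... | inj₂ (here refl) = contradiction refl (All.lookup w∉K i)
  ... | inj₂ (there j)   = ∈-++⁺ʳ L₁ j

-- Pigeonhole: deleting last letters maps M into the shorter list K, so two distinct words of M
-- differ in their last letter only.
collision : ∀ {m} {K M : List (List Bool)} → Unique M → All (λ w → length w ≡ suc m) M →
  (∀ {w c} → w ∷ʳ c ∈ M → w ∈ K) → length K < length M →
  ∃ λ w → ∀ c → w ∷ʳ c ∈ M
collision {M = []} _ _ _ ()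
collision {m} {K} {M = v ∷ M} (v∉M ∷ uM) (len ∷ lens) init lt with snoc-split v len
... | w , c , refl , _ with (w ∷ʳ not c) ∈?ᴸ M
... | yes i = w , λ d → [ (λ { refl → here refl }) , (λ { refl → there i }) ]′ (bool-cases d c)
... | no ∉ with ∈-∃++ (init (here refl))
... | K₁ , K₂ , refl = lift (collision uM lens init′
  (≤-pred (subst (_< suc (length M)) (length-++-sucʳ K₁ w K₂) lt)))
  where
  lift : (∃ λ w → ∀ c → w ∷ʳ c ∈ M) → ∃ λ v → ∀ d → v ∷ʳ d ∈ w ∷ʳ c ∷ M
  lift (w , h) = w , λ c → there (h c)
  init′ : ∀ {v d} → v ∷ʳ d ∈ M → v ∈ K₁ ++ K₂
  init′ {v} {d} i with ∈-++⁻ K₁ (init (there i))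
  ... | inj₁ j         = ∈-++⁺ˡ j
  ... | inj₂ (there j) = ∈-++⁺ʳ K₁ j
  ... | inj₂ (here refl) with bool-cases d c
  ... | inj₁ refl = contradiction refl (All.lookup v∉M i)
  ... | inj₂ refl = contradiction i ∉

Sturmian⇒Listing : ∀ {x} → Sturmian x → ∀ m → Listing x m
Sturmian⇒Listing S zero = record
  { sub = record { L = [] ∷ [] ; size = refl ; unique = [] ∷ [] ; factors = (refl , 0 , tt) ∷ [] } ; complete =
    λ { {[]} _ _ → here refl } }
Sturmian⇒Listing {x} S (suc m) with S (suc m) (s≤s z≤n)
... | L , size , unique , iff = record
  { sub      = record { L = L ; size = size ; unique = unique ; factors  = All.tabulate λ {w} i →
    is-factor (Equivalence.to (iff w) i) }
  ; complete = λ {w} len (k , h) → Equivalence.from (iff w)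
    (k , trans (cong (factorAt x k) (sym len)) (At⇒factorAt w h))
  }
  where
  is-factor : ∀ {w} → IsFactorLen x (suc m) w → length w ≡ suc m × Fac x w
  is-factor (k , refl) = length-factorAt x k (suc m) , k , At-factorAt x k (suc m)

Special⇒Sturmian : ∀ {x} → Special x → Sturmian x
Special⇒Sturmian {x} S m _ = L , size , unique , λ w →
  mk⇔ (λ i → to (All.lookup factors i)) λ { (k , refl) →
  complete (length-factorAt x k m) (k , At-factorAt x k m) }
  where
  open Listing (listing S m)
  to : ∀ {w} → length w ≡ m × Fac x w → IsFactorLen x m w
  to {w} (refl , k , h) = k , At⇒factorAt w h

Sturmian⇒Special : ∀ {x} → Sturmian x → Special x
Sturmian⇒Special {x} S = has , λ _ w w′ h h′ len _ → unique-special w w′ h h′ len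
  where
  ls : ∀ m → Listing x m
  ls = Sturmian⇒Listing S
  has : HasSpecial x
  has m = found (collision M.unique (All.map proj₁ M.factors) init
    (subst₂ _<_ (sym K.size) (sym M.size) ≤-refl))
    where
    module K = Listing (ls m)
    module M = Listing (ls (suc m))
    init : ∀ {w c} → w ∷ʳ c ∈ M.L → w ∈ K.L
    init {w} {c} i with All.lookup M.factors i
    ... | len , h = K.complete (suc-injective (trans (+-comm 1 (length w)) (trans (sym (length-++ w)) len)))
      (Fac-prefix w [ c ] h)
    found : (∃ λ w → ∀ c → w ∷ʳ c ∈ M.L) → ∃ λ w → length w ≡ m × RightSpecial x w
    found (w , h) = w , suc-injective (trans (+-comm 1 (length w))
      (trans (sym (length-++ w)) (proj₁ (All.lookup M.factors (h true))))) ,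
      λ c → proj₂ (All.lookup M.factors (h c))
  unique-special : ∀ w w′ → RightSpecial x w → RightSpecial x w′ → length w ≡ length w′ → w ≡ w′
  unique-special w w′ h h′ len with ≡ᴸ-dec _≟ᵇ_ w w′
  ... | yes e = e
  ... | no ne = contradiction (unique-⊆-length big inside)
    (<⇒≱ (subst₂ _<_ (sym M.size) (sym (cong (suc ∘ suc) (trans X.size K.size))) ≤-refl))
    where
    m : ℕ
    m = length w
    module K = Listing (ls m)
    module M = Listing (ls (suc m))
    ext : Extension x m K.L
    ext = extension K.unique K.factors
    module X = Extension ext
    c c′ : Bool
    c  = proj₁ (missing ext w)
    c′ = proj₁ (missing ext w′)
    -- The m + 1 chosen extensions and a further one for each of w and w′ make m + 3 factors of
    -- length m + 1, one too many.
    big : Unique (w ∷ʳ c ∷ w′ ∷ʳ c′ ∷ X.M)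
    big = ((λ e → ne (∷ʳ-injectiveˡ w w′ e)) ∷ ≢⇒Unique-head (proj₂ (missing ext w))) ∷
      ≢⇒Unique-head (proj₂ (missing ext w′)) ∷ X.unique
    inside : ∀ {v} → v ∈ w ∷ʳ c ∷ w′ ∷ʳ c′ ∷ X.M → v ∈ M.L
    inside (here refl)         = M.complete (trans (length-++ w) (+-comm m 1)) (h c)
    inside (there (here refl)) = M.complete (trans (length-++ w′)
      (trans (+-comm (length w′) 1) (cong suc (sym len)))) (h′ c′)
    inside (there (there i))   = M.complete (proj₁ (All.lookup X.factors i)) (proj₂ (All.lookup X.factors i))

Fac-suc : ∀ {x w} → Fac (x ∘ suc) w → Fac x w
Fac-suc {w = w} (k , h) = suc k , At-shift w (λ _ → refl) h

Fac-tail : ∀ {x c w} → Fac x (c ∷ w) → Fac (x ∘ suc) w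
Fac-tail {w = w} (k , _ , h) = k , At-shift w (λ _ → refl) h

HasSpecial-suc : ∀ {x} → HasSpecial x → HasSpecial (x ∘ suc)
HasSpecial-suc E m with E (suc m)
... | c ∷ w , len , h = w , suc-injective len , λ d → Fac-tail (h d)

Special-suc : ∀ {x} → Special x → Special (x ∘ suc)
Special-suc (E , U) = HasSpecial-suc E , λ m w w′ h h′ → U m w w′ (λ c → Fac-suc (h c)) (λ c → Fac-suc (h′ c))

-- The shift of x still has m + 1 factors of each length m, so none of those of x is lost.
recurrent : ∀ {x w} → Special x → Fac x w → Fac (x ∘ suc) w
recurrent {x} {w} S h with w ∈?ᴸ Sublisting.L (sublisting (HasSpecial-suc (proj₁ S)) (length w))
... | yes i = proj₂ (All.lookup (Sublisting.factors (sublisting (HasSpecial-suc (proj₁ S)) (length w))) i)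
... | no ∉  = contradiction (unique-⊆-length (≢⇒Unique-head ∉ ∷ K.unique) inside)
  (<⇒≱ (subst₂ _<_ (sym L.size) (sym (cong suc K.size)) ≤-refl))
  where
  module K = Sublisting (sublisting (HasSpecial-suc (proj₁ S)) (length w))
  module L = Listing (listing S (length w))
  inside : ∀ {v} → v ∈ w ∷ K.L → v ∈ L.L
  inside (here refl) = L.complete refl h
  inside (there i)   = L.complete (proj₁ (All.lookup K.factors i)) (Fac-suc (proj₂ (All.lookup K.factors i)))

-- Desubstitution

block-same : ∀ a → block a a ≡ a ∷ []
block-same false = refl
block-same true  = refl

block-other : ∀ a → block a (not a) ≡ not a ∷ a ∷ []
block-other false = refl
block-other true  = refl

-- x is the image of x′ under a ↦ a, not a ↦ a (not a), with pos i the start of the block of x′ i.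
record Image (a : Bool) (x x′ : ℕ → Bool) : Set where
  field
    pos      : ℕ → ℕ
    pos-zero : pos 0 ≡ 0
    head     : ∀ i → x (pos i) ≡ a
    short    : ∀ {i} → x′ i ≡ a → pos (suc i) ≡ suc (pos i)
    long     : ∀ {i} → x′ i ≡ not a → x (suc (pos i)) ≡ not a × pos (suc i) ≡ suc (suc (pos i))

τ-last : ∀ a p → ∃ λ y → a ∷ τ a p ≡ y ∷ʳ a
τ-last a []      = [] , refl
τ-last a (c ∷ p) with bool-cases c a | τ-last a p
... | inj₁ refl | y , e = a ∷ y , trans (cong (λ b → a ∷ (b ++ τ a p)) (block-same a)) (cong (a ∷_) e)
... | inj₂ refl | y , e = a ∷ not a ∷ y , trans (cong (λ b → a ∷ (b ++ τ a p)) (block-other a))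
  (cong (λ z → a ∷ not a ∷ z) e)

closed-++ : ∀ a u v → ∃ λ y → a ∷ τ a (u ++ v) ≡ y ++ (a ∷ τ a v)
closed-++ a u v with τ-last a u
... | y , e = y , trans (cong (a ∷_) (concatMap-++ (block a) u v))
  (trans (cong (_++ τ a v) e) (++-assoc y [ a ] (τ a v)))

closed-⊑ : ∀ a {u v} → u ⊑ v → (a ∷ τ a u) ⊑ (a ∷ τ a v)
closed-⊑ a {u} (x , y , refl) with closed-++ a x (u ++ y)
... | z , e = z , τ a y , trans e (cong (λ t → z ++ (a ∷ t)) (concatMap-++ (block a) u y))

length-τ-≥ : ∀ a w → length w ≤ length (τ a w)
length-τ-≥ a []      = z≤n
length-τ-≥ a (c ∷ w) = subst (suc (length w) ≤_) (sym (length-++ (block a c)))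
  (+-mono-≤ (one a c) (length-τ-≥ a w))
  where
  one : ∀ a c → 1 ≤ length (block a c)
  one false false = s≤s z≤n
  one false true  = s≤s z≤n
  one true  false = s≤s z≤n
  one true  true  = s≤s z≤n

length-τ-≤ : ∀ a w → length (τ a w) ≤ 2 * length w
length-τ-≤ a []      = z≤n
length-τ-≤ a (c ∷ w) = subst₂ _≤_ (sym (length-++ (block a c))) (sym (*-suc 2 (length w)))
  (+-mono-≤ (two a c) (length-τ-≤ a w))
  where
  two : ∀ a c → length (block a c) ≤ 2
  two false false = s≤s z≤n
  two false true  = ≤-refl
  two true  false = ≤-refl
  two true  true  = s≤s z≤n

length-τ-∷ʳ-same : ∀ a z → length (τ a (z ∷ʳ a)) ≡ length (τ a z) + 1
length-τ-∷ʳ-same a z = trans (cong length (concatMap-++ (block a) z [ a ]))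
  (trans (length-++ (τ a z)) (cong (λ b → length (τ a z) + length (b ++ [])) (block-same a)))

length-τ-∷ʳ-other : ∀ a z → length (τ a (z ∷ʳ not a)) ≡ length (τ a z) + 2
length-τ-∷ʳ-other a z = trans (cong length (concatMap-++ (block a) z [ not a ]))
  (trans (length-++ (τ a z)) (cong (λ b → length (τ a z) + length (b ++ [])) (block-other a)))

not-self : ∀ {a} → not a ≡ a → ⊥
not-self {false} ()
not-self {true}  ()

module _ {a : Bool} {x x′ : ℕ → Bool} (I : Image a x x′) where
  open Image I

  InBlock : ℕ → ℕ → Set
  InBlock k i = pos i ≡ k ⊎ (suc (pos i) ≡ k × x′ i ≡ not a)

  cover : ∀ k → ∃ (InBlock k)
  cover zero = 0 , inj₁ pos-zero
  cover (suc k) with cover k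
  ... | i , inj₂ (e , l) = suc i , inj₁ (trans (proj₂ (long l)) (cong suc e))
  ... | i , inj₁ e with bool-cases (x′ i) a
  ... | inj₁ s = suc i , inj₁ (trans (short s) (cong suc e))
  ... | inj₂ l = i , inj₂ (cong suc e , l)

  isolated : ∀ k → x k ≡ not a → x (suc k) ≡ a
  isolated k e with cover k
  ... | i , inj₁ refl       = contradiction (trans (sym e) (head i)) not-self
  ... | i , inj₂ (refl , l) = trans (cong x (sym (proj₂ (long l)))) (head (suc i))

  At-image : ∀ i z → At x′ i z → At x (pos i) (a ∷ τ a z)
  At-image i []      _       = head i , tt
  At-image i (c ∷ z) (e , h) with bool-cases c a
  ... | inj₁ refl rewrite block-same a  = head i ,
    subst (λ k → At x k (a ∷ τ a z)) (short e) (At-image (suc i) z h)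
  ... | inj₂ refl rewrite block-other a = head i , proj₁ (long e) ,
    subst (λ k → At x k (a ∷ τ a z)) (proj₂ (long e)) (At-image (suc i) z h)

  pos-image : ∀ i z → At x′ i z → pos (i + length z) ≡ pos i + length (τ a z)
  pos-image i []      _       = trans (cong pos (+-identityʳ i)) (sym (+-identityʳ (pos i)))
  pos-image i (c ∷ z) (e , h) with bool-cases c a
  ... | inj₁ refl rewrite block-same a =
    trans (cong pos (+-suc i (length z))) (trans (pos-image (suc i) z h)
      (trans (cong (_+ length (τ a z)) (short e)) (sym (+-suc (pos i) _))))
  ... | inj₂ refl rewrite block-other a =
    trans (cong pos (+-suc i (length z))) (trans (pos-image (suc i) z h)
      (trans (cong (_+ length (τ a z)) (proj₂ (long e)))
      (combine (pos i ∷ length (τ a z) ∷ []) [] (1+ (1+ # 0) :+ # 1) (# 0 :+ 1+ (1+ # 1)))))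

  Fac-image : ∀ {z} → Fac x′ z → Fac x (a ∷ τ a z)
  Fac-image {z} (i , h) = pos i , At-image i z h

  -- The last letter of `a ∷ τ a z` is the head of the block after z, and the letter behind that
  -- head equals the letter of x′ following z.
  special-image : ∀ {z} → RightSpecial x′ z → RightSpecial x (a ∷ τ a z)
  special-image {z} h c with bool-cases c a
  ... | inj₁ refl = subst (Fac x) (cong (a ∷_)
    (trans (concatMap-++ (block a) z [ a ]) (cong (λ b → τ a z ++ (b ++ [])) (block-same a)))) (Fac-image (h a))
  ... | inj₂ refl = Fac-prefix ((a ∷ τ a z) ∷ʳ not a) [ a ] (subst (Fac x)
    (cong (a ∷_) (trans (concatMap-++ (block a) z [ not a ])
      (trans (cong (λ b → τ a z ++ (b ++ [])) (block-other a)) (sym (++-assoc (τ a z) [ not a ] [ a ])))))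
    (Fac-image (h (not a))))

  -- Reading x′ backwards from two block boundaries preceded by the same m letters of x.
  record Backwards (m i j : ℕ) : Set where
    field
      z     : List Bool
      i₀ j₀ : ℕ
      end-i : i₀ + length z ≡ i
      end-j : j₀ + length z ≡ j
      at-i  : At x′ i₀ z
      at-j  : At x′ j₀ z
      z≤m   : length z ≤ m
      m≤τz  : m ≤ length (τ a z)

  private
    unread : ∀ {i j} → Backwards 0 i j
    unread {i} {j} = record { z = [] ; i₀ = i ; j₀ = j ; end-i = +-identityʳ i ; end-j = +-identityʳ j ; at-i =
      tt ; at-j = tt ; z≤m = z≤n ; m≤τz = z≤n }

    append : ∀ {m i j} c d → x′ i ≡ c → x′ j ≡ c → (B : Backwards m i j) → 1 ≤ d →
      (∀ z → length (τ a (z ∷ʳ c)) ≡ length (τ a z) + d) → Backwards (m + d) (suc i) (suc j)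
    append {m} c d ei ej B 1≤d len = record
      { z = z ∷ʳ c ; i₀ = i₀ ; j₀ = j₀
      ; end-i = combine (i₀ ∷ length (z ∷ʳ c) ∷ i ∷ length z ∷ [])
        ((# 1 ≈ # 3 :+ κ 1 by length-++ z) ∷ (# 0 :+ # 3 ≈ # 2 by end-i) ∷ []) (# 0 :+ # 1) (1+ # 2)
      ; end-j = combine (j₀ ∷ length (z ∷ʳ c) ∷ j ∷ length z ∷ [])
        ((# 1 ≈ # 3 :+ κ 1 by length-++ z) ∷ (# 0 :+ # 3 ≈ # 2 by end-j) ∷ []) (# 0 :+ # 1) (1+ # 2)
      ; at-i  = At-++⁺ z at-i (trans (cong x′ end-i) ei , tt)
      ; at-j  = At-++⁺ z at-j (trans (cong x′ end-j) ej , tt)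
      ; z≤m   = subst (_≤ m + d) (sym (length-++ z)) (+-mono-≤ z≤m 1≤d)
      ; m≤τz  = subst (m + d ≤_) (sym (len z)) (+-monoˡ-≤ d m≤τz)
      }
      where
      open Backwards B
      i = _
      j = _

  -- A short block ends in a and a long one in `not a`, so the letter before a boundary determines
  -- the block that ends there.
  backwards : ∀ m i j k l → k + m ≡ pos i → l + m ≡ pos j →
    (∀ r → r < m → x (k + r) ≡ x (l + r)) → Backwards m i j
  backwards zero    i       j       k l ei ej same = unread
  backwards (suc m) zero    j       k l ei ej same = case trans (sym (+-suc k m)) (trans ei pos-zero) of λ ()
  backwards (suc m) (suc i) zero    k l ei ej same = case trans (sym (+-suc l m)) (trans ej pos-zero) of λ ()
  backwards (suc m) (suc i) (suc j) k l ei ej same with bool-cases (x′ i) a | bool-cases (x′ j) a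
  ... | inj₁ si | inj₁ sj = subst (λ n → Backwards n (suc i) (suc j)) (+-comm m 1)
    (append a 1 si sj (backwards m i j k l (combine (k ∷ m ∷ pos i ∷ pos (suc i) ∷ [])
      ((# 0 :+ 1+ # 1 ≈ # 3 by ei) ∷ (# 3 ≈ 1+ # 2 by short si) ∷ []) (# 0 :+ # 1) (# 2))
      (combine (l ∷ m ∷ pos j ∷ pos (suc j) ∷ [])
        ((# 0 :+ 1+ # 1 ≈ # 3 by ej) ∷ (# 3 ≈ 1+ # 2 by short sj) ∷ []) (# 0 :+ # 1) (# 2)) λ r h →
          same r (m<n⇒m<1+n h)) ≤-refl (length-τ-∷ʳ-same a))
  ... | inj₁ si | inj₂ lj = contradiction
    (trans (sym (proj₁ (long lj))) (trans (cong x (combine (pos j ∷ l ∷ m ∷ pos (suc j) ∷ [])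
      ((# 3 ≈ # 1 :+ 1+ # 2 by sym ej) ∷ (1+ (1+ # 0) ≈ # 3 by sym (proj₂ (long lj))) ∷ [])
      (1+ # 0) (# 1 :+ # 2)))
      (trans (sym (same m ≤-refl)) (trans (cong x (combine (k ∷ m ∷ pos i ∷ pos (suc i) ∷ [])
        ((# 0 :+ 1+ # 1 ≈ # 3 by ei) ∷ (# 3 ≈ 1+ # 2 by short si) ∷ []) (# 0 :+ # 1) (# 2))) (head i)))))
          not-self
  ... | inj₂ li | inj₁ sj = contradiction
    (trans (sym (proj₁ (long li))) (trans (cong x (combine (pos i ∷ k ∷ m ∷ pos (suc i) ∷ [])
      ((# 3 ≈ # 1 :+ 1+ # 2 by sym ei) ∷ (1+ (1+ # 0) ≈ # 3 by sym (proj₂ (long li))) ∷ [])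
      (1+ # 0) (# 1 :+ # 2)))
      (trans (same m ≤-refl) (trans (cong x (combine (l ∷ m ∷ pos j ∷ pos (suc j) ∷ [])
        ((# 0 :+ 1+ # 1 ≈ # 3 by ej) ∷ (# 3 ≈ 1+ # 2 by short sj) ∷ []) (# 0 :+ # 1) (# 2))) (head j)))))
          not-self
  -- Only the second letter of a long block is left, but it determines the block. Since the block is
  -- taken whole, `m≤τz` is an inequality.
  backwards (suc zero) (suc i) (suc j) k l ei ej same | inj₂ li | inj₂ lj = record
    { z = B.z ; i₀ = B.i₀ ; j₀ = B.j₀ ; end-i = B.end-i ; end-j = B.end-j ; at-i = B.at-i ; at-j = B.at-j
    ; z≤m = ≤-refl ; m≤τz = ≤-trans (s≤s z≤n) B.m≤τz }
    where
    B : Backwards 2 (suc i) (suc j)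
    B = append (not a) 2 li lj unread (s≤s z≤n) (length-τ-∷ʳ-other a)
    module B = Backwards B
  backwards (suc (suc m)) (suc i) (suc j) k l ei ej same | inj₂ li | inj₂ lj =
    subst (λ n → Backwards n (suc i) (suc j)) (+-comm m 2)
    (append (not a) 2 li lj (backwards m i j k l
      (combine (k ∷ m ∷ pos i ∷ pos (suc i) ∷ [])
        ((# 0 :+ 1+ (1+ # 1) ≈ # 3 by ei) ∷ (# 3 ≈ 1+ (1+ # 2) by proj₂ (long li)) ∷ [])
        (# 0 :+ # 1) (# 2))
      (combine (l ∷ m ∷ pos j ∷ pos (suc j) ∷ [])
        ((# 0 :+ 1+ (1+ # 1) ≈ # 3 by ej) ∷ (# 3 ≈ 1+ (1+ # 2) by proj₂ (long lj)) ∷ [])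
        (# 0 :+ # 1) (# 2))
      λ r h → same r (m<n⇒m<1+n (m<n⇒m<1+n h))) (s≤s z≤n) (length-τ-∷ʳ-other a))

  private
    At-nth : ∀ {k} w → At x k w → ∀ r → r < length w → x (k + r) ≡ nth false w r
    At-nth {k} (c ∷ w) (e , h) zero    _       = trans (cong x (+-identityʳ k)) e
    At-nth {k} (c ∷ w) (e , h) (suc r) (s≤s lt) = trans (cong x (+-suc k r)) (At-nth w h r lt)

  -- A right special word ends in a, because `not a` is followed by a only. In both occurrences this
  -- a heads a block, the different next letters name different letters of x′, and reading backwards
  -- from there gives z. The bound on the length of z drives the inductions.
  desubstitute : ∀ m w → length w ≡ suc m → RightSpecial x w → ∃ λ z → length z ≤ m × RightSpecial x′ z ×
    Suffix w (a ∷ τ a z)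
  desubstitute m w len h with snoc-split w len
  ... | v , c , refl , refl with h a | h (not a)
  ... | k , hk | l , hl = build (cover (k + m)) (cover (l + m))
    where
    ck : At x k (v ∷ʳ c) × At x (k + length (v ∷ʳ c)) [ a ]
    ck = At-++⁻ (v ∷ʳ c) hk
    cl : At x l (v ∷ʳ c) × At x (l + length (v ∷ʳ c)) [ not a ]
    cl = At-++⁻ (v ∷ʳ c) hl
    len′ : length (v ∷ʳ c) ≡ suc m
    len′ = len
    xk : x (k + m) ≡ c
    xk = proj₁ (proj₂ (At-++⁻ v (proj₁ ck)))
    xl : x (l + m) ≡ c
    xl = proj₁ (proj₂ (At-++⁻ v (proj₁ cl)))
    next-k : x (suc (k + m)) ≡ a
    next-k = trans (cong x (trans (sym (+-suc k m)) (cong (k +_) (sym len′)))) (proj₁ (proj₂ ck))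
    next-l : x (suc (l + m)) ≡ not a
    next-l = trans (cong x (trans (sym (+-suc l m)) (cong (l +_) (sym len′)))) (proj₁ (proj₂ cl))
    c≡a : c ≡ a
    c≡a with bool-cases c a
    ... | inj₁ e = e
    ... | inj₂ e = contradiction (trans (sym next-l) (isolated (l + m) (trans xl e))) not-self
    build : ∃ (InBlock (k + m)) → ∃ (InBlock (l + m)) →
      ∃ λ z → length z ≤ m × RightSpecial x′ z × Suffix (v ∷ʳ c) (a ∷ τ a z)
    build (i , inj₂ (e , li)) _ = contradiction
      (trans (sym (proj₁ (long li))) (trans (cong x e) (trans xk c≡a))) not-self
    build _ (j , inj₂ (e , lj)) = contradiction
      (trans (sym (proj₁ (long lj))) (trans (cong x e) (trans xl c≡a))) not-self
    build (i , inj₁ ei) (j , inj₁ ej) = z , z≤m , special ,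
      At-suffix (v ∷ʳ c) (a ∷ τ a z) (proj₁ ck) (At-image i₀ z at-i)
      (combine (k ∷ length (v ∷ʳ c) ∷ pos i₀ ∷ length (τ a z) ∷ m ∷ pos (i₀ + length z) ∷ pos i ∷ [])
        ((# 1 ≈ 1+ # 4 by len′) ∷ (# 5 ≈ # 2 :+ # 3 by pos-image i₀ z at-i)
         ∷ (# 6 ≈ # 5 by sym (cong pos end-i)) ∷ (# 0 :+ # 4 ≈ # 6 by sym ei) ∷ [])
        (# 0 :+ # 1) (# 2 :+ 1+ # 3))
      (subst (_≤ suc (length (τ a z))) (sym len′) (s≤s m≤τz))
      where
      open Backwards (backwards m i j k l (sym ei) (sym ej) λ r r<m →
        trans (At-nth v (proj₁ (At-++⁻ v (proj₁ ck))) r r<m)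
          (sym (At-nth v (proj₁ (At-++⁻ v (proj₁ cl))) r r<m)))
      x′i : x′ i ≡ a
      x′i with bool-cases (x′ i) a
      ... | inj₁ s  = s
      ... | inj₂ li = contradiction (trans (sym (proj₁ (long li))) (trans (cong (x ∘ suc) ei) next-k)) not-self
      x′j : x′ j ≡ not a
      x′j with bool-cases (x′ j) a
      ... | inj₂ lj = lj
      ... | inj₁ s  = contradiction (trans (sym next-l)
        (trans (cong x (trans (cong suc (sym ej)) (sym (short s)))) (head (suc j)))) not-self
      special : RightSpecial x′ z
      special d with bool-cases d a
      ... | inj₁ refl = i₀ , At-++⁺ z at-i (trans (cong x′ end-i) x′i , tt)
      ... | inj₂ refl = j₀ , At-++⁺ z at-j (trans (cong x′ end-j) x′j , tt)

  -- The preimages of w and w′ may differ in length, but by uniqueness one is a suffix of the other;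
  -- hence w and w′ are suffixes of one word.
  UniqueSpecial-image : ∀ m → UniqueSpecial m x′ → UniqueSpecial (suc m) x
  UniqueSpecial-image m U []      []        h h′ len w≤ = refl
  UniqueSpecial-image m U (c ∷ w) (c′ ∷ w′) h h′ len (s≤s w≤) =
    compare (desubstitute (length w) (c ∷ w) refl h) (desubstitute (length w) (c′ ∷ w′) (sym len) h′)
    where
    Preimage : List Bool → Set
    Preimage w₀ = ∃ λ z → length z ≤ length w × RightSpecial x′ z × Suffix w₀ (a ∷ τ a z)
    longer : ∀ z z′ → length z ≤ m → RightSpecial x′ z → RightSpecial x′ z′ → length z ≤ length z′ →
      Suffix (a ∷ τ a z) (a ∷ τ a z′)
    longer z z′ z≤m hz hz′ le with Suffix-cut (length z) z′ le
    ... | s , ls , (p , refl) with U z s hz (RightSpecial-suffix (p , refl) hz′) (sym ls) z≤m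
    ... | refl = closed-++ a p z
    compare : Preimage (c ∷ w) → Preimage (c′ ∷ w′) → c ∷ w ≡ c′ ∷ w′
    compare (z , z≤ , hz , sz) (z′ , z′≤ , hz′ , sz′) with ≤-total (length z) (length z′)
    ... | inj₁ le = suffix-unique (c ∷ w) (c′ ∷ w′)
      (Suffix-trans sz (longer z z′ (≤-trans z≤ w≤) hz hz′ le)) sz′ len
    ... | inj₂ le = suffix-unique (c ∷ w) (c′ ∷ w′) sz
      (Suffix-trans sz′ (longer z′ z (≤-trans z′≤ w≤) hz′ hz le)) len

  Special-image : Special x′ → Special x
  Special-image (E , U) = has , unique
    where
    has : HasSpecial x
    has m with E m
    ... | z , refl , h = special-cut m (a ∷ τ a z) (≤-trans (length-τ-≥ a z) (n≤1+n _)) (special-image h)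
    unique : ∀ m → UniqueSpecial m x
    unique zero    w w′ h h′ len w≤ = UniqueSpecial-image zero (U zero) w w′ h h′ len (≤-trans w≤ z≤n)
    unique (suc m) = UniqueSpecial-image m (U m)

  Special-preimage : Special x → Special x′
  Special-preimage (E , U) = has , λ m w w′ h h′ len _ → unique w w′ h h′ len
    where
    has : HasSpecial x′
    -- Blocks have at most two letters, so length 2m + 1 guarantees a preimage of length at least m.
    has m with E (suc (2 * m))
    ... | w , len , h with desubstitute (2 * m) w len h
    ... | z , _ , hz , (y , e) = special-cut m z
      (farkas′ 2 (m ∷ length z ∷ length (τ a z) ∷ length y ∷ length w ∷ [])
      ((# 2 ≼ κ 2 :* # 1 by length-τ-≤ a z)
       ∷ (# 3 :+ # 4 ≃ 1+ # 2 by sym (trans (cong length e) (length-++ y)))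
       ∷ (1+ (κ 2 :* # 0) ≃ # 4 by sym len) ∷ []) (# 0) (# 1)) hz
    -- Different words of equal length have a longest common suffix y preceded by different letters.
    -- So y preceded by either letter is right special, and the images yield two right special words
    -- `a ∷ a ∷ τ a y` and `not a ∷ a ∷ τ a y` of one length.
    fork : ∀ w w′ → length w ≡ length w′ → w ≢ w′ → ∃ λ y → ∀ c → Suffix (c ∷ y) w ⊎ Suffix (c ∷ y) w′
    fork []      []        _   ne = contradiction refl ne
    fork (c ∷ w) (c′ ∷ w′) len ne with ≡ᴸ-dec _≟ᵇ_ w w′
    ... | no ne′ with fork w w′ (suc-injective len) ne′
    ... | y , s = y , λ d → [ (λ { (p , refl) → inj₁ (c ∷ p , refl) }) ,
      (λ { (p , refl) → inj₂ (c′ ∷ p , refl) }) ]′ (s d)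
    fork (c ∷ w) (c′ ∷ w′) len ne | yes refl with bool-cases c′ c
    ... | inj₁ refl = contradiction refl ne
    ... | inj₂ refl = w , λ d → [ (λ { refl → inj₁ ([] , refl) }) ,
      (λ { refl → inj₂ ([] , refl) }) ]′ (bool-cases d c)
    unique : ∀ w w′ → RightSpecial x′ w → RightSpecial x′ w′ → length w ≡ length w′ → w ≡ w′
    unique w w′ h h′ len with ≡ᴸ-dec _≟ᵇ_ w w′
    ... | yes e = e
    ... | no ne = clash (fork w w′ len ne)
      where
      clash : (∃ λ y → ∀ c → Suffix (c ∷ y) w ⊎ Suffix (c ∷ y) w′) → w ≡ w′
      clash (y , s) = contradiction (∷-injectiveˡ
        (U _ (not a ∷ a ∷ τ a y) (a ∷ a ∷ τ a y) other same refl ≤-refl)) not-self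
        where
        both : ∀ c → RightSpecial x′ (c ∷ y)
        both c = [ (λ t → RightSpecial-suffix t h) , (λ t → RightSpecial-suffix t h′) ]′ (s c)
        same : RightSpecial x (a ∷ a ∷ τ a y)
        same = subst (λ b → RightSpecial x (a ∷ (b ++ τ a y))) (block-same a) (special-image (both a))
        other : RightSpecial x (not a ∷ a ∷ τ a y)
        other = RightSpecial-suffix {w = not a ∷ a ∷ τ a y} ([ a ] , refl)
          (subst (λ b → RightSpecial x (a ∷ (b ++ τ a y))) (block-other a) (special-image (both (not a))))

-- In a special word one letter a is right special, so the other letter is isolated.
module _ {x : ℕ → Bool} (S : Special x) where

  isolated-letter : ∃ λ a → ∀ k → x k ≡ not a → x (suc k) ≡ a
  isolated-letter with proj₁ S 1
  ... | a ∷ [] , refl , h = a , next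
    where
    next : ∀ k → x k ≡ not a → x (suc k) ≡ a
    next k e with bool-cases (x (suc k)) a
    ... | inj₁ e′ = e′
    -- If `not a` stands twice in a row, uniqueness forbids that it is ever followed by a, so x is
    -- constant from k on. But a right special word of length k + 1 puts an a behind position k.
    ... | inj₂ e′ = contradiction (stuck-word (proj₁ S (suc k))) id
      where
      no-return : ∀ j → x j ≡ not a → x (suc j) ≢ a
      no-return j p q = not-self (∷-injectiveˡ (proj₂ S 1 (not a ∷ []) (a ∷ []) special h refl ≤-refl))
        where
        special : RightSpecial x (not a ∷ [])
        special c with bool-cases c a
        ... | inj₁ refl = j , p , q , tt
        ... | inj₂ refl = k , e , e′ , tt
      stuck : ∀ d → x (k + d) ≡ not a
      stuck zero    = trans (cong x (+-identityʳ k)) e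
      stuck (suc d) with bool-cases (x (k + suc d)) a
      ... | inj₂ p = p
      ... | inj₁ p = contradiction (trans (cong x (sym (+-suc k d))) p) (no-return (k + d) (stuck d))
      stuck-word : (∃ λ w → length w ≡ suc k × RightSpecial x w) → ⊥
      stuck-word (w , len , hw) with hw a
      ... | l , hl = not-self (trans (sym (stuck (suc l))) (trans (cong x (combine (k ∷ l ∷ length w ∷ [])
        ((1+ # 0 ≈ # 2 by sym len) ∷ []) (# 0 :+ 1+ # 1) (# 1 :+ # 2))) (proj₁ (proj₂ (At-++⁻ w hl)))))

-- The word is cut before every a; the letter behind the head of a block tells which block it is.
preimage : ∀ {a x} → x 0 ≡ a → (∀ k → x k ≡ not a → x (suc k) ≡ a) → ∃ λ x′ → Image a x x′
preimage {a} {x} x0 iso = (λ i → x (suc (pos i))) , record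
  { pos = pos ; pos-zero = refl ; head = head
  ; short = λ {i} → next-same (pos i) ; long = λ {i} e → e , next-other (pos i) e }
  where
  next : ∀ {b} → ℕ → Dec (b ≡ a) → ℕ
  next k (yes _) = suc k
  next k (no _)  = suc (suc k)
  pos : ℕ → ℕ
  pos zero    = 0
  pos (suc i) = next (pos i) (x (suc (pos i)) ≟ᵇ a)
  head : ∀ i → x (pos i) ≡ a
  head zero    = x0
  head (suc i) with x (suc (pos i)) ≟ᵇ a
  ... | yes e = e
  ... | no ne with bool-cases (x (suc (pos i))) a
  ... | inj₁ e = contradiction e ne
  ... | inj₂ e = iso (suc (pos i)) e
  next-same : ∀ {b} k → b ≡ a → next k (b ≟ᵇ a) ≡ suc k
  next-same {b} k e with b ≟ᵇ a
  ... | yes _ = refl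
  ... | no ne = contradiction e ne
  next-other : ∀ {b} k → b ≡ not a → next k (b ≟ᵇ a) ≡ suc (suc k)
  next-other {b} k e with b ≟ᵇ a
  ... | yes e′ = contradiction (trans (sym e) e′) not-self
  ... | no _   = refl

-- A segment of length m + 2 fits into `a ∷ τ a z` with z of length m + 1: the closing a gains one
-- position, and if the segment starts inside a long block, that block gains the other.
central-step : ∀ m → (∀ {x k} → Special x → ∃ λ D → segment x k (suc m) ⊑ W D) →
  ∀ {x k} → Special x → ∃ λ D → segment x k (suc (suc m)) ⊑ W D
central-step m ih {x} {k} S = start (isolated-letter S)
  where
  w : List Bool
  w = segment x k (suc (suc m))
  from-head : ∀ {x k a} → Special x → x 0 ≡ a → (∀ k → x k ≡ not a → x (suc k) ≡ a) → At x k w → ∃ λ D → w ⊑ W D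
  from-head {x} {k} {a} S x0 iso hw with preimage x0 iso
  ... | x′ , I = step (cover I k)
    where
    open Image I using (pos)
    len-w : length w ≡ suc (suc m)
    len-w = length-segment _ _ (suc (suc m))
    step : ∃ (InBlock I k) → ∃ λ D → w ⊑ W D
    step (i , c) = lift (ih {x′} {i} (Special-preimage I S))
      where
      z : List Bool
      z = segment x′ i (suc m)
      enough : InBlock I k i → k + length w ≤ pos i + suc (length (τ a z))
      enough (inj₁ e) = farkas (k ∷ length w ∷ pos i ∷ length (τ a z) ∷ m ∷ length z ∷ [])
        ((# 0 ≃ # 2 by sym e) ∷ (# 1 ≃ 1+ (1+ # 4) by len-w) ∷ (# 5 ≼ # 3 by length-τ-≥ a z)
         ∷ (1+ # 4 ≃ # 5 by sym (length-segment x′ i (suc m))) ∷ []) (# 0 :+ # 1) (# 2 :+ 1+ # 3)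
      enough (inj₂ (e , l)) = farkas (k ∷ length w ∷ pos i ∷ length (τ a z) ∷ m ∷ length (τ a z₁) ∷ length z₁ ∷
        [])
        ((# 0 ≃ 1+ # 2 by sym e) ∷ (# 1 ≃ 1+ (1+ # 4) by len-w) ∷ (1+ (1+ # 5) ≃ # 3 by sym (two l))
         ∷ (# 6 ≼ # 5 by length-τ-≥ a z₁) ∷ (# 4 ≃ # 6 by sym (length-segment x′ (suc i) m)) ∷ [])
        (# 0 :+ # 1) (# 2 :+ 1+ # 3)
        where
        z₁ : List Bool
        z₁ = segment x′ (suc i) m
        two : x′ i ≡ not a → length (τ a (x′ i ∷ z₁)) ≡ suc (suc (length (τ a z₁)))
        two l rewrite l | block-other a = refl
      pos≤ : InBlock I k i → pos i ≤ k
      pos≤ (inj₁ e)       = ≤-reflexive e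
      pos≤ (inj₂ (e , _)) = ≤-trans (n≤1+n _) (≤-reflexive e)
      lift : (∃ λ D → z ⊑ W D) → ∃ λ D → w ⊑ W D
      lift (D , h) = a ∷ D , ⊑-trans (At-⊑ w (a ∷ τ a z) hw (At-image I i z (At-segment x′ i (suc m))) (pos≤ c)
        (enough c)) (closed-⊑ a h)
  start : (∃ λ a → ∀ k → x k ≡ not a → x (suc k) ≡ a) → ∃ λ D → w ⊑ W D
  start (a , iso) with bool-cases (x 0) a
  ... | inj₁ e = from-head S e iso (At-segment x k (suc (suc m)))
  -- A preimage requires a at position 0. If it is missing there, it stands at position 1, and the
  -- segment occurs again in the shifted word.
  ... | inj₂ e with recurrent {w = w} S (k , At-segment x k (suc (suc m)))
  ... | k′ , h = from-head (Special-suc S) (iso 0 e) (λ k → iso (suc k)) h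

special⇒central : ∀ m {x k} → Special x → ∃ λ D → segment x k m ⊑ W D
special⇒central zero          {x} {k} S = [] , [] , [] , refl
special⇒central (suc zero)    {x} {k} S = x k ∷ [] , [] , [] , refl
special⇒central (suc (suc m)) S         = central-step m (special⇒central (suc m)) S

-- Sturmian words from directive words

mutual
  image : Bool → (ℕ → Bool) → ℕ → Bool
  image a x zero    = a
  image a x (suc n) = imageStep a x (does (x 0 ≟ᵇ a)) n

  imageStep : Bool → (ℕ → Bool) → Bool → ℕ → Bool
  imageStep a x true  n       = image a (x ∘ suc) n
  imageStep a x false zero    = not a
  imageStep a x false (suc n) = image a (x ∘ suc) n

does-same : ∀ {c a} → c ≡ a → does (c ≟ᵇ a) ≡ true
does-same {false} refl = refl
does-same {true}  refl = refl

does-other : ∀ {c a} → c ≡ not a → does (c ≟ᵇ a) ≡ false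
does-other {a = false} refl = refl
does-other {a = true}  refl = refl

image-Image : ∀ a x → Image a (image a x) x
image-Image a x = record
  { pos = pos x ; pos-zero = refl
  ; head  = λ i → trans (cong (image a x) (sym (+-identityʳ (pos x i)))) (shift x i 0)
  ; short = λ {i} e → trans (pos-suc x i) (cong (λ b → width b + pos x i) (does-same e))
  ; long  = λ {i} e →
      trans (cong (image a x) (+-comm 1 (pos x i))) (trans (shift x i 1)
        (cong (λ b → imageStep a (λ j → x (i + j)) b 0) (does-other (trans (cong x (+-identityʳ i)) e)))) ,
      trans (pos-suc x i) (cong (λ b → width b + pos x i) (does-other e))
  }
  where
  width : Bool → ℕ
  width b = if b then 1 else 2
  pos : (ℕ → Bool) → ℕ → ℕ
  pos x zero    = 0
  pos x (suc i) = width (does (x 0 ≟ᵇ a)) + pos (x ∘ suc) i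
  shift : ∀ x i n → image a x (pos x i + n) ≡ image a (λ j → x (i + j)) n
  shift x zero    n = refl
  shift x (suc i) n with does (x 0 ≟ᵇ a) in e
  ... | true  rewrite e = shift (x ∘ suc) i n
  ... | false rewrite e = shift (x ∘ suc) i n
  pos-suc : ∀ x i → pos x (suc i) ≡ width (does (x i ≟ᵇ a)) + pos x i
  pos-suc x zero    = refl
  pos-suc x (suc i) = trans (cong (width (does (x 0 ≟ᵇ a)) +_) (pos-suc (x ∘ suc) i))
    (combine (width (does (x 0 ≟ᵇ a)) ∷ width (does (x (suc i) ≟ᵇ a)) ∷ pos (x ∘ suc) i ∷ []) []
      (# 0 :+ (# 1 :+ # 2)) (# 1 :+ (# 0 :+ # 2)))

Image-cong : ∀ {a x y x′} → (∀ n → y n ≡ x n) → Image a x x′ → Image a y x′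
Image-cong eq I = record
  { pos = pos ; pos-zero = pos-zero ; head = λ i → trans (eq (pos i)) (head i) ; short = short
  ; long = λ e → trans (eq _) (proj₁ (long e)) , proj₂ (long e) }
  where open Image I

-- The first letter is a whatever the argument is, so n common letters of the arguments give n + 1
-- common letters of the images. This gain makes the approximants converge.
image-local : ∀ a n {x y} → (∀ i → i < n → x i ≡ y i) → ∀ k → k ≤ n → image a x k ≡ image a y k
image-local a n       eq zero    _       = refl
image-local a (suc n) {x} {y} eq (suc k) (s≤s k≤) with does (x 0 ≟ᵇ a) | does (y 0 ≟ᵇ a) | cong
  (λ b → does (b ≟ᵇ a)) (eq 0 z<s)
... | true  | _ | refl = image-local a n (λ i h → eq (suc i) (s≤s h)) k k≤
image-local a (suc n) eq (suc zero)    (s≤s k≤) | false | _ | refl = refl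
image-local a (suc n) eq (suc (suc k)) (s≤s k≤) | false | _ | refl =
  image-local a n (λ i h → eq (suc i) (s≤s h)) k (≤-trans (n≤1+n k) k≤)

approximant : ℕ → Bool → ℕ → Bool
approximant zero    a _ = a
approximant (suc k) a   = image a (approximant k (not a))

-- The Fibonacci word, with directive word a, not a, a, ..., taken as the diagonal of its
-- approximants because the equation in `fibonacci-Image` is not a structural recursion. It is the
-- Sturmian word from which those containing a given `W D` are built.
fibonacci : Bool → ℕ → Bool
fibonacci a n = approximant (suc n) a n

approximant-stable : ∀ k d a i → i < k → approximant (k + d) a i ≡ approximant k a i
approximant-stable (suc k) d a i (s≤s i≤k) = image-local a k (λ j → approximant-stable k d (not a) j) i i≤k

fibonacci-Image : ∀ a → Image a (fibonacci a) (fibonacci (not a))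
fibonacci-Image a = Image-cong (λ n → image-local a n (λ i h → agree n i h) n ≤-refl)
  (image-Image a (fibonacci (not a)))
  where
  agree : ∀ n i → i < n → approximant n (not a) i ≡ fibonacci (not a) i
  agree n i h with m≤n⇒∃[o]m+o≡n h
  ... | d , refl = approximant-stable (suc i) d (not a) i ≤-refl

fibonacci-special : ∀ a → Special (fibonacci a)
fibonacci-special a = (λ m → has m a) , λ m → unique m a
  where
  has : ∀ m a → ∃ λ w → length w ≡ m × RightSpecial (fibonacci a) w
  has zero    a = [] , refl , letter
    where
    open Image (fibonacci-Image a)
    letter : RightSpecial (fibonacci a) []
    letter c with bool-cases c a
    ... | inj₁ refl = 0 , refl , tt
    ... | inj₂ refl = suc (pos 0) , proj₁ (long {0} refl) , tt
  has (suc m) a with has m (not a)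
  ... | z , refl , h = special-cut (suc m) (a ∷ τ a z) (s≤s (length-τ-≥ a z))
    (special-image (fibonacci-Image a) h)
  unique : ∀ m a → UniqueSpecial m (fibonacci a)
  unique zero    a []      []       _ _ _  _  = refl
  unique zero    a []      (_ ∷ _)  _ _ () _
  unique zero    a (_ ∷ _) _        _ _ _  ()
  unique (suc m) a = UniqueSpecial-image (fibonacci-Image a) m (unique m (not a))

central⇒special : ∀ D → ∃ λ x → Special x × Fac x (W D)
central⇒special []      = fibonacci true , fibonacci-special true , 0 , tt
central⇒special (a ∷ D) with central⇒special D
... | x , S , h = image a x , Special-image (image-Image a x) S , Fac-image (image-Image a x) h

-- Doubled factors and the equivalence

At-dbl : ∀ A {x} z → At x 0 z → At (dbl A x) 0 (double A z)
At-dbl A     []      _       = tt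
At-dbl A {x} (c ∷ z) (refl , h) with A (x 0) in e | At-dbl A {x ∘ suc} z (At-shift z (λ _ → refl) h)
... | true  | ih = refl , cong (λ b → dblStep A x b 0) e ,
  At-shift (double A z) (λ n → cong (λ b → dblStep A x b (suc n)) e) ih
... | false | ih = refl , At-shift (double A z) (λ n → cong (λ b → dblStep A x b n) e) ih

length-double-≥ : ∀ A w → length w ≤ length (double A w)
length-double-≥ A []      = z≤n
length-double-≥ A (c ∷ w) = subst (suc (length w) ≤_) (sym (length-++ (doubled A c)))
  (+-mono-≤ one (length-double-≥ A w))
  where
  one : 1 ≤ length (doubled A c)
  one with A c
  ... | true  = s≤s z≤n
  ... | false = s≤s z≤n

Central⇒Factor : ∀ u → Central u → FactorOfDoubleSturmian u
Central⇒Factor u (A , D , h) with central⇒special D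
... | x , S , k , f = dbl A x , (x , A , 0 , Special⇒Sturmian S , λ n → refl) , occurrence
  where
  v : List Bool
  -- Doubling displaces a position by an amount that depends on all earlier letters, so the prefix
  -- of x before the occurrence is carried along.
  v = segment x 0 k ++ W D
  at-v : At x 0 v
  at-v = At-++⁺ (segment x 0 k) (At-segment x 0 k) (subst (λ m → At x m (W D)) (sym (length-segment x 0 k)) f)
  u⊑ : u ⊑ double A v
  u⊑ = ⊑-trans h
    (⊑-concatMap (doubled A) (segment x 0 k , [] , cong (segment x 0 k ++_) (sym (++-identityʳ (W D)))))
  occurrence : IsFactor u (dbl A x)
  occurrence with Fac-⊑ u⊑ (0 , At-dbl A v at-v)
  ... | j , hu = j , At⇒factorAt u hu

Factor⇒Central : ∀ u → FactorOfDoubleSturmian u → Central u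
Factor⇒Central u (y , (x , A , k , S , eq) , k′ , e) with special⇒central (k + k′ + length u) {x} {0}
  (Sturmian⇒Special S)
... | D , h = A , D , ⊑-trans (At-⊑ u (double A z) at-u (At-dbl A z (At-segment x 0 M)) z≤n
    (≤-trans (≤-reflexive (sym (length-segment x 0 M))) (length-double-≥ A z)))
  (⊑-concatMap (doubled A) h)
  where
  M : ℕ
  -- Doubling shortens no word, so the doubled prefix of this length reaches past the occurrence of
  -- u.
  M = k + k′ + length u
  z : List Bool
  z = segment x 0 M
  at-u : At (dbl A x) (k + k′) u
  at-u = At-shift u (λ n → trans (cong (dbl A x) (+-assoc k k′ n)) (sym (eq (k′ + n))))
    (subst (At y k′) e (At-factorAt y k′ (length u)))

theorem1 : (u : List Bool) → u ≢ [] → MuLe u 3 ⇔ FactorOfDoubleSturmian u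
theorem1 u ne = mk⇔ (λ h → Central⇒Factor u (MuLe⇒Central u h)) (λ h → Central⇒MuLe u ne (Factor⇒Central u h))
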